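{- For every fixed integer $k \geq 3$, there is an algorithm which, given an input graph or digraph $G$ with $m$ edges, computes the number of homomorphisms from $C_k$ to $G$ in time $\tilde{O}(m^{2 - 1/\lceil k/2 \rceil})$. Here $C_k$ denotes the undirected cycle with $k$ vertices if $G$ is an undirected graph, and the directed cycle with $k$ vertices if $G$ is a digraph.
   Context: A homomorphism between undirected graphs $H\to G$ is a map $V(H)\to V(G)$ sending edges to edges; a homomorphism between digraphs is a map sending each directed edge $(u,v)$ to a directed edge $(\varphi(u),\varphi(v))$. $\tilde O$ hides polylogarithmic factors; implicit constants may depend on $k$. No degeneracy assumption is made on $G$. -}

module Defs where

open import Data.Bool.Base using (if_then_else_)
open import Data.Fin.Base using (Fin; toℕ)
open import Data.Fin.Properties using (all?)
open import Data.List.Base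
  using (List; []; _∷_; length; filter; allFin; cartesianProductWith; concatMap)
open import Data.List.Membership.Propositional using (_∈_)
open import Data.List.Relation.Unary.AllPairs using (AllPairs)
open import Data.List.Relation.Unary.Unique.Propositional using (Unique)
open import Data.Nat.Base
  using (ℕ; zero; suc; _+_; _*_; _∸_; _^_; _⊔_; _≤_; _<_; s≤s; _<ᵇ_; _≡ᵇ_)
open import Data.Nat.Logarithm using (⌈log₂_⌉)
import Data.Nat.Properties as ℕ
open import Data.Product.Base using (_×_; _,_; ∃-syntax; Σ-syntax; swap)
open import Data.Sum.Base using (_⊎_; inj₁; inj₂)
import Data.Sum.Base as Sum
open import Data.Vec.Base using (Vec; []; _∷_; lookup)
open import Function.Bundles using (_⇔_)
open import Level using (0ℓ)
open import Relation.Binary.Core using (Rel; _Preserves_⟶_)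
open import Relation.Binary.Definitions using (Decidable; Symmetric)
open import Relation.Binary.PropositionalEquality.Core
  using (_≡_; _≢_; sym; trans; cong; subst)
open import Relation.Nullary.Decidable
  using (Dec; map′; _×-dec_; _⊎-dec_; _→-dec_)
open import Relation.Nullary.Negation.Core using (¬_)

-- Loops and antiparallel arcs are allowed.
record Digraph : Set₁ where
  infix 4 _⇒_ _⇒?_
  field
    order : ℕ
    _⇒_   : Rel (Fin order) 0ℓ
    _⇒?_  : Decidable _⇒_

-- An undirected simple graph is given by its symmetric, irreflexive
-- adjacency relation.
record Graph : Set₁ where
  field
    adjacency : Digraph
  open Digraph adjacency public renaming (_⇒_ to _~_; _⇒?_ to _~?_)
  field
    ~-sym     : Symmetric _~_
    ~-irrefl  : ∀ v → ¬ (v ~ v)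

-- The orders and (for undirected edges) orientations are arbitrary: an
-- algorithm must cope with every listing.
record ArcList (D : Digraph) : Set where
  open Digraph D
  field
    list     : List (Fin order × Fin order)
    distinct : Unique list
    complete : ∀ u v → ((u , v) ∈ list) ⇔ (u ⇒ v)

record EdgeList (G : Graph) : Set where
  open Graph G
  field
    list     : List (Fin order × Fin order)
    distinct : AllPairs (λ e f → e ≢ f × e ≢ swap f) list
    complete : ∀ u v → ((u , v) ∈ list ⊎ (v , u) ∈ list) ⇔ (u ~ v)

CycleArc : ∀ k → Rel (Fin k) 0ℓ
CycleArc k i j = (toℕ j ≡ suc (toℕ i)) ⊎ (suc (toℕ i) ≡ k × toℕ j ≡ 0)

cycleArc? : ∀ k → Decidable (CycleArc k)
cycleArc? k i j =
  (toℕ j ℕ.≟ suc (toℕ i)) ⊎-dec ((suc (toℕ i) ℕ.≟ k) ×-dec (toℕ j ℕ.≟ 0))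

directedCycle : ℕ → Digraph
directedCycle k = record
  { order = k ; _⇒_ = CycleArc k ; _⇒?_ = cycleArc? k }

cycle : ∀ k → 3 ≤ k → Graph
cycle k 3≤k = record
  { adjacency = record
    { order = k
    ; _⇒_   = λ i j → CycleArc k i j ⊎ CycleArc k j i
    ; _⇒?_  = λ i j → cycleArc? k i j ⊎-dec cycleArc? k j i
    }
  ; ~-sym    = Sum.swap
  ; ~-irrefl = λ i → Sum.[ noLoop i , noLoop i ]
  }
  where
  3≰1 : ¬ (3 ≤ 1)
  3≰1 (s≤s ())

  noLoop : ∀ i → ¬ CycleArc k i i
  noLoop i (inj₁ i≡1+i) = ℕ.1+n≢n (sym i≡1+i)
  noLoop i (inj₂ (1+i≡k , i≡0)) =
    3≰1 (subst (3 ≤_) (trans (sym 1+i≡k) (cong suc i≡0)) 3≤k)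

-- Vertex maps are vectors, so that equal maps are propositionally equal.
IsHom : (H D : Digraph) → Vec (Fin (Digraph.order D)) (Digraph.order H) → Set
IsHom H D φ = lookup φ Preserves Digraph._⇒_ H ⟶ Digraph._⇒_ D

isHom? : ∀ H D φ → Dec (IsHom H D φ)
isHom? H D φ = map′ (λ h {u} {v} → h u v) (λ h u v → h {u} {v})
  (all? λ u → all? λ v →
    Digraph._⇒?_ H u v →-dec Digraph._⇒?_ D (lookup φ u) (lookup φ v))

allMaps : ∀ k n → List (Vec (Fin n) k)
allMaps zero    n = [] ∷ []
allMaps (suc k) n = cartesianProductWith _∷_ (allFin n) (allMaps k n)

homCount : Digraph → Digraph → ℕ
homCount H D =
  length (filter (isHom? H D) (allMaps (Digraph.order H) (Digraph.order D)))

homCountᵘ : Graph → Graph → ℕ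
homCountᵘ H G = homCount (Graph.adjacency H) (Graph.adjacency G)

Reg : Set
Reg = ℕ

data Op : Set where
  add sub mul lt eq : Op

⟦_⟧ : Op → ℕ → ℕ → ℕ
⟦ add ⟧ x y = x + y
⟦ sub ⟧ x y = x ∸ y
⟦ mul ⟧ x y = x * y
⟦ lt  ⟧ x y = if x <ᵇ y then 1 else 0
⟦ eq  ⟧ x y = if x ≡ᵇ y then 1 else 0

-- Structured control flow costs only a constant factor against jumps,
-- since the program is fixed.
infixr 5 _⨾_
data Program : Set where
  skip   : Program
  const  : Reg → ℕ → Program              -- r ≔ literal
  op     : Op → Reg → Reg → Reg → Program -- r ≔ r₁ ∙ r₂
  load   : Reg → Reg → Program            -- r ≔ mem[r₁]
  store  : Reg → Reg → Program            -- mem[r] ≔ r₁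
  _⨾_    : Program → Program → Program
  ifNZ   : Reg → Program → Program → Program
  whileNZ : Reg → Program → Program

_[_≔_] : (ℕ → ℕ) → ℕ → ℕ → (ℕ → ℕ)
(f [ a ≔ x ]) b = if a ≡ᵇ b then x else f b

record State : Set where
  constructor ⟨_,_⟩
  field
    reg mem : ℕ → ℕ
open State public

-- w ⊢ p , σ ⇓[ t ] τ : with w-bit words, p started in σ halts in τ after
-- t unit-cost steps.  There is no rule for an operation whose result does
-- not fit into a word, so a derivation also certifies that no overflow
-- occurs; addresses are register contents and hence words as well.
infix 4 _⊢_,_⇓[_]_
data _⊢_,_⇓[_]_ (w : ℕ) : Program → State → ℕ → State → Set where
  ⇓skip  : ∀ {σ} → w ⊢ skip , σ ⇓[ 1 ] σ
  ⇓const : ∀ {σ r x} → x < 2 ^ w →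
           w ⊢ const r x , σ ⇓[ 1 ] ⟨ reg σ [ r ≔ x ] , mem σ ⟩
  ⇓op    : ∀ {σ o r r₁ r₂} → ⟦ o ⟧ (reg σ r₁) (reg σ r₂) < 2 ^ w →
           w ⊢ op o r r₁ r₂ , σ
             ⇓[ 1 ] ⟨ reg σ [ r ≔ ⟦ o ⟧ (reg σ r₁) (reg σ r₂) ] , mem σ ⟩
  ⇓load  : ∀ {σ r r₁} → mem σ (reg σ r₁) < 2 ^ w →
           w ⊢ load r r₁ , σ
             ⇓[ 1 ] ⟨ reg σ [ r ≔ mem σ (reg σ r₁) ] , mem σ ⟩
  ⇓store : ∀ {σ r r₁} →
           w ⊢ store r r₁ , σ
             ⇓[ 1 ] ⟨ reg σ , mem σ [ reg σ r ≔ reg σ r₁ ] ⟩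
  ⇓seq   : ∀ {p q σ τ υ s t} → w ⊢ p , σ ⇓[ s ] τ → w ⊢ q , τ ⇓[ t ] υ →
           w ⊢ p ⨾ q , σ ⇓[ s + t ] υ
  ⇓then  : ∀ {r p q σ τ t} → reg σ r ≢ 0 → w ⊢ p , σ ⇓[ t ] τ →
           w ⊢ ifNZ r p q , σ ⇓[ suc t ] τ
  ⇓else  : ∀ {r p q σ τ t} → reg σ r ≡ 0 → w ⊢ q , σ ⇓[ t ] τ →
           w ⊢ ifNZ r p q , σ ⇓[ suc t ] τ
  ⇓stop  : ∀ {r p σ} → reg σ r ≡ 0 → w ⊢ whileNZ r p , σ ⇓[ 1 ] σ
  ⇓loop  : ∀ {r p σ τ υ s t} → reg σ r ≢ 0 →
           w ⊢ p , σ ⇓[ s ] τ → w ⊢ whileNZ r p , τ ⇓[ t ] υ →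
           w ⊢ whileNZ r p , σ ⇓[ suc (s + t) ] υ

contents : List ℕ → ℕ → ℕ
contents []       a       = 0
contents (x ∷ xs) zero    = x
contents (x ∷ xs) (suc a) = contents xs a

-- Memory initially holds n, m, u₁, v₁, …, uₘ, vₘ and is zero elsewhere.
initial : ∀ n → List (Fin n × Fin n) → State
initial n es = ⟨ (λ _ → 0) , contents (n ∷ length es ∷ concatMap ends es) ⟩
  where
  ends : Fin n × Fin n → List ℕ
  ends (u , v) = toℕ u ∷ toℕ v ∷ []

output : State → ℕ
output σ = reg σ 0

record GraphProblem : Set₂ where
  field
    Instance : Set₁
    vertices : Instance → ℕ
    edges    : (x : Instance) → List (Fin (vertices x) × Fin (vertices x))
    answer   : Instance → ℕ

-- t ≤ C · (1 + ⌈log₂ m⌉)^d · m^(a/b), raised to the b-th power (b ≥ 1) to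
-- avoid the fractional exponent.  For m = 0 the bound is read as at m = 1,
-- since no program takes zero steps.
TimeBound : (C d a b m t : ℕ) → Set
TimeBound C d a b m t =
  t ^ b ≤ (C * (1 + ⌈log₂ m ⌉) ^ d) ^ b * (1 ⊔ m) ^ a

-- One program and constants c, C, d serve all instances.  The word length
-- is any w ≥ c · log₂ (2 + n + m), i.e. words of O(log (n + m)) bits
-- suffice and longer ones do no harm.
SolvableInÕm^ : (a b : ℕ) → GraphProblem → Set₁
SolvableInÕm^ a b P =
  Σ[ p ∈ Program ] Σ[ c ∈ ℕ ] Σ[ C ∈ ℕ ] Σ[ d ∈ ℕ ] ∀ x w →
    let n = vertices x
        m = length (edges x)
    in (2 + n + m) ^ c ≤ 2 ^ w →
       ∃[ t ] ∃[ σ ]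
         (w ⊢ p , initial n (edges x) ⇓[ t ] σ)
         × output σ ≡ answer x
         × TimeBound C d a b m t
  where open GraphProblem P

CountHomsᵘ : Graph → GraphProblem
CountHomsᵘ H = record
  { Instance = ∃[ G ] EdgeList G
  ; vertices = λ (G , _) → Graph.order G
  ; edges    = λ (_ , es) → EdgeList.list es
  ; answer   = λ (G , _) → homCountᵘ H G
  }

CountHoms : Digraph → GraphProblem
CountHoms H = record
  { Instance = ∃[ D ] ArcList D
  ; vertices = λ (D , _) → Digraph.order D
  ; edges    = λ (_ , as) → ArcList.list as
  ; answer   = λ (D , _) → homCount H D
  }

{-# OPTIONS --safe #-}
-- Let r = ⌈k/2⌉, let A be the adjacency matrix, and call a vertex high if its
-- out-degree d satisfies d ^ r > m.  Homomorphisms from the cycle are counted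
-- by tr A^k.  With H and L the diagonal projections to the high and the low
-- vertices and B = L A, cyclicity of the trace gives
--   tr A^k = tr B^k + Σ_{i<k} tr (H A^(k-i) B^i).
-- There are at most m^(1-1/r) high vertices, and for each of them all k terms
-- of the sum are found by one dynamic program over the arcs, in time O(m).
-- For tr B^k, the walks of r and of k - r steps leaving low vertices are
-- enumerated, at most m · (m^(1/r))^(r-1) many, and matched in a table indexed
-- by their ends.  Both costs are m^(2-1/r).  An undirected graph is treated as
-- the digraph containing both orientations of every edge.
--
-- The program is written in a small language whose only effect is to add to
-- array cells.  If a statement writes no array that it reads, its effect is a
-- plain sum over its loops, so that only these sums have to be evaluated.
module Submission where

open import Defs
open import Data.Bool.Base using (Bool; true; false; T; if_then_else_)
open import Data.Fin.Base using (Fin; zero; suc; toℕ)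
open import Data.Fin.Properties using (toℕ-injective; toℕ<n)
open import Data.List.Base
  using (List; []; _∷_; _++_; length; map; filter; tabulate; allFin; cartesianProductWith; concatMap)
open import Data.List.Membership.Propositional using (_∈_; _∉_)
open import Data.List.Properties using (filter-≐; filter-none; filter-++; length-++; length-map; map-++; map-∘)
open import Data.List.Relation.Unary.All using (All; []; _∷_)
import Data.List.Relation.Unary.All as All
open import Data.List.Relation.Unary.AllPairs using (AllPairs; []; _∷_)
import Data.List.Relation.Unary.AllPairs as AllPairs
open import Data.List.Relation.Unary.Any using (here; there)
open import Data.List.Relation.Unary.Unique.Propositional using (Unique)
open import Data.Nat.Base
open import Data.Nat.ListAction using () renaming (sum to sumᴸ)
open import Data.Nat.Properties
open import Data.Nat.Solver using (module +-*-Solver)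
open import Data.Product.Base using (_×_; _,_; proj₁; proj₂; ∃-syntax; Σ-syntax; swap)
open import Data.Sum.Base using (_⊎_; inj₁; inj₂)
open import Data.Unit.Base using (⊤; tt)
open import Data.Vec.Base using (Vec; []; _∷_; lookup)
open import Function.Base using (_∘_)
open import Function.Bundles using (module Equivalence)
open import Level using (0ℓ)
open import Relation.Binary.Core using (Rel)
open import Relation.Binary.Definitions using (Decidable)
open import Relation.Binary.PropositionalEquality
open import Relation.Nullary using (Dec; yes; no; does; contradiction; _×-dec_)
open import Relation.Unary using (Pred) renaming (Decidable to Decidable₁)

import Data.Product.Base as Product
import Algebra.Properties.CommutativeSemigroup as CommutativeSemigroupProperties

-- The bound is in m alone while n is arbitrary, so no loop may range over vertices and no table may
-- be cleared. Vertices are reached only through arcs, and memory that starts at zero serves as the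
-- empty n by n tables.
--
-- The i-th term of the sum counts the closed walks whose first high vertex stands at position i,
-- read from that vertex on. The terms differ only in where the low tail begins, so two arrays per
-- length carry them all: walks from a high vertex, and the accumulated `Q`. Enumerating r-step
-- walks costs m for the first arc and at most D for each of the other r - 1 steps, D being the
-- integer r-th root; only the analysis uses D, the program compares powers.
--
-- The machine gets stuck on overflow. Cells only grow, so bounding the final sums excludes overflow
-- at every moment; each phase raises the bound to a fixed power, and k fixes the number of phases.
-- For the sum rule, a phase writes arrays with larger numbers than those it reads. The exception is
-- the construction of adjacency lists, which reads the degrees it increments and is verified by a
-- loop invariant.

module +-CS = CommutativeSemigroupProperties +-commutativeSemigroup
module *-CS = CommutativeSemigroupProperties *-commutativeSemigroup

-- Finite sums

-- The largest index is split off first because compiled loops count down: that summand belongs to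
-- the iteration that runs first.
Σ< : ℕ → (ℕ → ℕ) → ℕ
Σ< zero    f = 0
Σ< (suc n) f = f n + Σ< n f

Σ-cong : ∀ n {f g} → (∀ x → x < n → f x ≡ g x) → Σ< n f ≡ Σ< n g
Σ-cong zero    h = refl
Σ-cong (suc n) h = cong₂ _+_ (h n ≤-refl) (Σ-cong n λ x x<n → h x (m<n⇒m<1+n x<n))

Σ-cong′ : ∀ n {f g} → (∀ x → f x ≡ g x) → Σ< n f ≡ Σ< n g
Σ-cong′ n h = Σ-cong n λ x _ → h x

Σ-mono : ∀ n {f g} → (∀ x → x < n → f x ≤ g x) → Σ< n f ≤ Σ< n g
Σ-mono zero    h = z≤n
Σ-mono (suc n) h = +-mono-≤ (h n ≤-refl) (Σ-mono n λ x x<n → h x (m<n⇒m<1+n x<n))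

Σ-const : ∀ n c → Σ< n (λ _ → c) ≡ n * c
Σ-const zero    c = refl
Σ-const (suc n) c = cong (c +_) (Σ-const n c)

Σ-zero : ∀ n {f} → (∀ x → x < n → f x ≡ 0) → Σ< n f ≡ 0
Σ-zero n h = trans (Σ-cong n h) (trans (Σ-const n 0) (*-zeroʳ n))

Σ-+ : ∀ n f g → Σ< n (λ x → f x + g x) ≡ Σ< n f + Σ< n g
Σ-+ zero    f g = refl
Σ-+ (suc n) f g =
  trans (cong (f n + g n +_) (Σ-+ n f g)) (+-CS.interchange (f n) (g n) _ _)

Σ-*ˡ : ∀ n c f → c * Σ< n f ≡ Σ< n (λ x → c * f x)
Σ-*ˡ zero    c f = *-zeroʳ c
Σ-*ˡ (suc n) c f = trans (*-distribˡ-+ c (f n) _) (cong (c * f n +_) (Σ-*ˡ n c f))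

Σ-*ʳ : ∀ n c f → Σ< n f * c ≡ Σ< n (λ x → f x * c)
Σ-*ʳ n c f =
  trans (*-comm _ c) (trans (Σ-*ˡ n c f) (Σ-cong′ n λ x → *-comm c (f x)))

Σ-swap : ∀ m n (f : ℕ → ℕ → ℕ) →
         Σ< m (λ x → Σ< n (f x)) ≡ Σ< n (λ y → Σ< m (λ x → f x y))
Σ-swap zero    n f = sym (Σ-zero n λ _ _ → refl)
Σ-swap (suc m) n f =
  trans (cong (Σ< n (f m) +_) (Σ-swap m n f)) (sym (Σ-+ n (f m) _))

-- The Kronecker delta is the machine's equality test, so tests in programs evaluate to it by
-- computation.
δ : ℕ → ℕ → ℕ
δ = ⟦ eq ⟧

sgn : ℕ → ℕ
sgn zero    = 0
sgn (suc _) = 1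

sgn≤1 : ∀ x → sgn x ≤ 1
sgn≤1 zero    = z≤n
sgn≤1 (suc x) = ≤-refl

δ-refl : ∀ i → δ i i ≡ 1
δ-refl zero    = refl
δ-refl (suc i) = δ-refl i

δ-refl-* : ∀ i x → δ i i * x ≡ x
δ-refl-* i x = trans (cong (_* x) (δ-refl i)) (*-identityˡ x)

δ-≢ : ∀ {i j} → i ≢ j → δ i j ≡ 0
δ-≢ {zero}  {zero}  i≢j = contradiction refl i≢j
δ-≢ {zero}  {suc j} i≢j = refl
δ-≢ {suc i} {zero}  i≢j = refl
δ-≢ {suc i} {suc j} i≢j = δ-≢ λ e → i≢j (cong suc e)

δ-sym : ∀ i j → δ i j ≡ δ j i
δ-sym zero    zero    = refl
δ-sym zero    (suc j) = refl
δ-sym (suc i) zero    = refl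
δ-sym (suc i) (suc j) = δ-sym i j

bit≤1 : ∀ (b : Bool) → (if b then 1 else 0) ≤ 1
bit≤1 true  = ≤-refl
bit≤1 false = z≤n

Σ-δ : ∀ n {i} (f : ℕ → ℕ) → i < n → Σ< n (λ x → δ i x * f x) ≡ f i
Σ-δ (suc n) {i} f i<1+n with i ≟ n
... | yes refl = begin
  δ i i * f i + Σ< i (λ x → δ i x * f x)
    ≡⟨ cong₂ _+_ (trans (cong (_* f i) (δ-refl i)) (*-identityˡ (f i)))
                 (Σ-zero i λ x x<i → cong (_* f x) (δ-≢ (>⇒≢ x<i))) ⟩
  f i + 0 ≡⟨ +-identityʳ (f i) ⟩
  f i     ∎
  where open ≡-Reasoning
... | no i≢n = trans (cong (λ z → z * f n + Σ< n (λ x → δ i x * f x)) (δ-≢ i≢n))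
                     (Σ-δ n f (≤∧≢⇒< (≤-pred i<1+n) i≢n))

-- An accumulator language and its compilation

-- get a i j is cell (i , j) of array a, for a fixed a; it is stored at address
-- (a * N + i) * N + j, where N exceeds all indices.
data Expr (d : ℕ) : Set where
  var : Fin d → Expr d
  lit : ℕ → Expr d
  bin : Op → Expr d → Expr d → Expr d
  get : ℕ → Expr d → Expr d → Expr d

infixr 5 _⨟_
-- Loop bounds and bound variables are array cells, never computed values: a bound on the memory
-- then bounds every variable.
data Stmt (d : ℕ) : Set where
  acc  : ℕ → Expr d → Expr d → Expr d → Stmt d
  _⨟_  : Stmt d → Stmt d → Stmt d
  when : Expr d → Stmt d → Stmt d
  for  : ℕ → Expr d → Expr d → Stmt (suc d) → Stmt d
  bind : ℕ → Expr d → Expr d → Stmt (suc d) → Stmt d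

Env : ℕ → Set
Env = Vec ℕ

Mem : Set
Mem = ℕ → ℕ → ℕ → ℕ

private variable
  d : ℕ

eval : Expr d → Env d → Mem → ℕ
eval (var x)     ρ M = lookup ρ x
eval (lit x)     ρ M = x
eval (bin o a b) ρ M = ⟦ o ⟧ (eval a ρ M) (eval b ρ M)
eval (get a i j) ρ M = M a (eval i ρ M) (eval j ρ M)

-- All expressions are evaluated in `M`, also those reached after earlier writes. This is the true
-- effect when the arrays that are read keep their contents, which `Reads*` and `Writes` ensure.
contrib : Stmt d → Env d → Mem → Mem
contrib (acc a i j e)  ρ M a′ i′ j′ =
  δ a a′ * (δ (eval i ρ M) i′ * (δ (eval j ρ M) j′ * eval e ρ M))
contrib (s ⨟ t)        ρ M a′ i′ j′ = contrib s ρ M a′ i′ j′ + contrib t ρ M a′ i′ j′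
contrib (when e s)     ρ M a′ i′ j′ = sgn (eval e ρ M) * contrib s ρ M a′ i′ j′
contrib (for a i j s)  ρ M a′ i′ j′ =
  Σ< (eval (get a i j) ρ M) λ x → contrib s (x ∷ ρ) M a′ i′ j′
contrib (bind a i j s) ρ M a′ i′ j′ =
  contrib s (eval (get a i j) ρ M ∷ ρ) M a′ i′ j′

infixl 6 _⊕_
_⊕_ : Mem → Mem → Mem
(M ⊕ D) a i j = M a i j + D a i j

infix 4 _≋_
_≋_ : Mem → Mem → Set
M ≋ M′ = ∀ a i j → M a i j ≡ M′ a i j

-- Used with `_< θ`, against `Writes (θ ≤_)`: arrays are stratified by number, with reads below the
-- threshold and writes from it on.
Reads : (ℕ → Set) → Expr d → Set
Reads P (var x)     = ⊤
Reads P (lit x)     = ⊤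
Reads P (bin o a b) = Reads P a × Reads P b
Reads P (get a i j) = P a × Reads P i × Reads P j

Reads* : (ℕ → Set) → Stmt d → Set
Reads* P (acc a i j e)  = Reads P i × Reads P j × Reads P e
Reads* P (s ⨟ t)        = Reads* P s × Reads* P t
Reads* P (when e s)     = Reads P e × Reads* P s
Reads* P (for a i j s)  = Reads P (get {_} a i j) × Reads* P s
Reads* P (bind a i j s) = Reads P (get {_} a i j) × Reads* P s

Writes : (ℕ → Set) → Stmt d → Set
Writes P (acc a i j e)  = P a
Writes P (s ⨟ t)        = Writes P s × Writes P t
Writes P (when e s)     = Writes P s
Writes P (for a i j s)  = Writes P s
Writes P (bind a i j s) = Writes P s

Writes-map : ∀ {P Q : ℕ → Set} → (∀ {a} → P a → Q a) → (s : Stmt d) → Writes P s → Writes Q s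
Writes-map f (acc a i j e)  p       = f p
Writes-map f (s ⨟ t)        (p , q) = Writes-map f s p , Writes-map f t q
Writes-map f (when e s)     p       = Writes-map f s p
Writes-map f (for a i j s)  p       = Writes-map f s p
Writes-map f (bind a i j s) p       = Writes-map f s p

contrib-quiet : ∀ (s : Stmt d) {ρ M a} i j → Writes (_≢ a) s → contrib s ρ M a i j ≡ 0
contrib-quiet (acc a′ _ _ _)      i j p       = cong (_* _) (δ-≢ p)
contrib-quiet (s ⨟ t)             i j (p , q) = cong₂ _+_ (contrib-quiet s i j p) (contrib-quiet t i j q)
contrib-quiet (when e s) {ρ} {M}  i j p       =
  trans (cong (sgn (eval e ρ M) *_) (contrib-quiet s i j p)) (*-zeroʳ (sgn (eval e ρ M)))
contrib-quiet (for a′ i′ j′ s) {ρ} {M} i j p  =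
  Σ-zero (eval (get a′ i′ j′) ρ M) λ _ _ → contrib-quiet s i j p
contrib-quiet (bind _ _ _ s)      i j p       = contrib-quiet s i j p

-- An exponent: every value arising in a run over words ≤ Ω is ≤ Ω ^ size.
size : Expr d → ℕ
size (var x)     = 1
size (lit x)     = x
size (bin o a b) = suc (size a + size b)
size (get a i j) = 2 + a + (size i + size j)

size* : Stmt d → ℕ
size* (acc a i j e)  = 2 + a + (size i + size j) + size e
size* (s ⨟ t)        = suc (size* s + size* t)
size* (when e s)     = size e + size* s
size* (for a i j s)  = size (get a i j) + size* s
size* (bind a i j s) = size (get a i j) + size* s

-- Polynomial bounds on values and contributions

module _ {Ω : ℕ} (2≤Ω : 2 ≤ Ω) where

  private instance
    Ω≢0 : NonZero Ω
    Ω≢0 = >-nonZero (≤-trans (s≤s z≤n) 2≤Ω)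

  1≤^ : ∀ x → 1 ≤ Ω ^ x
  1≤^ x = m^n>0 Ω x

  -- This lets a literal enter `size` with its own value; it also bounds the array number inside an
  -- address.
  lit<^ : ∀ x → x < Ω ^ x
  lit<^ zero    = ≤-refl
  lit<^ (suc x) = begin-strict
    suc x           ≡⟨ +-comm 1 x ⟩
    x + 1           <⟨ +-mono-<-≤ (lit<^ x) (1≤^ x) ⟩
    Ω ^ x + Ω ^ x   ≡⟨ cong (Ω ^ x +_) (sym (+-identityʳ (Ω ^ x))) ⟩
    2 * Ω ^ x       ≤⟨ *-monoˡ-≤ (Ω ^ x) 2≤Ω ⟩
    Ω * Ω ^ x       ∎
    where open ≤-Reasoning

  ≤^ : ∀ {x y} → x ≤ y → Ω ^ x ≤ Ω ^ y
  ≤^ = ^-monoʳ-≤ Ω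

  ≤^1 : ∀ {x y} → x ≤ Ω → 1 ≤ y → x ≤ Ω ^ y
  ≤^1 x≤Ω 1≤y = ≤-trans x≤Ω (≤-trans (≤-reflexive (sym (^-identityʳ Ω))) (≤^ 1≤y))

  *≤^ : ∀ {x y} a b → x ≤ Ω ^ a → y ≤ Ω ^ b → x * y ≤ Ω ^ (a + b)
  *≤^ a b x≤ y≤ =
    ≤-trans (*-mono-≤ x≤ y≤) (≤-reflexive (sym (^-distribˡ-+-* Ω a b)))

  +≤^ : ∀ {x y} a b → x ≤ Ω ^ a → y ≤ Ω ^ b → x + y ≤ Ω ^ suc (a + b)
  +≤^ {x} {y} a b x≤ y≤ = begin
    x + y                          ≤⟨ +-mono-≤ (≤-trans x≤ (≤^ (m≤m+n a b))) (≤-trans y≤ (≤^ (m≤n+m b a))) ⟩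
    Ω ^ (a + b) + Ω ^ (a + b)      ≡⟨ cong (Ω ^ (a + b) +_) (sym (+-identityʳ _)) ⟩
    2 * Ω ^ (a + b)                ≤⟨ *-monoˡ-≤ _ 2≤Ω ⟩
    Ω ^ suc (a + b)                ∎
    where open ≤-Reasoning

  op≤^ : ∀ o {x y} a b → x ≤ Ω ^ a → y ≤ Ω ^ b → ⟦ o ⟧ x y ≤ Ω ^ suc (a + b)
  op≤^ add a b x≤ y≤ = +≤^ a b x≤ y≤
  op≤^ sub {x} {y} a b x≤ y≤ = ≤-trans (m∸n≤m x y) (≤-trans x≤ (≤^ (m≤n⇒m≤1+n (m≤m+n a b))))
  op≤^ mul a b x≤ y≤ = ≤-trans (*≤^ a b x≤ y≤) (≤^ {a + b} (n≤1+n (a + b)))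
  op≤^ lt {x} {y} a b x≤ y≤ = ≤-trans (bit≤1 (x <ᵇ y)) (1≤^ (suc (a + b)))
  op≤^ eq {x} {y} a b x≤ y≤ = ≤-trans (bit≤1 (x ≡ᵇ y)) (1≤^ (suc (a + b)))

  eval≤ : ∀ (e : Expr d) {ρ M} → (∀ x → lookup ρ x ≤ Ω) → (∀ a i j → M a i j ≤ Ω) →
          eval e ρ M ≤ Ω ^ size e
  eval≤ (var x)     ρ≤ M≤ = ≤^1 (ρ≤ x) ≤-refl
  eval≤ (lit x)     ρ≤ M≤ = <⇒≤ (lit<^ x)
  eval≤ (bin o a b) ρ≤ M≤ = op≤^ o (size a) (size b) (eval≤ a ρ≤ M≤) (eval≤ b ρ≤ M≤)
  eval≤ (get a i j) ρ≤ M≤ =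
    ≤^1 {y = size (get a i j)} (M≤ _ _ _) (s≤s z≤n)

  ∷≤ : ∀ {x} {ρ : Env d} → x ≤ Ω → (∀ y → lookup ρ y ≤ Ω) → ∀ y → lookup (x ∷ ρ) y ≤ Ω
  ∷≤ x≤ ρ≤ zero    = x≤
  ∷≤ x≤ ρ≤ (suc y) = ρ≤ y

  -- A loop multiplies the bound by its length, which is an array cell and hence at most `Ω`.
  -- Nesting is static, so the exponent does not depend on the input.
  contrib≤ : ∀ (s : Stmt d) {ρ M} → (∀ x → lookup ρ x ≤ Ω) → (∀ a i j → M a i j ≤ Ω) →
             ∀ a i j → contrib s ρ M a i j ≤ Ω ^ size* s
  contrib≤ (acc a i j e) {ρ} {M} ρ≤ M≤ a′ i′ j′ = begin
    δ a a′ * (δ (eval i ρ M) i′ * (δ (eval j ρ M) j′ * eval e ρ M))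
      ≤⟨ drop a a′ (drop (eval i ρ M) i′ (drop (eval j ρ M) j′ ≤-refl)) ⟩
    eval e ρ M     ≤⟨ eval≤ e ρ≤ M≤ ⟩
    Ω ^ size e     ≤⟨ ≤^ (m≤n+m (size e) (2 + a + (size i + size j))) ⟩
    Ω ^ size* (acc a i j e) ∎
    where
    open ≤-Reasoning
    drop : ∀ x y {u v} → u ≤ v → δ x y * u ≤ v
    drop x y u≤v =
      ≤-trans (*-mono-≤ (bit≤1 (x ≡ᵇ y)) u≤v) (≤-reflexive (*-identityˡ _))
  contrib≤ (s ⨟ t) ρ≤ M≤ a i j =
    +≤^ (size* s) (size* t) (contrib≤ s ρ≤ M≤ a i j) (contrib≤ t ρ≤ M≤ a i j)
  contrib≤ (when e s) {ρ} {M} ρ≤ M≤ a i j =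
    *≤^ (size e) (size* s) (≤-trans (sgn≤1 (eval e ρ M)) (1≤^ (size e))) (contrib≤ s ρ≤ M≤ a i j)
  contrib≤ (for b k l s) {ρ} {M} ρ≤ M≤ a i j = begin
    Σ< n (λ x → contrib s (x ∷ ρ) M a i j)
      ≤⟨ Σ-mono n (λ x x<n → contrib≤ s (∷≤ (≤-trans (<⇒≤ x<n) (M≤ _ _ _)) ρ≤) M≤ a i j) ⟩
    Σ< n (λ _ → Ω ^ size* s) ≡⟨ Σ-const n _ ⟩
    n * Ω ^ size* s
      ≤⟨ *≤^ (size (get b k l)) (size* s) (eval≤ (get b k l) ρ≤ M≤) ≤-refl ⟩
    Ω ^ size* (for b k l s) ∎
    where
    open ≤-Reasoning
    n = eval (get b k l) ρ M
  contrib≤ (bind b k l s) ρ≤ M≤ a i j =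
    ≤-trans (contrib≤ s (∷≤ (M≤ _ _ _) ρ≤) M≤ a i j) (≤^ (m≤n+m (size* s) (size (get b k l))))

  -- One extra factor accounts for the old content of the cell, another for the addition.
  ⊕≤ : ∀ (s : Stmt 0) {M} → (∀ a i j → M a i j ≤ Ω) →
       ∀ a i j → (M ⊕ contrib s [] M) a i j ≤ Ω ^ (2 + size* s)
  ⊕≤ s M≤ a i j = +≤^ 1 (size* s) (≤^1 (M≤ a i j) ≤-refl) (contrib≤ s (λ ()) M≤ a i j)

-- Register 0 receives the output and register 1 holds the radix N; the
-- variables follow, outermost binder first.
loc : Fin d → Reg
loc {suc d} zero    = 2 + d
loc {suc d} (suc x) = loc x

loc< : (x : Fin d) → loc x < 2 + d
loc< {suc d} zero    = ≤-refl
loc< {suc d} (suc x) = m<n⇒m<1+n (loc< x)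

horner : Program → Program → Reg → Program
horner p q t = (p ⨾ op mul t t 1) ⨾ q ⨾ op add t t (suc t)

compileE : Expr d → Reg → Program
address : ℕ → Expr d → Expr d → Reg → Program

-- There is no move instruction; a variable is copied by adding it to zero.
compileE (var x)     t = const t 0 ⨾ op add t (loc x) t
compileE (lit x)     t = const t x
compileE (bin o a b) t = compileE a t ⨾ compileE b (suc t) ⨾ op o t t (suc t)
compileE (get a i j) t = address a i j t ⨾ load t t

address a i j t =
  horner (horner (const t a) (compileE i (suc t)) t) (compileE j (suc t)) t

compile : Stmt d → Program
compile {d} (acc a i j e) =
  address a i j (2 + d) ⨾ compileE e (3 + d) ⨾ load (4 + d) (2 + d) ⨾
  op add (3 + d) (3 + d) (4 + d) ⨾ store (2 + d) (3 + d)
compile {d} (s ⨟ t)        = compile s ⨾ compile t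
compile {d} (when e s)     = compileE e (2 + d) ⨾ ifNZ (2 + d) (compile s) skip
-- Register `2 + d` is at once the loop counter and the body's bound variable. Decremented before
-- the body, it runs from the bound minus one down to zero; the body writes only registers above it.
compile {d} (for a i j s)  =
  compileE (get a i j) (2 + d) ⨾
  whileNZ (2 + d) (const (3 + d) 1 ⨾ op sub (2 + d) (2 + d) (3 + d) ⨾ compile s)
compile {d} (bind a i j s) = compileE (get a i j) (2 + d) ⨾ compile s

steps : Expr d → ℕ
address-steps : Expr d → Expr d → ℕ
steps (var x)     = 2
steps (lit x)     = 1
steps (bin o a b) = steps a + (steps b + 1)
steps (get a i j) = address-steps i j + 1

address-steps i j = ((1 + 1) + (steps i + 1) + 1) + (steps j + 1)

-- A constant of the program text: the time is at most `cost s * B`, with `B` the work bound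
-- supplied by `OK`. In `for`, the 4 pays for three steps of overhead per iteration and the final
-- test; in `when`, the 2 pays for the test and a possible `skip`.
cost : Stmt d → ℕ
cost (acc a i j e)  = address-steps i j + (steps e + 3)
cost (s ⨟ t)        = cost s + cost t
cost (when e s)     = steps e + 2 + cost s
cost (for a i j s)  = steps (get a i j) + 4 + cost s
cost (bind a i j s) = steps (get a i j) + cost s

update-same : ∀ f a x → (f [ a ≔ x ]) a ≡ x
update-same f a x with a ≡ᵇ a | ≡⇒≡ᵇ a a refl
... | true | _ = refl

update-other : ∀ f a x b → a ≢ b → (f [ a ≔ x ]) b ≡ f b
update-other f a x b a≢b with a ≡ᵇ b | ≡ᵇ⇒≡ a b
... | true  | a≡b = contradiction (a≡b tt) a≢b
... | false | _   = refl

-- Correctness and timing of compiled statements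

module Machine (w N Ω : ℕ) (2≤Ω : 2 ≤ Ω) (N≤Ω : N ≤ Ω) where

  addr : Mem
  addr a i j = (a * N + i) * N + j

  digit-injective : ∀ {a a′ i i′} → i < N → i′ < N → a * N + i ≡ a′ * N + i′ → a ≡ a′ × i ≡ i′
  digit-injective {a} {a′} {i} {i′} i<N i′<N e = a≡a′ , i≡i′
    where
    not-less : ∀ {a a′ i i′} → i < N → a * N + i ≡ a′ * N + i′ → a′ ≤ a
    not-less {a} {a′} {i} {i′} i<N e = ≮⇒≥ λ a<a′ → <-irrefl e (begin-strict
      a * N + i     <⟨ +-monoʳ-< (a * N) i<N ⟩
      a * N + N     ≡⟨ +-comm (a * N) N ⟩
      suc a * N     ≤⟨ *-monoˡ-≤ N a<a′ ⟩
      a′ * N        ≤⟨ m≤m+n (a′ * N) i′ ⟩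
      a′ * N + i′   ∎)
      where open ≤-Reasoning
    a≡a′ : a ≡ a′
    a≡a′ = ≤-antisym (not-less i′<N (sym e)) (not-less i<N e)
    i≡i′ : i ≡ i′
    i≡i′ = +-cancelˡ-≡ (a * N) i i′ (trans e (cong (λ z → z * N + i′) (sym a≡a′)))

  addr-injective : ∀ {a a′ i i′ j j′} → i < N → i′ < N → j < N → j′ < N →
                   addr a i j ≡ addr a′ i′ j′ → a ≡ a′ × i ≡ i′ × j ≡ j′
  addr-injective i<N i′<N j<N j′<N e
    with digit-injective j<N j′<N e
  ... | e′ , j≡j′ with digit-injective i<N i′<N e′
  ... | a≡a′ , i≡i′ = a≡a′ , i≡i′ , j≡j′

  -- Rows and columns at `N` and beyond share addresses with other cells, so only indices below `N`
  -- are specified.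
  Holds : (ℕ → Set) → Mem → (ℕ → ℕ) → Set
  Holds P M m = ∀ a i j → P a → i < N → j < N → m (addr a i j) ≡ M a i j

  record Sim (ρ : Env d) (σ : State) : Set where
    field
      radix : reg σ 1 ≡ N
      vars  : ∀ x → reg σ (loc x) ≡ lookup ρ x
      vars≤ : ∀ x → lookup ρ x ≤ Ω
  open Sim

  infix 4 _≈[_]_
  record _≈[_]_ (σ : State) (t : ℕ) (τ : State) : Set where
    constructor same
    field at : ∀ x → x < t → reg τ x ≡ reg σ x
  open _≈[_]_

  Sim-resp : ∀ {ρ : Env d} {σ τ t} → 2 + d ≤ t → σ ≈[ t ] τ → Sim ρ σ → Sim ρ τ
  Sim-resp 2+d≤t σ≈τ S = record
    { radix = trans (at σ≈τ 1 (≤-trans (s≤s (s≤s z≤n)) 2+d≤t)) (radix S)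
    ; vars  = λ x → trans (at σ≈τ _ (≤-trans (loc< x) 2+d≤t)) (vars S x)
    ; vars≤ = vars≤ S
    }

  write-≈ : ∀ {σ t} x {m} → σ ≈[ t ] ⟨ reg σ [ t ≔ x ] , m ⟩
  write-≈ {σ} {t} x = same λ y y<t → update-other (reg σ) t x y (>⇒≢ y<t)

  ≈-trans : ∀ {σ τ υ s t} → s ≤ t → σ ≈[ s ] τ → τ ≈[ t ] υ → σ ≈[ s ] υ
  ≈-trans s≤t p q = same λ x x<s → trans (at q x (≤-trans x<s s≤t)) (at p x x<s)

  InBounds : Mem → Expr d → Env d → Set
  InBounds M (var x)     ρ = ⊤
  InBounds M (lit x)     ρ = ⊤
  InBounds M (bin o a b) ρ = InBounds M a ρ × InBounds M b ρ
  InBounds M (get a i j) ρ =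
    InBounds M i ρ × InBounds M j ρ × eval i ρ M < N × eval j ρ M < N

  record Computes (p : Program) (σ : State) (t : Reg) (v c : ℕ) : Set where
    constructor computes
    field
      {final} : State
      run     : w ⊢ p , σ ⇓[ c ] final
      mem≡    : mem final ≡ mem σ
      below   : σ ≈[ t ] final
      result  : reg final t ≡ v

  record Fits (z : ℕ) : Set where
    constructor fits
    field unfit : Ω ^ z < 2 ^ w
  open Fits

  fits-≤ : ∀ {y z} → y ≤ z → Fits z → Fits y
  fits-≤ y≤z f = fits (≤-<-trans (≤^ 2≤Ω y≤z) (unfit f))

  fit : ∀ {x z} → x ≤ Ω ^ z → Fits z → x < 2 ^ w
  fit x≤ f = ≤-<-trans x≤ (unfit f)

  op-step : ∀ {o r r₁ r₂ σ x y} → reg σ r₁ ≡ x → reg σ r₂ ≡ y → ⟦ o ⟧ x y < 2 ^ w →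
            w ⊢ op o r r₁ r₂ , σ ⇓[ 1 ] ⟨ reg σ [ r ≔ ⟦ o ⟧ x y ] , mem σ ⟩
  op-step refl refl v< = ⇓op v<

  load-step : ∀ {r r₁ σ x} → mem σ (reg σ r₁) ≡ x → x < 2 ^ w →
              w ⊢ load r r₁ , σ ⇓[ 1 ] ⟨ reg σ [ r ≔ x ] , mem σ ⟩
  load-step refl x< = ⇓load x<

  const-computes : ∀ {σ t x} → x < 2 ^ w → Computes (const t x) σ t x 1
  const-computes {σ} {t} {x} x< =
    computes (⇓const x<) refl (write-≈ {σ} {t} x) (update-same (reg σ) t x)

  bin-computes :
    ∀ {o p q σ t u v c c′} → Computes p σ t u c →
    (∀ τ → σ ≈[ t ] τ → mem τ ≡ mem σ → Computes q τ (suc t) v c′) → ⟦ o ⟧ u v < 2 ^ w →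
    Computes (p ⨾ q ⨾ op o t t (suc t)) σ t (⟦ o ⟧ u v) (c + (c′ + 1))
  bin-computes {o} {σ = σ} {t} {u} {v} (computes {τ} ↓p mem≡p below-p result-p) K v<
    with K τ below-p mem≡p
  ... | computes {υ} ↓q mem≡q below-q result-q =
    computes (⇓seq ↓p (⇓seq ↓q (op-step (trans (at below-q t ≤-refl) result-p) result-q v<)))
      (trans mem≡q mem≡p)
      (≈-trans {σ} {υ} ≤-refl
        (≈-trans {σ} {τ} (n≤1+n t) below-p below-q) (write-≈ {υ} {t} (⟦ o ⟧ u v)))
      (update-same (reg υ) t _)

  scale-computes :
    ∀ {p σ t u c} → 1 < t → reg σ 1 ≡ N → Computes p σ t u c → u * N < 2 ^ w →
    Computes (p ⨾ op mul t t 1) σ t (u * N) (c + 1)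
  scale-computes {σ = σ} {t} {u} 1<t base (computes {τ} ↓p mem≡p below-p result-p) v< =
    computes (⇓seq ↓p (op-step result-p (trans (at below-p 1 1<t) base) v<)) mem≡p
      (≈-trans {σ} {τ} ≤-refl below-p (write-≈ {τ} {t} (u * N)))
      (update-same (reg τ) t _)

  horner-computes :
    ∀ {p q σ t u v c c′} → 1 < t → reg σ 1 ≡ N → Computes p σ t u c →
    (∀ τ → σ ≈[ t ] τ → mem τ ≡ mem σ → Computes q τ (suc t) v c′) →
    u * N + v < 2 ^ w →
    Computes (horner p q t) σ t (u * N + v) (c + 1 + (c′ + 1))
  horner-computes {u = u} {v} 1<t base P K v< =
    bin-computes {o = add} (scale-computes 1<t base P (≤-<-trans (m≤m+n (u * N) v) v<)) K v<

  digit< : ∀ {u v a} → u < a → v < N → u * N + v < a * N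
  digit< {u} {v} {a} u<a v<N = begin-strict
    u * N + v   <⟨ +-monoʳ-< (u * N) v<N ⟩
    u * N + N   ≡⟨ +-comm (u * N) N ⟩
    suc u * N   ≤⟨ *-monoˡ-≤ N u<a ⟩
    a * N       ∎
    where open ≤-Reasoning

  *N≤^ : ∀ {x z} → x ≤ Ω ^ z → x * N ≤ Ω ^ suc z
  *N≤^ {x} {z} x≤ = ≤-trans (*-mono-≤ x≤ N≤Ω) (≤-reflexive (*-comm (Ω ^ z) Ω))

  module _ {θ : ℕ} {M : Mem} (M≤ : ∀ a i j → M a i j ≤ Ω) where

    -- The address stays below `Ω ^ (2 + a)`: the array number is below `Ω ^ a`, and each of the two
    -- radix steps multiplies by `N ≤ Ω`.
    address-correct :
      ∀ a (i j : Expr d) {ρ : Env d} {σ t} →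
      Reads (_< θ) i → Reads (_< θ) j → InBounds M i ρ → InBounds M j ρ →
      eval i ρ M < N → eval j ρ M < N → Fits (2 + a + (size i + size j)) →
      2 + d ≤ t → Sim ρ σ → Holds (_< θ) M (mem σ) →
      Computes (address a i j t) σ t (addr a (eval i ρ M) (eval j ρ M)) (address-steps i j)

    compileE-correct :
      ∀ (e : Expr d) {ρ : Env d} {σ t} → Reads (_< θ) e → InBounds M e ρ → Fits (size e) →
      2 + d ≤ t → Sim ρ σ → Holds (_< θ) M (mem σ) →
      Computes (compileE e t) σ t (eval e ρ M) (steps e)

    address-correct {d} a i j {ρ} {σ} {t} ri rj bi bj i<N j<N f d≤t S H =
      horner-computes 1<t (radix S)
        (horner-computes 1<t (radix S)
          (const-computes (fit (<⇒≤ a<) (fits-≤ a≤ f)))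
          (λ τ σ≈τ mem≡ →
            compileE-correct i ri bi (fits-≤ i≤ f) (m≤n⇒m≤1+n d≤t)
              (Sim-resp d≤t σ≈τ S) (subst (Holds _ _) (sym mem≡) H))
          (fit (≤-trans (<⇒≤ (digit< a< i<N)) (*N≤^ {z = a} ≤-refl)) (fits-≤ a+1≤ f)))
        (λ τ σ≈τ mem≡ →
          compileE-correct j rj bj (fits-≤ j≤ f) (m≤n⇒m≤1+n d≤t)
            (Sim-resp d≤t σ≈τ S) (subst (Holds _ _) (sym mem≡) H))
        (fit (≤-trans (<⇒≤ (digit< (digit< a< i<N) j<N)) (*N≤^ {z = suc a} (*N≤^ {z = a} ≤-refl)))
             (fits-≤ (m≤m+n (2 + a) _) f))
      where
      1<t : 1 < t
      1<t = ≤-trans (s≤s (s≤s z≤n)) d≤t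
      a< : a < Ω ^ a
      a< = lit<^ 2≤Ω a
      a+1≤ : suc a ≤ 2 + a + (size i + size j)
      a+1≤ = ≤-trans (n≤1+n (suc a)) (m≤m+n (2 + a) (size i + size j))
      a≤ : a ≤ 2 + a + (size i + size j)
      a≤ = ≤-trans (n≤1+n a) a+1≤
      i≤ : size i ≤ 2 + a + (size i + size j)
      i≤ = ≤-trans (m≤m+n (size i) (size j)) (m≤n+m _ (2 + a))
      j≤ : size j ≤ 2 + a + (size i + size j)
      j≤ = ≤-trans (m≤n+m (size j) (size i)) (m≤n+m _ (2 + a))

    compileE-correct {d} (var x) {ρ} {σ} {t} r b f d≤t S H =
      computes
        (⇓seq (⇓const (≤-<-trans z≤n Ω<))
              (op-step (trans (update-other (reg σ) t 0 (loc x) (>⇒≢ (≤-trans (loc< x) d≤t))) (vars S x))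
                       (update-same (reg σ) t 0) (≤-<-trans x≤Ω Ω<)))
        refl
        (≈-trans {σ} {⟨ reg σ [ t ≔ 0 ] , mem σ ⟩} ≤-refl (write-≈ {σ} {t} 0)
                 (write-≈ {⟨ reg σ [ t ≔ 0 ] , mem σ ⟩} {t} (lookup ρ x + 0) {mem σ}))
        (trans (update-same (reg σ [ t ≔ 0 ]) t _) (+-identityʳ (lookup ρ x)))
      where
      Ω< : Ω < 2 ^ w
      Ω< = fit (≤^1 2≤Ω ≤-refl ≤-refl) f
      x≤Ω : lookup ρ x + 0 ≤ Ω
      x≤Ω = ≤-trans (≤-reflexive (+-identityʳ _)) (vars≤ S x)
    compileE-correct (lit x) r b f d≤t S H = const-computes (fit (<⇒≤ (lit<^ 2≤Ω x)) f)
    compileE-correct (bin o a b) (ra , rb) (ba , bb) f d≤t S H =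
      bin-computes
        (compileE-correct a ra ba (fits-≤ (m≤n⇒m≤1+n (m≤m+n (size a) (size b))) f) d≤t S H)
        (λ τ σ≈τ mem≡ →
          compileE-correct b rb bb (fits-≤ (m≤n⇒m≤1+n (m≤n+m (size b) (size a))) f)
            (m≤n⇒m≤1+n d≤t) (Sim-resp d≤t σ≈τ S) (subst (Holds _ _) (sym mem≡) H))
        (fit (op≤^ 2≤Ω o (size a) (size b) (eval≤ 2≤Ω a (vars≤ S) M≤) (eval≤ 2≤Ω b (vars≤ S) M≤)) f)
    compileE-correct (get a i j) {ρ} {σ} {t} (a<θ , ri , rj) (bi , bj , i<N , j<N) f d≤t S H
      with address-correct a i j ri rj bi bj i<N j<N f d≤t S H
    ... | computes {τ} ↓p mem≡p below-p result-p =
      computes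
        (⇓seq ↓p (load-step
          (trans (cong₂ (λ m x → m x) mem≡p result-p) (H a (eval i ρ M) (eval j ρ M) a<θ i<N j<N))
          (fit (≤^1 2≤Ω {y = size (get a i j)} (M≤ _ _ _) (s≤s z≤n)) f)))
        mem≡p
        (≈-trans {σ} {τ} ≤-refl below-p (write-≈ {τ} {t} _))
        (update-same (reg τ) t _)

  Anywhere : ℕ → Set
  Anywhere _ = ⊤

  record Outcome (s : Stmt d) (σ : State) (T : ℕ) (Q : Mem → Set) : Set where
    constructor outcome
    field
      {time}  : ℕ
      {final} : State
      run     : w ⊢ compile s , σ ⇓[ time ] final
      time≤   : time ≤ T
      below   : σ ≈[ 2 + d ] final
      memory  : Mem
      holds   : Holds Anywhere memory (mem final)
      post    : Q memory

  -- A Hoare triple for total correctness with time budget `T`; the precondition is an exact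
  -- abstract memory.
  Exec : Stmt d → Env d → Mem → ℕ → (Mem → Set) → Set
  Exec s ρ M T Q = ∀ σ → Sim ρ σ → Holds Anywhere M (mem σ) → Outcome s σ T Q

  exec-weaken : ∀ {s : Stmt d} {ρ M T T′ Q Q′} → T ≤ T′ → (∀ M → Q M → Q′ M) →
                Exec s ρ M T Q → Exec s ρ M T′ Q′
  exec-weaken T≤T′ Q⇒Q′ E σ S H with E σ S H
  ... | outcome r t≤ σ≈ M′ h q = outcome r (≤-trans t≤ T≤T′) σ≈ M′ h (Q⇒Q′ M′ q)

  exec-seq : ∀ {s t : Stmt d} {ρ M T₁ T₂ Q R} → Exec s ρ M T₁ Q →
             (∀ M′ → Q M′ → Exec t ρ M′ T₂ R) → Exec (s ⨟ t) ρ M (T₁ + T₂) R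
  exec-seq E F σ S H with E σ S H
  ... | outcome {final = τ} r t≤ σ≈ M′ h q with F M′ q τ (Sim-resp ≤-refl σ≈ S) h
  ... | outcome {final = υ} r′ t≤′ τ≈ M″ h′ q′ =
    outcome (⇓seq r r′) (+-mono-≤ t≤ t≤′) (≈-trans ≤-refl σ≈ τ≈) M″ h′ q′

  -- Since `addr` is injective on indices below `N`, the store changes exactly one represented cell;
  -- at every other cell one of the three deltas vanishes.
  update-cell : ∀ {M m} a x y v → x < N → y < N → Holds Anywhere M m →
    Holds Anywhere (λ a′ i j → M a′ i j + δ a a′ * (δ x i * (δ y j * v)))
                   (m [ addr a x y ≔ v + M a x y ])
  update-cell {M} {m} a x y v x<N y<N H a′ i j _ i<N j<N with addr a x y ≟ addr a′ i j
  ... | no ≢ = trans (update-other m (addr a x y) (v + M a x y) (addr a′ i j) ≢)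
                 (trans (H a′ i j tt i<N j<N)
                   (sym (trans (cong (M a′ i j +_) zeros) (+-identityʳ _))))
    where
    zeros : δ a a′ * (δ x i * (δ y j * v)) ≡ 0
    zeros with a ≟ a′ | x ≟ i | y ≟ j
    ... | no a≢ | _ | _ = cong (_* _) (δ-≢ a≢)
    ... | yes _ | no x≢ | _ = trans (cong (λ z → δ a a′ * (z * _)) (δ-≢ x≢)) (*-zeroʳ (δ a a′))
    ... | yes _ | yes _ | no y≢ =
      trans (cong (λ z → δ a a′ * (δ x i * (z * v))) (δ-≢ y≢))
            (trans (cong (δ a a′ *_) (*-zeroʳ (δ x i))) (*-zeroʳ (δ a a′)))
    ... | yes refl | yes refl | yes refl = contradiction refl ≢
  ... | yes ≡addr with addr-injective {a} {a′} x<N i<N y<N j<N ≡addr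
  ... | refl , refl , refl =
    trans (update-same m (addr a x y) (v + M a x y)) (trans (+-comm v (M a x y)) (cong (M a x y +_) (sym ones)))
    where
    ones : δ a a * (δ x x * (δ y y * v)) ≡ v
    ones rewrite δ-refl a | δ-refl x | δ-refl y =
      trans (*-identityˡ _) (trans (*-identityˡ _) (*-identityˡ v))

  -- Index safety together with a work bound `B`. Sequencing takes a common `B`, its constant factor
  -- being left to `cost`; a loop adds up the bounds of its iterations. A guarded body is examined
  -- only under a true guard, which is how the degree bounds for low vertices enter.
  data OK (M : Mem) : Stmt d → Env d → ℕ → Set where
    acc  : ∀ {a i j e B} {ρ : Env d} → InBounds M (get a i j) ρ → InBounds M e ρ → 1 ≤ B →
           OK M (acc a i j e) ρ B
    _⨟_  : ∀ {s t B} {ρ : Env d} → OK M s ρ B → OK M t ρ B → OK M (s ⨟ t) ρ B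
    when : ∀ {e s B} {ρ : Env d} → InBounds M e ρ → 1 ≤ B →
           (eval e ρ M ≢ 0 → OK M s ρ B) → OK M (when e s) ρ B
    for  : ∀ {a i j s B} {ρ : Env d} (b : ℕ → ℕ) → InBounds M (get a i j) ρ → 1 ≤ B →
           (∀ x → x < eval (get a i j) ρ M → OK M s (x ∷ ρ) (b x)) →
           Σ< (eval (get a i j) ρ M) b ≤ B → OK M (for a i j s) ρ B
    bind : ∀ {a i j s B} {ρ : Env d} → InBounds M (get a i j) ρ →
           OK M s (eval (get a i j) ρ M ∷ ρ) B → OK M (bind a i j s) ρ B

  -- The overhead of an iteration is charged to the bound of its body, which must therefore be
  -- positive.
  OK⇒1≤ : ∀ {M B} {s : Stmt d} {ρ} → OK M s ρ B → 1 ≤ B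
  OK⇒1≤ (acc _ _ 1≤B)       = 1≤B
  OK⇒1≤ (o ⨟ _)             = OK⇒1≤ o
  OK⇒1≤ (when _ 1≤B _)      = 1≤B
  OK⇒1≤ (for _ _ 1≤B _ _)   = 1≤B
  OK⇒1≤ (bind _ o)          = OK⇒1≤ o

  -- Expressions are evaluated in a fixed memory M₀, with which the current
  -- memory agrees on the readable arrays.
  module Stratified {θ : ℕ} {M₀ : Mem} (M₀≤ : ∀ a i j → M₀ a i j ≤ Ω) where

    Agrees : Mem → Set
    Agrees M = ∀ a i j → a < θ → M a i j ≡ M₀ a i j

    Agrees-holds : ∀ {M} m → Agrees M → Holds Anywhere M m → Holds (_< θ) M₀ m
    Agrees-holds m A H a i j a<θ i<N j<N = trans (H a i j tt i<N j<N) (A a i j a<θ)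

    exec-acc : ∀ a (i j e : Expr d) {ρ M} → Reads* (_< θ) (acc a i j e) → Agrees M →
               InBounds M₀ (get a i j) ρ → InBounds M₀ e ρ → Fits (size* (acc a i j e)) →
               M a (eval i ρ M₀) (eval j ρ M₀) + eval e ρ M₀ ≤ Ω →
               Exec (acc a i j e) ρ M (cost (acc a i j e)) (_≋ M ⊕ contrib (acc a i j e) ρ M₀)
    exec-acc {d} a i j e {ρ} {M} (ri , rj , re) A (bi , bj , x<N , y<N) be f M+v≤ σ S H
      with address-correct M₀≤ a i j ri rj bi bj x<N y<N (fits-≤ (m≤m+n _ (size e)) f) ≤-refl S (Agrees-holds (mem σ) A H)
    ... | computes {τ} ↓p refl below-p result-p
      with compileE-correct M₀≤ e re be (fits-≤ (m≤n+m (size e) _) f) (n≤1+n _)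
             (Sim-resp ≤-refl below-p S) (Agrees-holds (mem σ) A H)
    ... | computes {υ} ↓q refl below-q result-q =
      outcome
        (⇓seq ↓p (⇓seq ↓q
          (⇓seq (load-step (trans (cong (mem σ) addr-kept) (H a x y tt x<N y<N))
                           (≤-<-trans (m≤m+n _ v) M+v<))
          (⇓seq (op-step (trans (update-other (reg υ) (4 + d) _ (3 + d) 1+n≢n) result-q)
                         (update-same (reg υ) (4 + d) _)
                         (subst (_< 2 ^ w) (+-comm (M a x y) v) M+v<))
                ⇓store))))
        ≤-refl
        (same λ r r< →
          trans (update-other (reg υ₁) (3 + d) _ r (>⇒≢ (m<n⇒m<1+n r<)))
            (trans (update-other (reg υ) (4 + d) _ r (>⇒≢ (m<n⇒m<1+n (m<n⇒m<1+n r<))))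
              (trans (at below-q r (m<n⇒m<1+n r<)) (at below-p r r<))))
        (λ a′ i′ j′ → M a′ i′ j′ + contrib (acc a i j e) ρ M₀ a′ i′ j′)
        (subst₂ (λ r r′ → Holds Anywhere _ (mem σ [ r ≔ r′ ]))
          (sym addr-kept′) (sym (update-same (reg υ₁) (3 + d) (v + M a x y))) (update-cell {M} {mem σ} a x y v x<N y<N H))
        (λ _ _ _ → refl)
      where
      x = eval i ρ M₀
      y = eval j ρ M₀
      v = eval e ρ M₀
      υ₁ υ₂ : State
      υ₁ = ⟨ reg υ [ 4 + d ≔ M a x y ] , mem σ ⟩
      υ₂ = ⟨ reg υ₁ [ 3 + d ≔ v + M a x y ] , mem σ ⟩
      addr-kept : reg υ (2 + d) ≡ addr a x y
      addr-kept = trans (at below-q (2 + d) ≤-refl) result-p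
      addr-kept′ : reg υ₂ (2 + d) ≡ addr a x y
      addr-kept′ =
        trans (update-other (reg υ₁) (3 + d) _ (2 + d) 1+n≢n)
          (trans (update-other (reg υ) (4 + d) (M a x y) (2 + d) (>⇒≢ (n<1+n _ ∙ n<1+n _))) addr-kept)
        where _∙_ = <-trans
      M+v< : M a x y + v < 2 ^ w
      M+v< = fit (≤^1 2≤Ω {y = size* (acc a i j e)} M+v≤ (s≤s z≤n)) f

    exec-when : ∀ {e} {s : Stmt d} {ρ M T Q} → Reads (_< θ) e → Agrees M → InBounds M₀ e ρ →
                Fits (size e) → (eval e ρ M₀ ≡ 0 → Q M) →
                (eval e ρ M₀ ≢ 0 → Exec s ρ M T Q) → Exec (when e s) ρ M (steps e + (2 + T)) Q
    exec-when {d} {e} {s} {ρ} {M} {T} re A be f E₀ E₁ σ S H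
      with compileE-correct M₀≤ e re be f ≤-refl S (Agrees-holds (mem σ) A H)
    ... | computes {τ} ↓p refl below-p result-p with eval e ρ M₀ ≟ 0
    ... | yes z = outcome (⇓seq ↓p (⇓else (trans result-p z) ⇓skip))
                    (+-monoʳ-≤ (steps e) (m≤m+n 2 T)) below-p M H (E₀ z)
    ... | no nz with E₁ nz τ (Sim-resp ≤-refl below-p S) H
    ... | outcome r t≤ τ≈ M′ h q =
      outcome (⇓seq ↓p (⇓then (λ z → nz (trans (sym result-p) z)) r))
        (+-monoʳ-≤ (steps e) (m≤n⇒m≤1+n (s≤s t≤))) (≈-trans ≤-refl below-p τ≈) M′ h q

    exec-bind : ∀ {a i j} {s : Stmt (suc d)} {ρ M T Q} → Reads (_< θ) (get a i j) → Agrees M →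
                InBounds M₀ (get a i j) ρ → Fits (size (get a i j)) →
                Exec s (eval (get a i j) ρ M₀ ∷ ρ) M T Q →
                Exec (bind a i j s) ρ M (steps (get a i j) + T) Q
    exec-bind {d} {a} {i} {j} {s} {ρ} {M} {T} re A be f E σ S H
      with compileE-correct M₀≤ (get a i j) re be f ≤-refl S (Agrees-holds (mem σ) A H)
    ... | computes {τ} ↓p refl below-p result-p with E τ S′ H
      where
      S′ : Sim (eval (get a i j) ρ M₀ ∷ ρ) τ
      S′ = record
        { radix = radix (Sim-resp ≤-refl below-p S)
        ; vars  = λ { zero → result-p ; (suc x) → vars (Sim-resp ≤-refl below-p S) x }
        ; vars≤ = ∷≤ 2≤Ω (M₀≤ _ _ _) (vars≤ S)
        }
    ... | outcome r t≤ τ≈ M′ h q =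
      outcome (⇓seq ↓p r) (+-monoʳ-≤ (steps (get a i j)) t≤)
        (≈-trans (n≤1+n (2 + d)) below-p τ≈) M′ h q

    module _ {s : Stmt (suc d)} {ρ : Env d} {T : ℕ → ℕ} (P : ℕ → Mem → Set) (1<2^w : 1 < 2 ^ w) where

      body : Program
      body = const (3 + d) 1 ⨾ op sub (2 + d) (2 + d) (3 + d) ⨾ compile s

      decremented : State → ℕ → State
      decremented σ n = ⟨ (reg σ [ 3 + d ≔ 1 ]) [ 2 + d ≔ n ] , mem σ ⟩

      decremented-≈ : ∀ σ n → σ ≈[ 2 + d ] decremented σ n
      decremented-≈ σ n = same λ x x<2+d →
        trans (update-other (reg σ [ 3 + d ≔ 1 ]) (2 + d) n x (>⇒≢ x<2+d))
              (update-other (reg σ) (3 + d) 1 x (>⇒≢ (m<n⇒m<1+n x<2+d)))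

      decremented-Sim : ∀ {σ n} → n ≤ Ω → Sim ρ σ → Sim (n ∷ ρ) (decremented σ n)
      decremented-Sim {σ} {n} n≤ S = record
        { radix = radix S′
        ; vars  = λ { zero → update-same (reg σ [ 3 + d ≔ 1 ]) (2 + d) n ; (suc x) → vars S′ x }
        ; vars≤ = ∷≤ 2≤Ω n≤ (vars≤ S)
        }
        where S′ = Sim-resp ≤-refl (decremented-≈ σ n) S

      -- `P i` is the invariant with `i` iterations still to run; the iteration entered from
      -- `P (suc i)` has loop variable `i`.
      exec-while : ∀ n {M} → n ≤ Ω → n < 2 ^ w → P n M →
        (∀ i → i < n → ∀ M′ → P (suc i) M′ → Exec s (i ∷ ρ) M′ (T i) (P i)) →
        ∀ σ → Sim ρ σ → Holds Anywhere M (mem σ) → reg σ (2 + d) ≡ n →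
        ∃[ t ] ∃[ τ ] ∃[ M′ ] (w ⊢ whileNZ (2 + d) body , σ ⇓[ t ] τ)
          × t ≤ 1 + Σ< n (λ i → 3 + T i) × σ ≈[ 2 + d ] τ × Holds Anywhere M′ (mem τ) × P 0 M′
      exec-while zero    n≤ n< p E σ S H z =
        1 , σ , _ , ⇓stop z , ≤-refl , same (λ _ _ → refl) , H , p
      exec-while (suc n) {M} n≤ n< p E σ S H z
        with E n ≤-refl M p (decremented σ n) (decremented-Sim (<⇒≤ n≤) S) H
      ... | outcome {t₁} {τ} r t≤ τ≈ M′ h q
        with exec-while n (<⇒≤ n≤) (<-trans ≤-refl n<) q (λ i i<n → E i (m<n⇒m<1+n i<n)) τ
               (Sim-resp ≤-refl (≈-trans (n≤1+n _) (decremented-≈ σ n) τ≈) S) h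
               (trans (at τ≈ (2 + d) ≤-refl) (update-same (reg σ [ 3 + d ≔ 1 ]) (2 + d) n))
      ... | t₂ , υ , M″ , r′ , t≤′ , τ≈υ , h′ , p′ =
        _ , υ , M″ ,
        ⇓loop (λ e → 1+n≢0 (trans (sym z) e))
          (⇓seq (⇓const 1<2^w)
            (⇓seq (op-step (trans (update-other (reg σ) (3 + d) 1 (2 + d) 1+n≢n) z)
                           (update-same (reg σ) (3 + d) 1) (<-trans ≤-refl n<)) r)) r′ ,
        ≤-trans (s≤s (s≤s (s≤s (+-mono-≤ t≤ t≤′))))
          (≤-reflexive (cong (3 +_) (+-suc (T n) _))) ,
        same (λ x x< → trans (at τ≈υ x x<)
          (trans (at τ≈ x (m<n⇒m<1+n x<)) (at (decremented-≈ σ n) x x<))) ,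
        h′ , p′

      exec-for : ∀ {a i j M} → Reads (_< θ) (get a i j) → Agrees M → InBounds M₀ (get a i j) ρ →
        Fits (size (get a i j)) → P (eval (get a i j) ρ M₀) M →
        (∀ x → x < eval (get a i j) ρ M₀ → ∀ M′ → P (suc x) M′ → Exec s (x ∷ ρ) M′ (T x) (P x)) →
        Exec (for a i j s) ρ M (steps (get a i j) + (1 + Σ< (eval (get a i j) ρ M₀) (λ x → 3 + T x))) (P 0)
      exec-for {a} {i} {j} {M} re A be f p E σ S H
        with compileE-correct M₀≤ (get a i j) re be f ≤-refl S (Agrees-holds (mem σ) A H)
      ... | computes {τ} ↓p refl below-p result-p
        with exec-while n (M₀≤ _ _ _) (fit (≤^1 2≤Ω {y = size (get a i j)} (M₀≤ _ _ _) (s≤s z≤n)) f)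
               p E τ (Sim-resp ≤-refl below-p S) H result-p
        where n = eval (get a i j) ρ M₀
      ... | t , υ , M′ , r , t≤ , τ≈υ , h , p′ =
        outcome (⇓seq ↓p r) (+-monoʳ-≤ (steps (get a i j)) t≤) (≈-trans ≤-refl below-p τ≈υ) M′ h p′

    Agrees-⊕ : ∀ {M M′} (s : Stmt d) ρ → Writes (θ ≤_) s → Agrees M →
               M′ ≋ M ⊕ contrib s ρ M₀ → Agrees M′
    Agrees-⊕ s ρ ws A e a i j a<θ =
      trans (e a i j) (trans (cong₂ _+_ (A a i j a<θ)
        (contrib-quiet s i j (Writes-map (λ θ≤ → >⇒≢ (<-≤-trans a<θ θ≤)) s ws))) (+-identityʳ _))

    for-time : ∀ n c K B (b : ℕ → ℕ) → 1 ≤ B → (∀ x → x < n → 1 ≤ b x) → Σ< n b ≤ B →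
               c + (1 + Σ< n (λ x → 3 + K * b x)) ≤ (c + 4 + K) * B
    for-time n c K B b 1≤B 1≤b Σ≤B = begin
      c + (1 + Σ< n (λ x → 3 + K * b x))
        ≡⟨ cong (λ z → c + (1 + z)) (trans (Σ-+ n (λ _ → 3) (λ x → K * b x)) (cong (Σ< n (λ _ → 3) +_) (sym (Σ-*ˡ n K b)))) ⟩
      c + (1 + (Σ< n (λ _ → 3) + K * Σ< n b))
        ≤⟨ +-monoʳ-≤ c (+-monoʳ-≤ 1 (+-mono-≤ (Σ-mono n λ x x<n → *-monoʳ-≤ 3 (1≤b x x<n)) (*-monoʳ-≤ K Σ≤B))) ⟩
      c + (1 + (Σ< n (λ x → 3 * b x) + K * B))
        ≡⟨ cong (λ z → c + (1 + (z + K * B))) (sym (Σ-*ˡ n 3 b)) ⟩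
      c + (1 + (3 * Σ< n b + K * B))
        ≤⟨ +-mono-≤ (m≤m*n c B) (+-mono-≤ 1≤B (+-monoˡ-≤ (K * B) (*-monoʳ-≤ 3 Σ≤B))) ⟩
      c * B + (B + (3 * B + K * B))
        ≡⟨ solve 3 (λ c K B → c :* B :+ (B :+ (con 3 :* B :+ K :* B)) := (c :+ con 4 :+ K) :* B) refl c K B ⟩
      (c + 4 + K) * B ∎
      where
      open ≤-Reasoning
      open +-*-Solver
      instance
        B≢0 : NonZero B
        B≢0 = >-nonZero 1≤B

    -- Contributions are only added, so bounding the final sums bounds every intermediate cell.
    -- Writes go to arrays from `θ` on, so each expression keeps its value in `M₀`.
    exec : ∀ (s : Stmt d) {ρ B M} → Reads* (_< θ) s → Writes (θ ≤_) s → OK M₀ s ρ B →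
           Fits (size* s) → Agrees M → (∀ a i j → M a i j + contrib s ρ M₀ a i j ≤ Ω) →
           Exec s ρ M (cost s * B) (_≋ M ⊕ contrib s ρ M₀)
    exec (acc a i j e) {ρ} {B} {M} rs ws (acc ib be 1≤B) f A M+≤ =
      exec-weaken (m≤m*n (cost (acc a i j e)) B) (λ _ q → q)
        (exec-acc a i j e rs A ib be f (subst (λ z → M a x y + z ≤ Ω) own (M+≤ a x y)))
      where
      instance
        B≢0 : NonZero B
        B≢0 = >-nonZero 1≤B
      x = eval i ρ M₀
      y = eval j ρ M₀
      own : contrib (acc a i j e) ρ M₀ a x y ≡ eval e ρ M₀
      own rewrite δ-refl a | δ-refl x | δ-refl y =
        trans (*-identityˡ _) (trans (*-identityˡ _) (*-identityˡ _))
    exec (s ⨟ t) {ρ} {B} {M} (rs , rt) (ws , wt) (os ⨟ ot) f A M+≤ =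
      exec-weaken (≤-reflexive (sym (*-distribʳ-+ B (cost s) (cost t))))
        (λ M′ q → q)
        (exec-seq
          (exec s rs ws os (fits-≤ (m≤n⇒m≤1+n (m≤m+n (size* s) (size* t))) f) A
            (λ a i j → ≤-trans (+-monoʳ-≤ (M a i j) (m≤m+n _ _)) (M+≤ a i j)))
          λ M′ q → exec-weaken ≤-refl
            (λ M″ q′ a i j → trans (q′ a i j) (trans (cong (_+ _) (q a i j)) (+-assoc (M a i j) _ _)))
            (exec t rt wt ot (fits-≤ (m≤n⇒m≤1+n (m≤n+m (size* t) (size* s))) f) (Agrees-⊕ s ρ ws A q)
              (λ a i j → ≤-trans
                (≤-reflexive (trans (cong (_+ _) (q a i j)) (+-assoc (M a i j) _ _))) (M+≤ a i j))))
    exec (when e s) {ρ} {B} {M} (re , rs) ws (when be 1≤B os) f A M+≤ =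
      exec-weaken time (λ _ q → q)
        (exec-when re A be (fits-≤ (m≤m+n (size e) (size* s)) f)
          (λ z a i j → sym (trans (cong (λ g → M a i j + sgn g * contrib s ρ M₀ a i j) z) (+-identityʳ _)))
          (λ nz → exec-weaken ≤-refl
            (λ M′ q a i j → trans (q a i j) (cong (M a i j +_) (sym (active nz a i j))))
            (exec s rs ws (os nz) (fits-≤ (m≤n+m (size* s) (size e)) f) A
              λ a i j → ≤-trans (≤-reflexive (cong (M a i j +_) (sym (active nz a i j)))) (M+≤ a i j))))
      where
      instance
        B≢0 : NonZero B
        B≢0 = >-nonZero 1≤B
      active : eval e ρ M₀ ≢ 0 → ∀ a i j →
               sgn (eval e ρ M₀) * contrib s ρ M₀ a i j ≡ contrib s ρ M₀ a i j
      active nz a i j with eval e ρ M₀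
      ... | zero  = contradiction refl nz
      ... | suc _ = *-identityˡ _
      time : steps e + (2 + cost s * B) ≤ (steps e + 2 + cost s) * B
      time = begin
        steps e + (2 + cost s * B)   ≡⟨ sym (+-assoc (steps e) 2 _) ⟩
        steps e + 2 + cost s * B     ≤⟨ +-monoˡ-≤ (cost s * B) (m≤m*n (steps e + 2) B) ⟩
        (steps e + 2) * B + cost s * B ≡⟨ sym (*-distribʳ-+ B (steps e + 2) (cost s)) ⟩
        (steps e + 2 + cost s) * B   ∎
        where open ≤-Reasoning
    exec (for a′ i′ j′ s) {ρ} {B} {M} (re , rs) ws (for b be 1≤B os Σ≤B) f A M+≤ =
      exec-weaken (for-time n (steps (get a′ i′ j′)) (cost s) B b 1≤B (λ x x<n → OK⇒1≤ (os x x<n)) Σ≤B)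
        (λ M′ (_ , q) a i j → trans (sym (+-identityʳ _)) (q a i j))
        (exec-for Remaining (fit (≤^1 2≤Ω {y = size (get a′ i′ j′)} (≤-trans (s≤s z≤n) 2≤Ω) (s≤s z≤n)) fe)
          re A be fe (A , λ _ _ _ → refl)
          λ x x<n M′ (A′ , q) → exec-weaken ≤-refl
            (λ M″ q′ → Agrees-⊕ s (x ∷ ρ) ws A′ q′ ,
              λ a i j → trans (cong (_+ Σ< x (c a i j)) (q′ a i j)) (trans (+-assoc (M′ a i j) _ _) (q a i j)))
            (exec s rs ws (os x x<n) (fits-≤ (m≤n+m (size* s) (size (get a′ i′ j′))) f) A′
              λ a i j → ≤-trans (+-monoʳ-≤ (M′ a i j) (m≤m+n (c a i j x) (Σ< x (c a i j))))
                          (≤-trans (≤-reflexive (q a i j)) (M+≤ a i j))))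
      where
      n  = eval (get a′ i′ j′) ρ M₀
      fe = fits-≤ (m≤m+n (size (get a′ i′ j′)) (size* s)) f
      c : ℕ → ℕ → ℕ → ℕ → ℕ
      c a i j x = contrib s (x ∷ ρ) M₀ a i j
      -- Loop invariant: the present contents and the contributions of the `x` iterations still to
      -- run add up to the final contents.
      Remaining : ℕ → Mem → Set
      Remaining x M′ = Agrees M′ ×
        (∀ a i j → M′ a i j + Σ< x (c a i j) ≡ M a i j + Σ< n (c a i j))
    exec (bind a′ i′ j′ s) {ρ} {B} {M} (re , rs) ws (bind be os) f A M+≤ =
      exec-weaken time (λ _ q → q)
        (exec-bind re A be (fits-≤ (m≤m+n (size (get a′ i′ j′)) (size* s)) f)
          (exec s rs ws os (fits-≤ (m≤n+m (size* s) (size (get a′ i′ j′))) f) A M+≤))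
      where
      instance
        B≢0 : NonZero B
        B≢0 = >-nonZero (OK⇒1≤ os)
      c = steps (get a′ i′ j′)
      time : c + cost s * B ≤ (c + cost s) * B
      time = ≤-trans (+-monoˡ-≤ (cost s * B) (m≤m*n c B))
                     (≤-reflexive (sym (*-distribʳ-+ B c (cost s))))

  -- Each phase restarts with the current memory as `M₀`, so arrays written by one phase can be read
  -- by the next. The price is a cell bound raised to a fixed power.
  phase : ∀ (s : Stmt 0) θ {M U B} → 2 ≤ U → (∀ a i j → M a i j ≤ U) → U ^ (2 + size* s) ≤ Ω →
          Reads* (_< θ) s → Writes (θ ≤_) s → OK M s [] B → Fits (size* s) →
          Exec s [] M (cost s * B)
            (λ M′ → (M′ ≋ M ⊕ contrib s [] M) × (∀ a i j → M′ a i j ≤ U ^ (2 + size* s)))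
  phase s θ {M} {U} 2≤U M≤U U^≤Ω rs ws os f =
    exec-weaken ≤-refl (λ M′ e → e , λ a i j → ≤-trans (≤-reflexive (e a i j)) (⊕≤ 2≤U s M≤U a i j))
      (exec s rs ws os f (λ _ _ _ _ → refl) λ a i j → ≤-trans (⊕≤ 2≤U s M≤U a i j) U^≤Ω)
    where
    open Stratified {θ} {M} (λ a i j → ≤-trans (M≤U a i j)
      (≤-trans (≤^1 2≤U {y = 2 + size* s} ≤-refl (s≤s z≤n)) U^≤Ω))

  phase-keeps : ∀ (s : Stmt 0) θ {M M′} → Writes (θ ≤_) s → M′ ≋ M ⊕ contrib s [] M →
                ∀ a i j → a < θ → M′ a i j ≡ M a i j
  phase-keeps s θ {M} ws e a i j a<θ = trans (e a i j) (trans (cong (M a i j +_)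
    (contrib-quiet s i j (Writes-map (λ θ≤ → >⇒≢ (<-≤-trans a<θ θ≤)) s ws))) (+-identityʳ _))

-- Splitting the trace of a matrix power

Matrix : Set
Matrix = ℕ → ℕ → ℕ

module Matrices (n : ℕ) where

  infixl 7 _·_
  _·_ : Matrix → Matrix → Matrix
  (P · Q) u v = Σ< n λ x → P u x * Q x v

  trace : Matrix → ℕ
  trace P = Σ< n λ u → P u u

  scale : (ℕ → ℕ) → Matrix → Matrix
  scale f P u v = f u * P u v

  pow : Matrix → ℕ → Matrix
  pow P zero    = δ
  pow P (suc j) = P · pow P j

  infix 4 _≐_
  -- Matrices are total functions on the naturals, and `δ` is neutral for the product only on
  -- indices below `n`.
  _≐_ : Matrix → Matrix → Set
  P ≐ Q = ∀ u v → u < n → v < n → P u v ≡ Q u v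

  ·-cong : ∀ {P P′ Q Q′} → P ≐ P′ → Q ≐ Q′ → P · Q ≐ P′ · Q′
  ·-cong p q u v u<n v<n = Σ-cong n λ x x<n → cong₂ _*_ (p u x u<n x<n) (q x v x<n v<n)

  trace-cong : ∀ {P Q} → P ≐ Q → trace P ≡ trace Q
  trace-cong e = Σ-cong n λ u u<n → e u u u<n u<n

  ·-assoc : ∀ P Q R u v → ((P · Q) · R) u v ≡ (P · (Q · R)) u v
  ·-assoc P Q R u v = begin
    Σ< n (λ y → Σ< n (λ x → P u x * Q x y) * R y v)
      ≡⟨ Σ-cong′ n (λ y → Σ-*ʳ n (R y v) _) ⟩
    Σ< n (λ y → Σ< n (λ x → P u x * Q x y * R y v))
      ≡⟨ Σ-swap n n _ ⟩
    Σ< n (λ x → Σ< n (λ y → P u x * Q x y * R y v))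
      ≡⟨ Σ-cong′ n (λ x → trans (Σ-cong′ n λ y → *-assoc (P u x) (Q x y) (R y v)) (sym (Σ-*ˡ n (P u x) _))) ⟩
    Σ< n (λ x → P u x * Σ< n (λ y → Q x y * R y v)) ∎
    where open ≡-Reasoning

  ·-identityˡ : ∀ P → δ · P ≐ P
  ·-identityˡ P u v u<n v<n = Σ-δ n (λ x → P x v) u<n

  ·-identityʳ : ∀ P → P · δ ≐ P
  ·-identityʳ P u v u<n v<n =
    trans (Σ-cong′ n λ x → trans (*-comm (P u x) _) (cong (_* P u x) (δ-sym x v)))
          (Σ-δ n (P u) v<n)

  trace-comm : ∀ P Q → trace (P · Q) ≡ trace (Q · P)
  trace-comm P Q = trans (Σ-swap n n _) (Σ-cong′ n λ x → Σ-cong′ n λ u → *-comm (P u x) (Q x u))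

  pow-+ : ∀ P i j → pow P (i + j) ≐ pow P i · pow P j
  pow-+ P zero    j u v u<n v<n = sym (·-identityˡ (pow P j) u v u<n v<n)
  pow-+ P (suc i) j u v u<n v<n =
    trans (·-cong {P} {P} (λ _ _ _ _ → refl) (pow-+ P i j) u v u<n v<n)
          (sym (·-assoc P (pow P i) (pow P j) u v))

  pow-sucʳ : ∀ P j → pow P (suc j) ≐ pow P j · P
  pow-sucʳ P j u v u<n v<n = begin
    pow P (suc j) u v         ≡⟨ cong (λ i → pow P i u v) (+-comm 1 j) ⟩
    pow P (j + 1) u v         ≡⟨ pow-+ P j 1 u v u<n v<n ⟩
    (pow P j · (P · δ)) u v   ≡⟨ ·-cong {pow P j} {pow P j} (λ _ _ _ _ → refl) (·-identityʳ P) u v u<n v<n ⟩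
    (pow P j · P) u v         ∎
    where open ≡-Reasoning

  module Split (A : Matrix) (lo hi : ℕ → ℕ) (hi+lo : ∀ u → hi u + lo u ≡ 1) where

    B : Matrix
    B = scale lo A

    -- Q j = Σ_{i<j} A^(j-i) B^i: walks of j steps whose last i steps leave low vertices.
    Q : ℕ → Matrix
    Q zero    u v = 0
    Q (suc j) u v = Σ< n λ x → (pow A j u x + lo x * Q j u x) * A x v

    -- `Q` is defined the way the program updates it, testing for a low vertex before following the
    -- arc; moving that factor into the arc matrix yields the recursion of the sum.
    Q-suc : ∀ j → Q (suc j) ≐ λ u v → pow A (suc j) u v + (Q j · B) u v
    Q-suc j u v u<n v<n = begin
      Σ< n (λ x → (pow A j u x + lo x * Q j u x) * A x v)
        ≡⟨ Σ-cong′ n (λ x → distribute (pow A j u x) (lo x) (Q j u x) (A x v)) ⟩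
      Σ< n (λ x → pow A j u x * A x v + Q j u x * (lo x * A x v))
        ≡⟨ Σ-+ n _ _ ⟩
      (pow A j · A) u v + (Q j · B) u v
        ≡⟨ cong (_+ (Q j · B) u v) (sym (pow-sucʳ A j u v u<n v<n)) ⟩
      pow A (suc j) u v + (Q j · B) u v ∎
      where
      open ≡-Reasoning
      distribute : ∀ a l q b → (a + l * q) * b ≡ a * b + q * (l * b)
      distribute = solve 4 (λ a l q b → (a :+ l :* q) :* b := a :* b :+ q :* (l :* b)) refl
        where open +-*-Solver

    split-trace : ∀ P → trace P ≡ trace (scale hi P) + trace (scale lo P)
    split-trace P = trans (Σ-cong′ n λ u → begin
      P u u                       ≡⟨ sym (*-identityˡ _) ⟩
      1 * P u u                   ≡⟨ cong (_* P u u) (sym (hi+lo u)) ⟩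
      (hi u + lo u) * P u u       ≡⟨ *-distribʳ-+ (P u u) (hi u) (lo u) ⟩
      hi u * P u u + lo u * P u u ∎) (Σ-+ n _ _)
      where open ≡-Reasoning

    scale-· : ∀ f P R u v → scale f (P · R) u v ≡ (scale f P · R) u v
    scale-· f P R u v = trans (Σ-*ˡ n (f u) _) (Σ-cong′ n λ x → sym (*-assoc (f u) (P u x) (R x v)))

    -- Moving the leading low step to the other end of the closed walk lets the
    -- induction trade a factor A for a factor B.
    rotate : ∀ j i → trace (scale lo (pow A (suc j) · pow B i)) ≡ trace (pow A j · pow B (suc i))
    rotate j i = begin
      trace (scale lo (pow A (suc j) · pow B i))
        ≡⟨ trace-cong {scale lo (pow A (suc j) · pow B i)} {B · (pow A j · pow B i)} (λ u v u<n v<n →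
             trans (cong (lo u *_) (·-assoc A (pow A j) (pow B i) u v)) (scale-· lo A (pow A j · pow B i) u v)) ⟩
      trace (B · (pow A j · pow B i))
        ≡⟨ trace-comm B (pow A j · pow B i) ⟩
      trace ((pow A j · pow B i) · B)
        ≡⟨ trace-cong {(pow A j · pow B i) · B} {pow A j · pow B (suc i)} (λ u v u<n v<n →
             trans (·-assoc (pow A j) (pow B i) B u v)
                   (·-cong {pow A j} {pow A j} (λ _ _ _ _ → refl) (λ x y x<n y<n → sym (pow-sucʳ B i x y x<n y<n)) u v u<n v<n)) ⟩
      trace (pow A j · pow B (suc i)) ∎
      where open ≡-Reasoning

    trace-step : ∀ j i → trace (scale hi (Q (suc j) · pow B i)) ≡
      trace (scale hi (pow A (suc j) · pow B i)) + trace (scale hi (Q j · pow B (suc i)))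
    trace-step j i = trans (Σ-cong n step) (Σ-+ n _ _)
      where
      open ≡-Reasoning
      step : ∀ u → u < n → hi u * (Q (suc j) · pow B i) u u ≡
             hi u * (pow A (suc j) · pow B i) u u + hi u * (Q j · pow B (suc i)) u u
      step u u<n = begin
        hi u * (Q (suc j) · pow B i) u u
          ≡⟨ cong (hi u *_) (Σ-cong n λ x x<n → trans (cong (_* pow B i x u) (Q-suc j u x u<n x<n))
               (*-distribʳ-+ (pow B i x u) (pow A (suc j) u x) _)) ⟩
        hi u * Σ< n (λ x → pow A (suc j) u x * pow B i x u + (Q j · B) u x * pow B i x u)
          ≡⟨ cong (hi u *_) (Σ-+ n _ _) ⟩
        hi u * ((pow A (suc j) · pow B i) u u + ((Q j · B) · pow B i) u u)
          ≡⟨ *-distribˡ-+ (hi u) _ _ ⟩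
        hi u * (pow A (suc j) · pow B i) u u + hi u * ((Q j · B) · pow B i) u u
          ≡⟨ cong (λ z → hi u * (pow A (suc j) · pow B i) u u + hi u * z) (·-assoc (Q j) B (pow B i) u u) ⟩
        hi u * (pow A (suc j) · pow B i) u u + hi u * (Q j · pow B (suc i)) u u ∎

    -- Split on whether the start is high. A low start is rotated to the end, which is why the power
    -- of `B` is kept general: the induction lowers `j` and raises `i`. `Q j` collects the walks by
    -- the number of rotations made before a high start is met.
    trace-split : ∀ j i → trace (pow A j · pow B i) ≡
                  trace (scale hi (Q j · pow B i)) + trace (pow B (i + j))
    trace-split zero i = begin
      trace (δ · pow B i)
        ≡⟨ trace-cong {δ · pow B i} {pow B i} (·-identityˡ (pow B i)) ⟩
      trace (pow B i)
        ≡⟨ cong₂ _+_ (sym (Σ-zero n λ u _ → trans (cong (hi u *_) (Σ-zero n λ _ _ → refl)) (*-zeroʳ (hi u))))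
                     (cong (λ z → trace (pow B z)) (sym (+-identityʳ i))) ⟩
      trace (scale hi (Q zero · pow B i)) + trace (pow B (i + 0)) ∎
      where open ≡-Reasoning
    trace-split (suc j) i = begin
      trace (pow A (suc j) · pow B i)
        ≡⟨ split-trace (pow A (suc j) · pow B i) ⟩
      trace (scale hi (pow A (suc j) · pow B i)) + trace (scale lo (pow A (suc j) · pow B i))
        ≡⟨ cong (h +_) (trans (rotate j i) (trace-split j (suc i))) ⟩
      h + (trace (scale hi (Q j · pow B (suc i))) + trace (pow B (suc i + j)))
        ≡⟨ sym (+-assoc h _ _) ⟩
      h + trace (scale hi (Q j · pow B (suc i))) + trace (pow B (suc i + j))
        ≡⟨ cong₂ _+_ (sym (trace-step j i)) (cong (λ z → trace (pow B z)) (sym (+-suc i j))) ⟩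
      trace (scale hi (Q (suc j) · pow B i)) + trace (pow B (i + suc j)) ∎
      where
      open ≡-Reasoning
      h = trace (scale hi (pow A (suc j) · pow B i))

    trace-pow : ∀ k → trace (pow A k) ≡ trace (pow B k) + trace (scale hi (Q k))
    trace-pow k = begin
      trace (pow A k)      ≡⟨ trace-cong {pow A k} {pow A k · δ} (λ u v u<n v<n → sym (·-identityʳ (pow A k) u v u<n v<n)) ⟩
      trace (pow A k · δ)  ≡⟨ trace-split k 0 ⟩
      trace (scale hi (Q k · δ)) + trace (pow B k)
        ≡⟨ cong (_+ trace (pow B k)) (trace-cong {scale hi (Q k · δ)} {scale hi (Q k)} λ u v u<n v<n →
             cong (hi u *_) (·-identityʳ (Q k) u v u<n v<n)) ⟩
      trace (scale hi (Q k)) + trace (pow B k) ≡⟨ +-comm (trace (scale hi (Q k))) _ ⟩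
      trace (pow B k) + trace (scale hi (Q k)) ∎
      where open ≡-Reasoning

-- The counting algorithm

-- Array numbers; array 0 is the input.  CNT holds the number of arcs in its
-- only cell, LEAD marks the arcs that are processed first at their source, and
-- OUT u 0, …, OUT u (DEG u - 1) are the out-neighbours of u.
CNT SRC DST DEG LEAD OUT TAB : ℕ
CNT  = 1
SRC  = 2
DST  = 3
DEG  = 4
LEAD = 5
OUT  = 6
TAB  = 7

pattern #0 = zero
pattern #1 = suc zero
pattern #2 = suc (suc zero)
pattern #3 = suc (suc (suc zero))

at : ℕ → Expr d → Expr d
at a i = get a i (lit 0)

cell : ℕ → Expr d
cell a = at a (lit 0)

power : Expr d → ℕ → Expr d
power e zero    = lit 1
power e (suc r) = bin mul e (power e r)

eval-power : ∀ (e : Expr d) r {ρ M} → eval (power e r) ρ M ≡ eval e ρ M ^ r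
eval-power e zero            = refl
eval-power e (suc r) {ρ} {M} = cong (eval e ρ M *_) (eval-power e r)

forArcs : Stmt (suc d) → Stmt d
forArcs = for CNT (lit 0) (lit 0)

-- The two half walks have `suc p` and `suc q` steps, and `suc p` is the r of the threshold. Powers
-- of degrees are compared with the number of arcs, which for an undirected graph is twice the
-- number of edges.
module Algorithm (p q : ℕ) where

  high low : Expr d → Expr d
  high v = bin lt (cell CNT) (power (at DEG v) (suc p))
  low  v = bin eq (high v) (lit 0)

  build : Stmt 0
  build = forArcs (bind SRC (var #0) (lit 0)
    -- The old degree is both the free slot for the new neighbour and the test for a first arc, so
    -- it is incremented last.
    (acc OUT (var #0) (at DEG (var #0)) (at DST (var #1)) ⨟
     acc LEAD (var #1) (lit 0) (bin eq (at DEG (var #0)) (lit 0)) ⨟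
     acc DEG (var #0) (lit 0) (lit 1)))

  Body : Set
  Body = ∀ {d} → Fin d → Fin d → Stmt d

  -- `s` and `v` are the variables holding the start and the current end. Each step binds a list
  -- position and a neighbour, hence the shift of `s` by two.
  extend : Body → ℕ → Body
  extend body zero    s v = body s v
  extend body (suc j) s v =
    when (low (var v)) (for DEG (var v) (lit 0) (bind OUT (var (suc v)) (var #0)
      (extend body j (suc (suc s)) #0)))

  -- Runs body at the two ends of every walk of j + 1 steps all of whose
  -- vertices but the last are low.
  enumerate : Body → ℕ → Stmt 0
  enumerate body j =
    forArcs (bind SRC (var #0) (lit 0) (bind DST (var #1) (lit 0)
      (when (low (var #1)) (extend body j #1 #0))))

  tally : Body
  tally s v = acc TAB (var s) (var v) (lit 1)

  match : ℕ → Body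
  match r s v = acc r (lit 0) (lit 0) (get TAB (var v) (var s))

  -- The marked arcs visit each vertex of positive out-degree once; a loop over all vertices would
  -- not be bounded in terms of m.
  forHigh : Stmt 2 → Stmt 0
  forHigh body = forArcs (when (at LEAD (var #0)) (bind SRC (var #0) (lit 0)
    (when (high (var #0)) body)))

  seed : Stmt 0
  seed = forHigh (acc 8 (var #0) (var #0) (lit 1))

  advance : ℕ → Stmt 2
  advance a = forArcs (bind SRC (var #0) (lit 0) (bind DST (var #1) (lit 0)
    -- `#3` is the high start vertex; `#1` and `#0` are the ends of the arc that prolongs the walks.
    (acc (2 + a) (var #3) (var #0) (get a (var #3) (var #1)) ⨟
     acc (3 + a) (var #3) (var #0)
       (bin add (get a (var #3) (var #1)) (bin mul (low (var #1)) (get (suc a) (var #3) (var #1)))))))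

  layer : ℕ → Stmt 0
  layer a = forHigh (advance a)

  finish : ℕ → Stmt 0
  finish a = enumerate (match (2 + a)) q ⨟ forHigh (acc (2 + a) (lit 0) (lit 0) (get (suc a) (var #0) (var #0)))

  -- Each length has its own pair of arrays, so no layer writes what it reads. Array `a` holds walks
  -- from high starts, `suc a` the matching rows of `Q`; `seed` leaves array 9 empty because `Q 0`
  -- is zero.
  layers : ℕ → ℕ → Stmt 0
  layers a zero    = finish a
  layers a (suc j) = layer a ⨟ layers (2 + a) j

  length-of-cycle : ℕ
  length-of-cycle = suc q + suc p

  result-array : ℕ → ℕ → ℕ
  result-array a zero    = 2 + a
  result-array a (suc j) = result-array (2 + a) j

-- Sums over arcs and adjacency lists

record Arcs : Set where
  field
    n L       : ℕ
    src dst   : ℕ → ℕ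
    src<      : ∀ e → e < L → src e < n
    dst<      : ∀ e → e < L → dst e < n

  adj : Matrix
  adj u v = Σ< L λ e → δ (src e) u * δ (dst e) v

  open Matrices n

  Σ-pairs : ∀ (F : Matrix) → Σ< L (λ e → F (src e) (dst e)) ≡ Σ< n λ u → Σ< n λ v → adj u v * F u v
  Σ-pairs F = begin
    Σ< L (λ e → F (src e) (dst e))
      ≡⟨ Σ-cong L (λ e e<L → sym (trans (Σ-δ n _ (src< e e<L)) (Σ-δ n (F (src e)) (dst< e e<L)))) ⟩
    Σ< L (λ e → Σ< n λ u → δ (src e) u * Σ< n λ v → δ (dst e) v * F u v)
      ≡⟨ Σ-swap L n _ ⟩
    Σ< n (λ u → Σ< L λ e → δ (src e) u * Σ< n λ v → δ (dst e) v * F u v)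
      ≡⟨ Σ-cong′ n (λ u → Σ-cong′ L λ e → trans (Σ-*ˡ n (δ (src e) u) _)
           (Σ-cong′ n λ v → sym (*-assoc (δ (src e) u) _ _))) ⟩
    Σ< n (λ u → Σ< L λ e → Σ< n λ v → δ (src e) u * δ (dst e) v * F u v)
      ≡⟨ Σ-cong′ n (λ u → Σ-swap L n _) ⟩
    Σ< n (λ u → Σ< n λ v → Σ< L λ e → δ (src e) u * δ (dst e) v * F u v)
      ≡⟨ Σ-cong′ n (λ u → Σ-cong′ n λ v → sym (Σ-*ʳ L (F u v) _)) ⟩
    Σ< n (λ u → Σ< n λ v → adj u v * F u v) ∎
    where open ≡-Reasoning

  Σ-out : ∀ u (f : ℕ → ℕ) → Σ< L (λ e → δ (src e) u * f (dst e)) ≡ Σ< n λ v → adj u v * f v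
  Σ-out u f = begin
    Σ< L (λ e → δ (src e) u * f (dst e))
      ≡⟨ Σ-cong L (λ e e<L → cong (δ (src e) u *_) (sym (Σ-δ n f (dst< e e<L)))) ⟩
    Σ< L (λ e → δ (src e) u * Σ< n λ v → δ (dst e) v * f v)
      ≡⟨ Σ-cong′ L (λ e → trans (Σ-*ˡ n (δ (src e) u) _) (Σ-cong′ n λ v → sym (*-assoc (δ (src e) u) _ _))) ⟩
    Σ< L (λ e → Σ< n λ v → δ (src e) u * δ (dst e) v * f v)
      ≡⟨ Σ-swap L n _ ⟩
    Σ< n (λ v → Σ< L λ e → δ (src e) u * δ (dst e) v * f v)
      ≡⟨ Σ-cong′ n (λ v → sym (Σ-*ʳ L (f v) _)) ⟩
    Σ< n (λ v → adj u v * f v) ∎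
    where open ≡-Reasoning

  Σ-in : ∀ v (f : ℕ → ℕ) → Σ< L (λ e → δ (dst e) v * f (src e)) ≡ Σ< n λ u → f u * adj u v
  Σ-in v f = begin
    Σ< L (λ e → δ (dst e) v * f (src e))
      ≡⟨ Σ-cong L (λ e e<L → cong (δ (dst e) v *_) (sym (Σ-δ n f (src< e e<L)))) ⟩
    Σ< L (λ e → δ (dst e) v * Σ< n λ u → δ (src e) u * f u)
      ≡⟨ Σ-cong′ L (λ e → trans (Σ-*ˡ n (δ (dst e) v) _) (Σ-cong′ n λ u → rearrange (δ (dst e) v) (δ (src e) u) (f u))) ⟩
    Σ< L (λ e → Σ< n λ u → f u * (δ (src e) u * δ (dst e) v))
      ≡⟨ Σ-swap L n _ ⟩
    Σ< n (λ u → Σ< L λ e → f u * (δ (src e) u * δ (dst e) v))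
      ≡⟨ Σ-cong′ n (λ u → sym (Σ-*ˡ L (f u) _)) ⟩
    Σ< n (λ u → f u * adj u v) ∎
    where
    open ≡-Reasoning
    rearrange : ∀ a b c → a * (b * c) ≡ c * (b * a)
    rearrange = solve 3 (λ a b c → a :* (b :* c) := c :* (b :* a)) refl
      where open +-*-Solver

-- A list of out-neighbours is specified only by the sums of arbitrary functions over it, so its
-- order never matters. `lead-sum` expresses that one arc is marked at each vertex with an outgoing
-- arc.
record Adjacency (G : Arcs) : Set where
  open Arcs G
  field
    deg lead : ℕ → ℕ
    out      : ℕ → ℕ → ℕ
    out-sum  : ∀ u (f : ℕ → ℕ) →
               Σ< (deg u) (λ x → f (out u x)) ≡ Σ< L λ e → δ (src e) u * f (dst e)
    lead-sum : ∀ u → Σ< L (λ e → δ (src e) u * sgn (lead e)) ≡ sgn (deg u)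
    out<     : ∀ u x → x < deg u → out u x < n

  Σ-lead : ∀ (f : ℕ → ℕ) → Σ< L (λ e → sgn (lead e) * f (src e)) ≡ Σ< n λ u → sgn (deg u) * f u
  Σ-lead f = begin
    Σ< L (λ e → sgn (lead e) * f (src e))
      ≡⟨ Σ-cong L (λ e e<L → cong (sgn (lead e) *_) (sym (Σ-δ n f (src< e e<L)))) ⟩
    Σ< L (λ e → sgn (lead e) * Σ< n λ u → δ (src e) u * f u)
      ≡⟨ Σ-cong′ L (λ e → trans (Σ-*ˡ n (sgn (lead e)) _) (Σ-cong′ n λ u →
           trans (*-CS.x∙yz≈y∙xz (sgn (lead e)) (δ (src e) u) (f u)) (sym (*-assoc (δ (src e) u) _ _)))) ⟩
    Σ< L (λ e → Σ< n λ u → δ (src e) u * sgn (lead e) * f u)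
      ≡⟨ Σ-swap L n _ ⟩
    Σ< n (λ u → Σ< L λ e → δ (src e) u * sgn (lead e) * f u)
      ≡⟨ Σ-cong′ n (λ u → trans (sym (Σ-*ʳ L (f u) _)) (cong (_* f u) (lead-sum u))) ⟩
    Σ< n (λ u → sgn (deg u) * f u) ∎
    where open ≡-Reasoning

  deg-sum : ∀ u → deg u ≡ Σ< L λ e → δ (src e) u * 1
  deg-sum u = trans (sym (trans (Σ-const (deg u) 1) (*-identityʳ _))) (out-sum u (λ _ → 1))

  deg≤L : ∀ u → deg u ≤ L
  deg≤L u = begin
    deg u                        ≡⟨ deg-sum u ⟩
    Σ< L (λ e → δ (src e) u * 1) ≤⟨ Σ-mono L (λ e _ → ≤-trans (≤-reflexive (*-identityʳ _)) (bit≤1 (src e ≡ᵇ u))) ⟩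
    Σ< L (λ _ → 1)               ≡⟨ trans (Σ-const L 1) (*-identityʳ L) ⟩
    L                            ∎
    where open ≤-Reasoning

-- The effect of each statement as a matrix expression

module Counts (p q : ℕ) (G : Arcs) (T : Adjacency G) where
  open Algorithm p q
  open Arcs G
  open Adjacency T
  open Matrices n

  hi lo : ℕ → ℕ
  hi u = ⟦ lt ⟧ L (deg u ^ suc p)
  lo u = ⟦ eq ⟧ (hi u) 0

  hi+lo : ∀ u → hi u + lo u ≡ 1
  hi+lo u with L <ᵇ deg u ^ suc p
  ... | true  = refl
  ... | false = refl

  hi-idem : ∀ u → hi u * hi u ≡ hi u
  hi-idem u with L <ᵇ deg u ^ suc p
  ... | true  = refl
  ... | false = refl

  sgn-hi : ∀ u → sgn (hi u) ≡ hi u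
  sgn-hi u with L <ᵇ deg u ^ suc p
  ... | true  = refl
  ... | false = refl

  sgn-lo : ∀ u → sgn (lo u) ≡ lo u
  sgn-lo u with L <ᵇ deg u ^ suc p
  ... | true  = refl
  ... | false = refl

  -- A vertex without outgoing arcs is never high, the exponent `suc p` being positive; hence the
  -- marked arcs miss no high vertex.
  deg-hi : ∀ u → sgn (deg u) * hi u ≡ hi u
  deg-hi u with deg u
  ... | zero  = refl
  ... | suc _ = *-identityˡ _

  open Split adj lo hi hi+lo

  record Ready (M : Mem) : Set where
    field
      cnt≡  : M CNT 0 0 ≡ L
      src≡  : ∀ e → M SRC e 0 ≡ src e
      dst≡  : ∀ e → M DST e 0 ≡ dst e
      deg≡  : ∀ u → M DEG u 0 ≡ deg u
      lead≡ : ∀ e → M LEAD e 0 ≡ lead e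
      out≡  : ∀ u x → M OUT u x ≡ out u x
  open Ready

  module _ {M : Mem} (R : Ready M) where

    eval-high : ∀ (e : Expr d) ρ → eval (high e) ρ M ≡ hi (eval e ρ M)
    eval-high e ρ =
      cong₂ ⟦ lt ⟧ (cnt≡ R) (trans (eval-power (at DEG e) (suc p) {ρ} {M}) (cong (_^ suc p) (deg≡ R (eval e ρ M))))

    eval-low : ∀ (e : Expr d) ρ → eval (low e) ρ M ≡ lo (eval e ρ M)
    eval-low e ρ = cong (λ z → ⟦ eq ⟧ z 0) (eval-high e ρ)

    Σ-arcs : ∀ f → Σ< (M CNT 0 0) f ≡ Σ< L f
    Σ-arcs f = cong (λ z → Σ< z f) (cnt≡ R)

    module _ (body : Body) (a i j : ℕ) (g : Matrix)
             (contrib-body : ∀ {d} s v (ρ : Env d) →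
                             contrib (body s v) ρ M a i j ≡ g (lookup ρ s) (lookup ρ v)) where

      contrib-extend : ∀ l s v (ρ : Env d) → lookup ρ v < n →
        contrib (extend body l s v) ρ M a i j ≡ Σ< n λ y → pow B l (lookup ρ v) y * g (lookup ρ s) y
      contrib-extend zero s v ρ v<n =
        trans (contrib-body s v ρ) (sym (Σ-δ n (g (lookup ρ s)) v<n))
      contrib-extend (suc l) s v ρ v<n = begin
        sgn (eval (low (var v)) ρ M) * Σ< (M DEG v′ 0) (λ x → contrib (extend body l (suc (suc s)) #0) (M OUT v′ x ∷ x ∷ ρ) M a i j)
          ≡⟨ cong₂ _*_ (trans (cong sgn (eval-low (var v) ρ)) (sgn-lo v′)) (cong (λ z → Σ< z walk) (deg≡ R v′)) ⟩
        lo v′ * Σ< (deg v′) (λ x → contrib (extend body l (suc (suc s)) #0) (M OUT v′ x ∷ x ∷ ρ) M a i j)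
          ≡⟨ cong (lo v′ *_) (Σ-cong (deg v′) λ x x<d →
               trans (contrib-extend l (suc (suc s)) #0 (M OUT v′ x ∷ x ∷ ρ) (subst (_< n) (sym (out≡ R v′ x)) (out< v′ x x<d)))
                     (cong F (out≡ R v′ x))) ⟩
        lo v′ * Σ< (deg v′) (λ x → F (out v′ x))
          ≡⟨ cong (lo v′ *_) (trans (out-sum v′ F) (Σ-out v′ F)) ⟩
        lo v′ * Σ< n (λ y → adj v′ y * F y)
          -- A vector is passed as a matrix all of whose columns equal it, so that the matrix lemmas
          -- apply at a dummy column 0.
          ≡⟨ scale-· lo adj (λ y _ → F y) v′ 0 ⟩
        Σ< n (λ y → B v′ y * F y)
          ≡⟨ sym (·-assoc B (pow B l) (λ y _ → g s′ y) v′ 0) ⟩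
        Σ< n (λ y → pow B (suc l) v′ y * g s′ y) ∎
        where
        open ≡-Reasoning
        v′ = lookup ρ v
        s′ = lookup ρ s
        walk : ℕ → ℕ
        walk x = contrib (extend body l (suc (suc s)) #0) (M OUT v′ x ∷ x ∷ ρ) M a i j
        F : ℕ → ℕ
        F y = Σ< n λ z → pow B l y z * g s′ z

      contrib-enumerate : ∀ l → contrib (enumerate body l) [] M a i j ≡
                          Σ< n λ s → Σ< n λ y → pow B (suc l) s y * g s y
      contrib-enumerate l = begin
        contrib (enumerate body l) [] M a i j
          ≡⟨ Σ-arcs _ ⟩
        Σ< L (λ e → sgn (eval (low (var #1)) (M DST e 0 ∷ M SRC e 0 ∷ e ∷ []) M) *
                    contrib (extend body l #1 #0) (M DST e 0 ∷ M SRC e 0 ∷ e ∷ []) M a i j)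
          ≡⟨ Σ-cong L (λ e e<L → cong₂ _*_
               (trans (cong sgn (eval-low (var #1) (M DST e 0 ∷ M SRC e 0 ∷ e ∷ []))) (trans (sgn-lo _) (cong lo (src≡ R e))))
               (trans (contrib-extend l #1 #0 (M DST e 0 ∷ M SRC e 0 ∷ e ∷ []) (subst (_< n) (sym (dst≡ R e)) (dst< e e<L)))
                      (cong₂ F (src≡ R e) (dst≡ R e)))) ⟩
        Σ< L (λ e → lo (src e) * F (src e) (dst e))
          ≡⟨ Σ-pairs (λ s v → lo s * F s v) ⟩
        Σ< n (λ s → Σ< n λ v → adj s v * (lo s * F s v))
          ≡⟨ Σ-cong′ n (λ s → trans (Σ-cong′ n λ v → trans (*-CS.x∙yz≈y∙xz (adj s v) (lo s) _) (sym (*-assoc (lo s) (adj s v) _)))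
               (sym (·-assoc B (pow B l) (λ y _ → g s y) s 0))) ⟩
        Σ< n (λ s → Σ< n λ y → pow B (suc l) s y * g s y) ∎
        where
        open ≡-Reasoning
        F : ℕ → ℕ → ℕ
        F s v = Σ< n λ y → pow B l v y * g s y

    contrib-forHigh : ∀ (s : Stmt 2) a i j (g : ℕ → ℕ) →
      (∀ e → e < L → contrib s (M SRC e 0 ∷ e ∷ []) M a i j ≡ g (src e)) →
      contrib (forHigh s) [] M a i j ≡ Σ< n λ u → hi u * g u
    contrib-forHigh s a i j g h = begin
      contrib (forHigh s) [] M a i j
        ≡⟨ Σ-arcs _ ⟩
      Σ< L (λ e → sgn (M LEAD e 0) * (sgn (eval (high (var #0)) (M SRC e 0 ∷ e ∷ []) M) * contrib s (M SRC e 0 ∷ e ∷ []) M a i j))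
        ≡⟨ Σ-cong L (λ e e<L → cong₂ (λ x y → sgn x * y) (lead≡ R e)
             (cong₂ _*_ (trans (cong sgn (eval-high (var #0) (M SRC e 0 ∷ e ∷ []))) (trans (sgn-hi _) (cong hi (src≡ R e)))) (h e e<L))) ⟩
      Σ< L (λ e → sgn (lead e) * (hi (src e) * g (src e)))
        ≡⟨ Σ-lead (λ u → hi u * g u) ⟩
      Σ< n (λ u → sgn (deg u) * (hi u * g u))
        ≡⟨ Σ-cong′ n (λ u → trans (sym (*-assoc (sgn (deg u)) (hi u) (g u))) (cong (_* g u) (deg-hi u))) ⟩
      Σ< n (λ u → hi u * g u) ∎
      where open ≡-Reasoning

    contrib-tally : ∀ u v → u < n → v < n → contrib (enumerate tally p) [] M TAB u v ≡ pow B (suc p) u v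
    contrib-tally u v u<n v<n = begin
      contrib (enumerate tally p) [] M TAB u v
        ≡⟨ contrib-enumerate tally TAB u v _ (λ s v ρ → refl) p ⟩
      Σ< n (λ s → Σ< n λ y → pow B (suc p) s y * (1 * (δ s u * (δ y v * 1))))
        ≡⟨ Σ-cong′ n (λ s → trans (Σ-cong′ n λ y → rearrange (pow B (suc p) s y) (δ s u) (δ y v) (δ-sym s u) (δ-sym y v))
             (trans (sym (Σ-*ˡ n (δ u s) _)) (cong (δ u s *_) (Σ-δ n (pow B (suc p) s) v<n)))) ⟩
      Σ< n (λ s → δ u s * pow B (suc p) s v)
        ≡⟨ Σ-δ n (λ s → pow B (suc p) s v) u<n ⟩
      pow B (suc p) u v ∎
      where
      open ≡-Reasoning
      rearrange : ∀ b x y {x′ y′} → x ≡ x′ → y ≡ y′ → b * (1 * (x * (y * 1))) ≡ x′ * (y′ * b)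
      rearrange b x y refl refl = solve 3 (λ b x y → b :* (con 1 :* (x :* (y :* con 1))) := x :* (y :* b)) refl b x y
        where open +-*-Solver

    -- The table is read with its ends exchanged, so each walk of `suc q` steps is closed by one of
    -- `suc p` steps.
    contrib-match : ∀ r → (∀ u v → u < n → v < n → M TAB u v ≡ pow B (suc p) u v) →
                    contrib (enumerate (match r) q) [] M r 0 0 ≡ trace (pow B length-of-cycle)
    contrib-match r tab = begin
      contrib (enumerate (match r) q) [] M r 0 0
        ≡⟨ contrib-enumerate (match r) r 0 0 (λ s y → M TAB y s)
             (λ s v ρ → trans (δ-refl-* r _) (trans (*-identityˡ _) (*-identityˡ _))) q ⟩
      Σ< n (λ s → Σ< n λ y → pow B (suc q) s y * M TAB y s)
        ≡⟨ Σ-cong n (λ s s<n → Σ-cong n λ y y<n → cong (pow B (suc q) s y *_) (tab y s y<n s<n)) ⟩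
      trace (pow B (suc q) · pow B (suc p))
        ≡⟨ trace-cong {pow B (suc q) · pow B (suc p)} {pow B length-of-cycle}
             (λ u v u<n v<n → sym (pow-+ B (suc q) (suc p) u v u<n v<n)) ⟩
      trace (pow B length-of-cycle) ∎
      where open ≡-Reasoning

    contrib-seed : ∀ h v → h < n → contrib seed [] M 8 h v ≡ hi h * δ h v
    contrib-seed h v h<n = begin
      contrib seed [] M 8 h v
        ≡⟨ contrib-forHigh (acc 8 (var #0) (var #0) (lit 1)) 8 h v _ (λ e _ → cong (λ u → 1 * (δ u h * (δ u v * 1))) (src≡ R e)) ⟩
      Σ< n (λ u → hi u * (1 * (δ u h * (δ u v * 1))))
        ≡⟨ Σ-cong′ n (λ u → rearrange (hi u) (δ u h) (δ u v) (δ-sym u h)) ⟩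
      Σ< n (λ u → δ h u * (hi u * δ u v))
        ≡⟨ Σ-δ n (λ u → hi u * δ u v) h<n ⟩
      hi h * δ h v ∎
      where
      open ≡-Reasoning
      rearrange : ∀ b x y {x′} → x ≡ x′ → b * (1 * (x * (y * 1))) ≡ x′ * (b * y)
      rearrange b x y refl = solve 3 (λ b x y → b :* (con 1 :* (x :* (y :* con 1))) := x :* (b :* y)) refl b x y
        where open +-*-Solver

    record Layer (a j : ℕ) : Set where
      field
        walks≡ : ∀ h v → h < n → v < n → M a h v ≡ hi h * pow adj j h v
        split≡ : ∀ h v → h < n → v < n → M (suc a) h v ≡ hi h * Q j h v
    open Layer

    module _ {a j : ℕ} (Y : Layer a j) where

      Σ-advance : ∀ h v → h < n → (f : ℕ → ℕ → ℕ) →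
        Σ< n (λ u → hi u * Σ< L (λ e → δ u h * (δ (dst e) v * f u (src e)))) ≡
        hi h * Σ< n (λ x → f h x * adj x v)
      Σ-advance h v h<n f = begin
        Σ< n (λ u → hi u * Σ< L (λ e → δ u h * (δ (dst e) v * f u (src e))))
          ≡⟨ Σ-cong′ n (λ u → trans (cong (hi u *_) (sym (Σ-*ˡ L (δ u h) _)))
               (trans (*-CS.x∙yz≈y∙xz (hi u) (δ u h) _) (cong (_* _) (δ-sym u h)))) ⟩
        Σ< n (λ u → δ h u * (hi u * Σ< L (λ e → δ (dst e) v * f u (src e))))
          ≡⟨ Σ-δ n _ h<n ⟩
        hi h * Σ< L (λ e → δ (dst e) v * f h (src e))
          ≡⟨ cong (hi h *_) (Σ-in v (f h)) ⟩
        hi h * Σ< n (λ x → f h x * adj x v) ∎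
        where open ≡-Reasoning

      -- The arrays already carry the factor `hi h`, and `forHigh` supplies it again; idempotence
      -- merges the two.
      absorb : ∀ h v (f g : ℕ → ℕ) → (∀ x → x < n → f x ≡ hi h * g x) →
               hi h * Σ< n (λ x → f x * adj x v) ≡ hi h * Σ< n (λ x → g x * adj x v)
      absorb h v f g e = begin
        hi h * Σ< n (λ x → f x * adj x v)
          ≡⟨ cong (hi h *_) (trans (Σ-cong n λ x x<n → trans (cong (_* adj x v) (e x x<n)) (*-assoc (hi h) (g x) _))
               (sym (Σ-*ˡ n (hi h) _))) ⟩
        hi h * (hi h * Σ< n (λ x → g x * adj x v))
          ≡⟨ trans (sym (*-assoc (hi h) (hi h) _)) (cong (_* _) (hi-idem h)) ⟩
        hi h * Σ< n (λ x → g x * adj x v) ∎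
        where open ≡-Reasoning

      contrib-layer-walks : ∀ h v → h < n → v < n →
        contrib (layer a) [] M (2 + a) h v ≡ hi h * pow adj (suc j) h v
      contrib-layer-walks h v h<n v<n = begin
        contrib (layer a) [] M (2 + a) h v
          ≡⟨ contrib-forHigh (advance a) (2 + a) h v _ (λ e _ → trans (Σ-arcs _)
               (trans (Σ-cong′ L λ e′ → trans (cong₂ _+_ (δ-refl-* a _) (other a _))
                 (trans (+-identityʳ _) (cong₂ (λ x y → δ (M SRC e 0) h * (δ y v * M a (M SRC e 0) x)) (src≡ R e′) (dst≡ R e′))))
                 (cong (λ u → Σ< L λ e′ → δ u h * (δ (dst e′) v * M a u (src e′))) (src≡ R e)))) ⟩
        Σ< n (λ u → hi u * Σ< L (λ e → δ u h * (δ (dst e) v * M a u (src e))))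
          ≡⟨ Σ-advance h v h<n (M a) ⟩
        hi h * Σ< n (λ x → M a h x * adj x v)
          ≡⟨ absorb h v (M a h) (pow adj j h) (λ x x<n → walks≡ Y h x h<n x<n) ⟩
        hi h * (pow adj j · adj) h v
          ≡⟨ cong (hi h *_) (sym (pow-sucʳ adj j h v h<n v<n)) ⟩
        hi h * pow adj (suc j) h v ∎
        where
        open ≡-Reasoning
        other : ∀ a x → δ (suc a) a * x ≡ 0
        other a x = cong (_* x) (δ-≢ {suc a} {a} 1+n≢n)

      contrib-layer-split : ∀ h v → h < n → v < n →
        contrib (layer a) [] M (3 + a) h v ≡ hi h * Q (suc j) h v
      contrib-layer-split h v h<n v<n = begin
        contrib (layer a) [] M (3 + a) h v
          ≡⟨ contrib-forHigh (advance a) (3 + a) h v _ (λ e _ → trans (Σ-arcs _)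
               (trans (Σ-cong′ L λ e′ → trans (cong₂ _+_ (other a _) (δ-refl-* a _))
                 (cong₂ _*_ (refl {x = δ (M SRC e 0) h}) (cong₂ _*_ (cong (λ y → δ y v) (dst≡ R e′))
                   (trans (cong (λ z → M a (M SRC e 0) (M SRC e′ 0) + z * M (suc a) (M SRC e 0) (M SRC e′ 0))
                     (eval-low (var #1) (M DST e′ 0 ∷ M SRC e′ 0 ∷ e′ ∷ M SRC e 0 ∷ e ∷ [])))
                          (cong (f (M SRC e 0)) (src≡ R e′))))))
                 (cong (λ u → Σ< L λ e′ → δ u h * (δ (dst e′) v * f u (src e′))) (src≡ R e)))) ⟩
        Σ< n (λ u → hi u * Σ< L (λ e → δ u h * (δ (dst e) v * f u (src e))))
          ≡⟨ Σ-advance h v h<n f ⟩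
        hi h * Σ< n (λ x → f h x * adj x v)
          ≡⟨ absorb h v (f h) (λ x → pow adj j h x + lo x * Q j h x) (λ x x<n →
               trans (cong₂ (λ y z → y + lo x * z) (walks≡ Y h x h<n x<n) (split≡ Y h x h<n x<n))
                     (factor (hi h) (pow adj j h x) (lo x) (Q j h x))) ⟩
        hi h * Q (suc j) h v ∎
        where
        open ≡-Reasoning
        f : ℕ → ℕ → ℕ
        f u x = M a u x + lo x * M (suc a) u x
        other : ∀ a x → δ a (suc a) * x ≡ 0
        other a x = cong (_* x) (δ-≢ {a} {suc a} (λ e → 1+n≢n (sym e)))
        factor : ∀ c x l y → c * x + l * (c * y) ≡ c * (x + l * y)
        factor = solve 4 (λ c x l y → c :* x :+ l :* (c :* y) := c :* (x :+ l :* y)) refl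
          where open +-*-Solver

      contrib-finish : (∀ u v → u < n → v < n → M TAB u v ≡ pow B (suc p) u v) → j ≡ length-of-cycle →
                       contrib (finish a) [] M (2 + a) 0 0 ≡ trace (pow adj length-of-cycle)
      contrib-finish tab refl = begin
        contrib (finish a) [] M (2 + a) 0 0
          ≡⟨ cong₂ _+_ (contrib-match (2 + a) tab)
               (contrib-forHigh (acc (2 + a) (lit 0) (lit 0) (get (suc a) (var #0) (var #0))) (2 + a) 0 0 (λ u → M (suc a) u u) (λ e _ →
                  trans (δ-refl-* a _) (trans (*-identityˡ _)
                    (trans (*-identityˡ _) (cong (λ u → M (suc a) u u) (src≡ R e)))))) ⟩
        trace (pow B length-of-cycle) + Σ< n (λ u → hi u * M (suc a) u u)
          ≡⟨ cong (trace (pow B length-of-cycle) +_) (Σ-cong n λ u u<n →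
               trans (cong (hi u *_) (split≡ Y u u u<n u<n))
                     (trans (sym (*-assoc (hi u) (hi u) _)) (cong (_* Q length-of-cycle u u) (hi-idem u)))) ⟩
        trace (pow B length-of-cycle) + trace (scale hi (Q length-of-cycle))
          ≡⟨ sym (trace-pow length-of-cycle) ⟩
        trace (pow adj length-of-cycle) ∎
        where open ≡-Reasoning

-- Running time and safety

^-distribʳ-* : ∀ r a b → (a * b) ^ r ≡ a ^ r * b ^ r
^-distribʳ-* zero    a b = refl
^-distribʳ-* (suc r) a b =
  trans (cong (a * b *_) (^-distribʳ-* r a b)) (*-CS.interchange a b (a ^ r) (b ^ r))

^-cancelˡ-< : ∀ r {a b} → a ^ r < b ^ r → a < b
^-cancelˡ-< r {a} {b} a^r<b^r = ≰⇒> λ b≤a → <⇒≱ a^r<b^r (^-monoˡ-≤ r b≤a)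

-- Serves the analysis only: the program extracts no roots. The downward search can start at `Y`,
-- since `suc Y ^ suc r` exceeds `Y`.
root : ∀ r Y → 1 ≤ Y → ∃[ D ] 1 ≤ D × D ^ suc r ≤ Y × Y < suc D ^ suc r
root r Y 1≤Y = go Y (≤-<-trans (≤-trans (≤-reflexive (sym (*-identityʳ Y))) (*-monoʳ-≤ Y (m^n>0 Y r))) (^-monoˡ-< (suc r) (n<1+n Y)))
  where
  instance
    Y≢0 : NonZero Y
    Y≢0 = >-nonZero 1≤Y
  go : ∀ E → Y < suc E ^ suc r → ∃[ D ] 1 ≤ D × D ^ suc r ≤ Y × Y < suc D ^ suc r
  go zero    Y< = contradiction Y< (≤⇒≯ (≤-trans (≤-reflexive (^-zeroˡ (suc r))) 1≤Y))
  go (suc E) Y< with suc E ^ suc r ≤? Y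
  ... | yes ≤Y = suc E , s≤s z≤n , ≤Y , Y<
  ... | no  ≰Y = go E (≰⇒> ≰Y)

module Resources (p q : ℕ) (G : Arcs) (T : Adjacency G) where
  open Algorithm p q
  open Arcs G
  open Adjacency T
  open Counts p q G T
  open Ready

  Y : ℕ
  Y = 1 ⊔ L

  1≤Y : 1 ≤ Y
  1≤Y = m≤m⊔n 1 L

  L≤Y : L ≤ Y
  L≤Y = m≤n⊔m 1 L

  -- The number of high vertices, counted through their marked arcs.
  heads : ℕ
  heads = Σ< L λ e → sgn (lead e) * hi (src e)

  hi-cases : ∀ u → (hi u ≡ 0 × deg u ^ suc p ≤ L) ⊎ (hi u ≡ 1 × L < deg u ^ suc p)
  hi-cases u with L <ᵇ deg u ^ suc p | <ᵇ⇒< L (deg u ^ suc p) | <⇒<ᵇ {L} {deg u ^ suc p}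
  ... | true  | t | _ = inj₂ (refl , t tt)
  ... | false | _ | f = inj₁ (refl , ≮⇒≥ f)

  module Threshold {D : ℕ} (1≤D : 1 ≤ D) (D^r≤Y : D ^ suc p ≤ Y) (Y<1+D^r : Y < suc D ^ suc p) where

    low-deg : ∀ u → lo u ≢ 0 → deg u ≤ D
    low-deg u nz with hi-cases u
    ... | inj₂ (h , _) = contradiction (cong (λ z → ⟦ eq ⟧ z 0) h) nz
    ... | inj₁ (_ , deg^r≤L) =
      ≤-pred (^-cancelˡ-< (suc p) (≤-<-trans (≤-trans deg^r≤L L≤Y) Y<1+D^r))

    high-deg : ∀ u → 1 ≤ L → hi u * suc D ≤ hi u * deg u
    high-deg u 1≤L with hi-cases u
    ... | inj₁ (h , _) = ≤-reflexive (trans (cong (_* suc D) h) (cong (_* deg u) (sym h)))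
    -- As there is an arc, `Y` is at most `L`, so `D ^ suc p ≤ L < deg u ^ suc p`.
    ... | inj₂ (_ , L<deg^r) = *-monoʳ-≤ (hi u)
      (^-cancelˡ-< (suc p) (≤-<-trans (≤-trans D^r≤Y (⊔-lub 1≤L ≤-refl)) L<deg^r))

    -- Each high vertex has more than D outgoing arcs, and is led by one arc.
    heads-bound : heads * suc D ≤ L
    heads-bound = begin
      heads * suc D
        ≡⟨ Σ-*ʳ L (suc D) _ ⟩
      Σ< L (λ e → sgn (lead e) * hi (src e) * suc D)
        ≤⟨ Σ-mono L (λ e e<L → ≤-trans (≤-reflexive (*-assoc (sgn (lead e)) (hi (src e)) (suc D)))
             (≤-trans (*-monoʳ-≤ (sgn (lead e)) (high-deg (src e) (≤-trans (s≤s z≤n) e<L)))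
               (*-monoʳ-≤ (sgn (lead e)) (≤-trans (*-monoˡ-≤ (deg (src e)) (hi≤1 (src e))) (≤-reflexive (*-identityˡ _)))))) ⟩
      Σ< L (λ e → sgn (lead e) * deg (src e))
        ≡⟨ Σ-lead deg ⟩
      Σ< n (λ u → sgn (deg u) * deg u)
        ≤⟨ Σ-mono n (λ u _ → ≤-trans (*-monoˡ-≤ (deg u) (sgn≤1 (deg u))) (≤-reflexive (*-identityˡ _))) ⟩
      Σ< n deg
        ≡⟨ Σ-cong′ n deg-sum ⟩
      Σ< n (λ u → Σ< L λ e → δ (src e) u * 1)
        ≡⟨ Σ-swap n L _ ⟩
      Σ< L (λ e → Σ< n λ u → δ (src e) u * 1)
        ≡⟨ Σ-cong L (λ e e<L → Σ-δ n (λ _ → 1) (src< e e<L)) ⟩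
      Σ< L (λ _ → 1)
        ≡⟨ trans (Σ-const L 1) (*-identityʳ L) ⟩
      L ∎
      where
      open ≤-Reasoning
      hi≤1 : ∀ u → hi u ≤ 1
      hi≤1 u = bit≤1 (L <ᵇ deg u ^ suc p)

    -- `D ^ p` bounds the walks continuing a given first arc, `heads` the number of passes over all
    -- arcs; one budget serves both kinds of phase.
    Z : ℕ
    Z = D ^ p ⊔ heads

    1≤D^ : ∀ j → 1 ≤ D ^ j
    1≤D^ j = m^n>0 D {{>-nonZero 1≤D}} j

    1≤Z : 1 ≤ Z
    1≤Z = ≤-trans (1≤D^ p) (m≤m⊔n (D ^ p) heads)

    -- The factor 2 is for `forHigh`, which scans all arcs in addition to processing the high
    -- vertices.
    budget : ℕ
    budget = 2 * (Y * Z)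

    YD^p-bound : (Y * D ^ p) ^ suc p ≤ Y ^ (suc p + p)
    YD^p-bound = begin
      (Y * D ^ p) ^ suc p          ≡⟨ ^-distribʳ-* (suc p) Y (D ^ p) ⟩
      Y ^ suc p * (D ^ p) ^ suc p  ≡⟨ cong (Y ^ suc p *_) (trans (^-*-assoc D p (suc p))
                                       (trans (cong (D ^_) (*-comm p (suc p))) (sym (^-*-assoc D (suc p) p)))) ⟩
      Y ^ suc p * (D ^ suc p) ^ p  ≤⟨ *-monoʳ-≤ (Y ^ suc p) (^-monoˡ-≤ p D^r≤Y) ⟩
      Y ^ suc p * Y ^ p            ≡⟨ sym (^-distribˡ-+-* Y (suc p) p) ⟩
      Y ^ (suc p + p)              ∎
      where open ≤-Reasoning

    -- One factor `Y` is traded for `suc D ^ suc p`, which joins `heads ^ suc p` to a power of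
    -- `heads * suc D ≤ L`.
    Yheads-bound : (Y * heads) ^ suc p ≤ Y ^ (suc p + p)
    Yheads-bound = begin
      (Y * heads) ^ suc p               ≡⟨ ^-distribʳ-* (suc p) Y heads ⟩
      Y ^ suc p * heads ^ suc p         ≡⟨ trans (cong (_* heads ^ suc p) (*-comm Y (Y ^ p))) (*-assoc (Y ^ p) Y _) ⟩
      Y ^ p * (Y * heads ^ suc p)       ≤⟨ *-monoʳ-≤ (Y ^ p) (*-monoˡ-≤ (heads ^ suc p) (<⇒≤ Y<1+D^r)) ⟩
      Y ^ p * (suc D ^ suc p * heads ^ suc p)
        ≡⟨ cong (Y ^ p *_) (trans (*-comm (suc D ^ suc p) _) (sym (^-distribʳ-* (suc p) heads (suc D)))) ⟩
      Y ^ p * (heads * suc D) ^ suc p   ≤⟨ *-monoʳ-≤ (Y ^ p) (^-monoˡ-≤ (suc p) (≤-trans heads-bound L≤Y)) ⟩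
      Y ^ p * Y ^ suc p                 ≡⟨ trans (*-comm (Y ^ p) _) (sym (^-distribˡ-+-* Y (suc p) p)) ⟩
      Y ^ (suc p + p)                   ∎
      where open ≤-Reasoning

    budget-bound : budget ^ suc p ≤ 2 ^ suc p * Y ^ (suc p + p)
    budget-bound = ≤-trans (≤-reflexive (^-distribʳ-* (suc p) 2 (Y * Z))) (*-monoʳ-≤ (2 ^ suc p) YZ-bound)
      where
      YZ-bound : (Y * Z) ^ suc p ≤ Y ^ (suc p + p)
      YZ-bound with ⊔-sel (D ^ p) heads
      ... | inj₁ e = subst (λ z → (Y * z) ^ suc p ≤ Y ^ (suc p + p)) (sym e) YD^p-bound
      ... | inj₂ e = subst (λ z → (Y * z) ^ suc p ≤ Y ^ (suc p + p)) (sym e) Yheads-bound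

    Y≤YZ : Y ≤ Y * Z
    Y≤YZ = m≤m*n Y Z {{>-nonZero 1≤Z}}

    YZ≤budget : Y * Z ≤ budget
    YZ≤budget = m≤m+n (Y * Z) (Y * Z + 0)

    1≤budget : 1 ≤ budget
    1≤budget = ≤-trans 1≤Y (≤-trans Y≤YZ YZ≤budget)

    module _ (w N Ω : ℕ) (2≤Ω : 2 ≤ Ω) (N≤Ω : N ≤ Ω) (n≤N : n ≤ N) (L<N : L < N)
             {M : Mem} (R : Ready M) where
      open Machine w N Ω 2≤Ω N≤Ω

      0<N : 0 < N
      0<N = ≤-<-trans z≤n L<N

      in-vertex : ∀ {v} → v < n → v < N
      in-vertex v<n = <-≤-trans v<n n≤N

      in-arc : ∀ {e} → e < L → e < N
      in-arc e<L = <-trans e<L L<N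

      power-InBounds : ∀ (e : Expr d) r {ρ} → InBounds M e ρ → InBounds M (power e r) ρ
      power-InBounds e zero    b = tt
      power-InBounds e (suc r) b = b , power-InBounds e r b

      high-InBounds : ∀ (x : Fin d) {ρ} → lookup ρ x < n → InBounds M (high (var x)) ρ
      high-InBounds x x<n =
        (tt , tt , 0<N , 0<N) , let b = tt , tt , in-vertex x<n , 0<N in b , power-InBounds (at DEG (var x)) p b

      low-InBounds : ∀ (x : Fin d) {ρ} → lookup ρ x < n → InBounds M (low (var x)) ρ
      low-InBounds x x<n = high-InBounds x x<n , tt

      src-vertex : ∀ {e} → e < L → M SRC e 0 < n
      src-vertex {e} e<L = subst (_< n) (sym (src≡ R e)) (src< e e<L)

      dst-vertex : ∀ {e} → e < L → M DST e 0 < n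
      dst-vertex {e} e<L = subst (_< n) (sym (dst≡ R e)) (dst< e e<L)

      OK-forArcs : ∀ {s : Stmt (suc d)} {ρ B} (b : ℕ → ℕ) → 1 ≤ B →
                   (∀ e → e < L → OK M s (e ∷ ρ) (b e)) → Σ< L b ≤ B → OK M (forArcs s) ρ B
      OK-forArcs b 1≤B os Σ≤B = for b (tt , tt , 0<N , 0<N) 1≤B
        (λ e e< → os e (subst (e <_) (cnt≡ R) e<)) (subst (λ z → Σ< z b ≤ _) (sym (cnt≡ R)) Σ≤B)

      module _ (body : Body) (OK-body : ∀ {d} s v (ρ : Env d) → lookup ρ s < n → lookup ρ v < n →
                                        OK M (body s v) ρ 1) where

        OK-extend : ∀ j s v (ρ : Env d) → lookup ρ s < n → lookup ρ v < n → OK M (extend body j s v) ρ (D ^ j)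
        OK-extend zero    s v ρ s<n v<n = OK-body s v ρ s<n v<n
        OK-extend (suc j) s v ρ s<n v<n = when (low-InBounds v v<n) (1≤D^ (suc j)) λ nz →
          for (λ _ → D ^ j) (tt , tt , in-vertex v<n , 0<N) (1≤D^ (suc j))
            (λ x x< → let x<deg = subst (x <_) (deg≡ R v′) x< in
              bind (tt , tt , in-vertex v<n , <-trans (<-≤-trans x<deg (deg≤L v′)) L<N)
                (OK-extend j (suc (suc s)) #0 (M OUT v′ x ∷ x ∷ ρ) s<n
                  (subst (_< n) (sym (out≡ R v′ x)) (out< v′ x x<deg))))
            (≤-trans (≤-reflexive (Σ-const (M DEG v′ 0) (D ^ j)))
              (*-monoˡ-≤ (D ^ j) (≤-trans (≤-reflexive (deg≡ R v′))
                (low-deg v′ λ z → nz (trans (eval-low R (var v) ρ) z)))))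
          where v′ = lookup ρ v

        OK-enumerate : ∀ j → j ≤ p → OK M (enumerate body j) [] budget
        OK-enumerate j j≤p = OK-forArcs (λ _ → D ^ j) 1≤budget
          (λ e e<L → bind (tt , tt , in-arc e<L , 0<N) (bind (tt , tt , in-arc e<L , 0<N)
            (when (low-InBounds #1 (src-vertex e<L)) (1≤D^ j) λ _ →
              OK-extend j #1 #0 (M DST e 0 ∷ M SRC e 0 ∷ e ∷ []) (src-vertex e<L) (dst-vertex e<L))))
          (begin
            Σ< L (λ _ → D ^ j) ≡⟨ Σ-const L (D ^ j) ⟩
            L * D ^ j          ≤⟨ *-mono-≤ L≤Y (≤-trans (^-monoʳ-≤ D {{>-nonZero 1≤D}} j≤p) (m≤m⊔n (D ^ p) heads)) ⟩
            Y * Z              ≤⟨ YZ≤budget ⟩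
            budget             ∎)
          where open ≤-Reasoning

      OK-forHigh : ∀ {s : Stmt 2} b → b ≤ Y →
        (∀ e B → e < L → b ≤ B → 1 ≤ B → OK M s (M SRC e 0 ∷ e ∷ []) B) → OK M (forHigh s) [] budget
      OK-forHigh {s} b b≤Y os = OK-forArcs b′ 1≤budget
        (λ e e<L → when (tt , tt , in-arc e<L , 0<N) (s≤s z≤n) λ lead≢0 →
          bind (tt , tt , in-arc e<L , 0<N)
            (when (high-InBounds #0 (src-vertex e<L)) (s≤s z≤n) λ high≢0 →
              os e (b′ e) e<L (enough e lead≢0 high≢0) (s≤s z≤n)))
        (begin
          Σ< L b′
            ≡⟨ Σ-+ L (λ _ → 1) (λ e → sgn (lead e) * hi (src e) * b) ⟩
          Σ< L (λ _ → 1) + Σ< L (λ e → sgn (lead e) * hi (src e) * b)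
            ≡⟨ cong₂ _+_ (trans (Σ-const L 1) (*-identityʳ L)) (sym (Σ-*ʳ L b _)) ⟩
          L + heads * b
            ≤⟨ +-mono-≤ (≤-trans L≤Y Y≤YZ) (≤-trans (*-mono-≤ (m≤n⊔m (D ^ p) heads) b≤Y) (≤-reflexive (*-comm Z Y))) ⟩
          Y * Z + Y * Z
            ≡⟨ cong (Y * Z +_) (sym (+-identityʳ (Y * Z))) ⟩
          budget ∎)
        where
        open ≤-Reasoning
        b′ : ℕ → ℕ
        -- Every arc pays one unit for its tests; only the marked arc of a high vertex pays for the
        -- body.
        b′ e = 1 + sgn (lead e) * hi (src e) * b
        enough : ∀ e → M LEAD e 0 ≢ 0 → eval (high (var #0)) (M SRC e 0 ∷ e ∷ []) M ≢ 0 → b ≤ b′ e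
        enough e lead≢0 high≢0 with lead e | lead≡ R e | hi-cases (src e)
        ... | zero  | z | _ = contradiction z lead≢0
        ... | suc _ | _ | inj₁ (h , _) =
          contradiction (trans (eval-high R (var #0) (M SRC e 0 ∷ e ∷ [])) (trans (cong hi (src≡ R e)) h)) high≢0
        ... | suc _ | _ | inj₂ (h , _) rewrite h = ≤-trans (≤-reflexive (sym (*-identityˡ _))) (n≤1+n _)

      OK-tally : OK M (enumerate tally p) [] budget
      OK-tally = OK-enumerate tally
        (λ s v ρ s<n v<n → acc (tt , tt , in-vertex s<n , in-vertex v<n) tt ≤-refl) p ≤-refl

      OK-seed : OK M seed [] budget
      OK-seed = OK-forHigh 1 1≤Y λ e B e<L _ 1≤B →
        acc (tt , tt , in-vertex (src-vertex e<L) , in-vertex (src-vertex e<L)) tt 1≤B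

      OK-layer : ∀ a → OK M (layer a) [] budget
      OK-layer a = OK-forHigh L L≤Y λ e B e<L L≤B 1≤B →
        let h = in-vertex (src-vertex e<L) in
        OK-forArcs (λ _ → 1) 1≤B
          (λ e′ e′<L →
            let u = in-vertex (src-vertex e′<L)
                v = in-vertex (dst-vertex e′<L) in
            bind (tt , tt , in-arc e′<L , 0<N) (bind (tt , tt , in-arc e′<L , 0<N)
              (acc (tt , tt , h , v) (tt , tt , h , u) ≤-refl ⨟
               acc (tt , tt , h , v) ((tt , tt , h , u) , low-InBounds #1 (src-vertex e′<L) , (tt , tt , h , u)) ≤-refl)))
          (≤-trans (≤-reflexive (trans (Σ-const L 1) (*-identityʳ L))) L≤B)

      OK-finish : ∀ a → q ≤ p → OK M (finish a) [] budget
      OK-finish a q≤p =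
        OK-enumerate (match (2 + a)) (λ s v ρ s<n v<n →
          acc (tt , tt , 0<N , 0<N) (tt , tt , in-vertex v<n , in-vertex s<n) ≤-refl) q q≤p ⨟
        OK-forHigh 1 1≤Y λ e B e<L _ 1≤B →
          acc (tt , tt , 0<N , 0<N) (tt , tt , in-vertex (src-vertex e<L) , in-vertex (src-vertex e<L)) 1≤B

-- Array discipline and correctness of the counting phases

module Discipline (p q : ℕ) where
  open Algorithm p q

  module _ {θ : ℕ} (7≤θ : 7 ≤ θ) where

    table : ∀ a {_ : T (a <ᵇ 7)} → a < θ
    table a {t} = <-≤-trans (<ᵇ⇒< a 7 t) 7≤θ

    Reads-power : ∀ (e : Expr d) r → Reads (_< θ) e → Reads (_< θ) (power e r)
    Reads-power e zero    h = tt
    Reads-power e (suc r) h = h , Reads-power e r h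

    Reads-high : ∀ (v : Fin d) → Reads (_< θ) (high (var v))
    Reads-high v = (table CNT , tt , tt) , (table DEG , tt , tt) , Reads-power (at DEG (var v)) p (table DEG , tt , tt)

    Reads-extend : ∀ {body : Body} → (∀ {d} (s v : Fin d) → Reads* (_< θ) (body s v)) →
                   ∀ j (s v : Fin d) → Reads* (_< θ) (extend body j s v)
    Reads-extend h zero    s v = h s v
    Reads-extend h (suc j) s v =
      (Reads-high v , tt) , (table DEG , tt , tt) , (table OUT , tt , tt) , Reads-extend h j _ _

    Reads-enumerate : ∀ {body : Body} → (∀ {d} (s v : Fin d) → Reads* (_< θ) (body s v)) →
                      ∀ j → Reads* (_< θ) (enumerate body j)
    Reads-enumerate h j = (table CNT , tt , tt) , (table SRC , tt , tt) , (table DST , tt , tt) ,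
      (Reads-high _ , tt) , Reads-extend h j _ _

    Reads-forHigh : ∀ s → Reads* (_< θ) s → Reads* (_< θ) (forHigh s)
    Reads-forHigh s h = (table CNT , tt , tt) , (table LEAD , tt , tt) , (table SRC , tt , tt) , Reads-high _ , h

    Reads-advance : ∀ a → suc a < θ → Reads* (_< θ) (advance a)
    Reads-advance a a< = (table CNT , tt , tt) , (table SRC , tt , tt) , (table DST , tt , tt) ,
      (tt , tt , <-trans ≤-refl a< , tt , tt) ,
      (tt , tt , (<-trans ≤-refl a< , tt , tt) , (Reads-high _ , tt) , (a< , tt , tt))

  Writes-extend : ∀ {P : ℕ → Set} {body : Body} → (∀ {d} (s v : Fin d) → Writes P (body s v)) →
                  ∀ j (s v : Fin d) → Writes P (extend body j s v)
  Writes-extend h zero    s v = h s v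
  Writes-extend h (suc j) s v = Writes-extend h j _ _

  Writes-finish : ∀ {P : ℕ → Set} a → P (2 + a) → Writes P (finish a)
  Writes-finish a h = Writes-extend {body = match (2 + a)} (λ _ _ → h) q _ _ , h

  -- The cell bounds of successive phases are iterated powers, so their exponents multiply. `Ω` is
  -- fixed before the first phase and must dominate the last bound.
  growth : ℕ → ℕ → ℕ
  growth a zero    = 2 + size* (finish a)
  growth a (suc j) = (2 + size* (layer a)) * growth (2 + a) j

  1≤growth : ∀ a j → 1 ≤ growth a j
  1≤growth a zero    = s≤s z≤n
  1≤growth a (suc j) = *-mono-≤ {1} {2 + size* (layer a)} (s≤s z≤n) (1≤growth (2 + a) j)

  count : Stmt 0
  count = enumerate tally p ⨟ seed ⨟ layers 8 length-of-cycle

  count-growth : ℕ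
  count-growth = (2 + size* (enumerate tally p)) * ((2 + size* seed) * growth 8 length-of-cycle)

module Correctness (p q : ℕ) (q≤p : q ≤ p) (G : Arcs) (T : Adjacency G)
  {D : ℕ} (1≤D : 1 ≤ D) (D^r≤Y : D ^ suc p ≤ 1 ⊔ Arcs.L G) (Y<1+D^r : 1 ⊔ Arcs.L G < suc D ^ suc p)
  (w N Ω : ℕ) (2≤Ω : 2 ≤ Ω) (N≤Ω : N ≤ Ω) (n≤N : Arcs.n G ≤ N) (L<N : Arcs.L G < N) where

  open Algorithm p q
  open Discipline p q
  open Arcs G
  open Adjacency T
  open Counts p q G T
  open Resources p q G T
  open Matrices n
  open Split adj lo hi hi+lo
  open Threshold 1≤D D^r≤Y Y<1+D^r
  open Machine w N Ω 2≤Ω N≤Ω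
  open Ready
  open Layer

  Ready-keep : ∀ {M M′} → (∀ a i j → a < 7 → M′ a i j ≡ M a i j) → Ready M → Ready M′
  Ready-keep k R = record
    { cnt≡  = trans (k CNT 0 0 (<ᵇ⇒< _ _ tt)) (cnt≡ R)
    ; src≡  = λ e → trans (k SRC e 0 (<ᵇ⇒< _ _ tt)) (src≡ R e)
    ; dst≡  = λ e → trans (k DST e 0 (<ᵇ⇒< _ _ tt)) (dst≡ R e)
    ; deg≡  = λ u → trans (k DEG u 0 (<ᵇ⇒< _ _ tt)) (deg≡ R u)
    ; lead≡ = λ e → trans (k LEAD e 0 (<ᵇ⇒< _ _ tt)) (lead≡ R e)
    ; out≡  = λ u x → trans (k OUT u x (<ᵇ⇒< _ _ tt)) (out≡ R u x)
    }

  Tabulated : Mem → Set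
  Tabulated M = ∀ u v → u < n → v < n → M TAB u v ≡ pow B (suc p) u v

  -- Length `j` is stored in arrays `a` and `suc a`. `empty` makes the contents of the next pair
  -- equal to the contribution written into it.
  record Stage (a j U : ℕ) (M : Mem) : Set where
    field
      8≤a   : 8 ≤ a
      2≤U   : 2 ≤ U
      M≤U   : ∀ b i i′ → M b i i′ ≤ U
      ready : Ready M
      tab   : Tabulated M
      layer≡ : Layer ready a j
      empty : ∀ b i i′ → 2 + a ≤ b → M b i i′ ≡ 0

  2≤^ : ∀ {U} x → 2 ≤ U → 2 ≤ U ^ (2 + x)
  2≤^ x 2≤U = ≤^1 2≤U {y = 2 + x} 2≤U (s≤s z≤n)

  ^≤-first : ∀ {U} x y → 1 ≤ U → 1 ≤ y → U ^ (x * y) ≤ Ω → U ^ x ≤ Ω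
  ^≤-first {U} x y 1≤U 1≤y h = ≤-trans (^-monoʳ-≤ U {{>-nonZero 1≤U}} (m≤m*n x y {{>-nonZero 1≤y}})) h

  ^≤-rest : ∀ {U} x y → U ^ (x * y) ≤ Ω → (U ^ x) ^ y ≤ Ω
  ^≤-rest {U} x y h = ≤-trans (≤-reflexive (^-*-assoc U x y)) h

  Finished : ℕ → Mem → Set
  Finished r M = M r 0 0 ≡ trace (pow adj length-of-cycle) × (∀ b i j → M b i j ≤ Ω)

  exec-layers : ∀ j′ {a j U M} → j + j′ ≡ length-of-cycle → Stage a j U M → U ^ growth a j′ ≤ Ω →
                Fits (size* (layers a j′)) →
                Exec (layers a j′) [] M (cost (layers a j′) * budget)
                  (Finished (result-array a j′))
  exec-layers zero {a} {j} {U} {M} j≡ S U^≤ f =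
    exec-weaken ≤-refl
      (λ M′ (e , M′≤) → trans (e (2 + a) 0 0) (cong₂ _+_ (empty (2 + a) 0 0 ≤-refl)
        (contrib-finish ready layer≡ tab (trans (sym (+-identityʳ j)) j≡))) , λ b i i′ → ≤-trans (M′≤ b i i′) U^≤)
      (phase (finish a) (2 + a) 2≤U M≤U U^≤
        (Reads-enumerate 7≤θ {body = match (2 + a)} (λ _ _ → tt , tt , TAB< , tt , tt) q , Reads-forHigh 7≤θ (acc (2 + a) (lit 0) (lit 0) (get (suc a) (var #0) (var #0))) (tt , tt , ≤-refl , tt , tt))
        (Writes-finish a ≤-refl)
        (OK-finish w N Ω 2≤Ω N≤Ω n≤N L<N ready a q≤p) f)
    where
    open Stage S
    TAB< : TAB < 2 + a
    TAB< = ≤-trans 8≤a (m≤n+m a 2)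
    7≤θ : 7 ≤ 2 + a
    7≤θ = <⇒≤ TAB<
  exec-layers (suc j′) {a} {j} {U} {M} j≡ S U^≤ f =
    exec-weaken (≤-reflexive (sym (*-distribʳ-+ budget (cost (layer a)) (cost (layers (2 + a) j′))))) (λ _ h → h)
      (exec-seq
        (phase (layer a) (2 + a) 2≤U M≤U
          (^≤-first (2 + size* (layer a)) (growth (2 + a) j′) (<⇒≤ 2≤U) (1≤growth (2 + a) j′) U^≤)
          (Reads-forHigh 7≤θ (advance a) (Reads-advance 7≤θ a ≤-refl)) (≤-refl , n≤1+n (2 + a))
          (OK-layer w N Ω 2≤Ω N≤Ω n≤N L<N ready a)
          (fits-≤ (m≤n⇒m≤1+n (m≤m+n (size* (layer a)) _)) f))
        λ M′ (e , M′≤) →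
          exec-layers j′ (trans (sym (+-suc j j′)) j≡) (next e M′≤)
            (^≤-rest (2 + size* (layer a)) (growth (2 + a) j′) U^≤)
            (fits-≤ (m≤n⇒m≤1+n (m≤n+m (size* (layers (2 + a) j′)) (size* (layer a)))) f))
    where
    open Stage S
    TAB< : TAB < 2 + a
    TAB< = ≤-trans 8≤a (m≤n+m a 2)
    7≤θ : 7 ≤ 2 + a
    7≤θ = <⇒≤ TAB<
    next : ∀ {M′} → M′ ≋ M ⊕ contrib (layer a) [] M → (∀ b i i′ → M′ b i i′ ≤ U ^ (2 + size* (layer a))) →
           Stage (2 + a) (suc j) (U ^ (2 + size* (layer a))) M′
    next {M′} e M′≤ = record
      { 8≤a   = <⇒≤ (s≤s (<⇒≤ (s≤s 8≤a)))
      ; 2≤U   = 2≤^ (size* (layer a)) 2≤U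
      ; M≤U   = M′≤
      ; ready = Ready-keep (λ b i i′ b<7 → keeps b i i′ (<-≤-trans b<7 7≤θ)) ready
      ; tab   = λ u v u<n v<n → trans (keeps TAB u v TAB<) (tab u v u<n v<n)
      ; layer≡ = record
        { walks≡ = λ h v h<n v<n → trans (e (2 + a) h v) (cong₂ _+_ (empty (2 + a) h v ≤-refl) (contrib-layer-walks ready layer≡ h v h<n v<n))
        ; split≡ = λ h v h<n v<n → trans (e (3 + a) h v) (cong₂ _+_ (empty (3 + a) h v (n≤1+n _)) (contrib-layer-split ready layer≡ h v h<n v<n))
        }
      ; empty = λ b i i′ 4+a≤b → trans (e b i i′) (cong₂ _+_ (empty b i i′ (≤-trans (m≤n+m (2 + a) 2) 4+a≤b))
          (contrib-quiet (layer a) {[]} {M} {b} i i′ (<⇒≢ (≤-trans (n≤1+n _) 4+a≤b) , <⇒≢ 4+a≤b)))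
      }
      where
      keeps : ∀ b i i′ → b < 2 + a → M′ b i i′ ≡ M b i i′
      keeps = phase-keeps (layer a) (2 + a) {M} {M′} (≤-refl , n≤1+n (2 + a)) e

  exec-count : ∀ {U M} → 2 ≤ U → (∀ b i j → M b i j ≤ U) → Ready M → (∀ b i j → 7 ≤ b → M b i j ≡ 0) →
               U ^ count-growth ≤ Ω → Fits (size* count) →
               Exec count [] M (cost count * budget)
                 (Finished (result-array 8 length-of-cycle))
  exec-count {U} {M} 2≤U M≤U R empty U^≤ f =
    exec-weaken
      (≤-reflexive (sym (trans (*-distribʳ-+ budget (cost s₁) (cost seed + cost s₃))
        (cong (cost s₁ * budget +_) (*-distribʳ-+ budget (cost seed) (cost s₃)))))) (λ _ h → h)
      (exec-seq
        (phase s₁ 7 2≤U M≤U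
          (^≤-first z₁ (z₂ * z₃) (<⇒≤ 2≤U) (*-mono-≤ {1} {z₂} (s≤s z≤n) (1≤growth 8 length-of-cycle)) U^≤)
          (Reads-enumerate ≤-refl {body = tally} (λ _ _ → tt , tt , tt) p)
          (tally-writes ≤-refl)
          (OK-tally w N Ω 2≤Ω N≤Ω n≤N L<N R) (fits-≤ (m≤n⇒m≤1+n (m≤m+n (size* s₁) _)) f))
        λ M₁ (e₁ , M₁≤) → exec-seq
          (phase seed 8 (2≤^ (size* s₁) 2≤U) M₁≤
            (^≤-first z₂ z₃ (<⇒≤ (2≤^ (size* s₁) 2≤U)) (1≤growth 8 length-of-cycle) (^≤-rest z₁ (z₂ * z₃) U^≤))
            (Reads-forHigh (n≤1+n 7) (acc 8 (var #0) (var #0) (lit 1)) (tt , tt , tt)) ≤-refl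
            (OK-seed w N Ω 2≤Ω N≤Ω n≤N L<N (ready₁ {M₁} e₁))
            (fits-≤ (≤-trans (m≤n⇒m≤1+n (m≤m+n (size* seed) (size* s₃))) (m≤n⇒m≤1+n (m≤n+m _ (size* s₁)))) f))
          λ M₂ (e₂ , M₂≤) → exec-layers length-of-cycle {8} {0} refl
            (record
              { 8≤a   = ≤-refl
              ; 2≤U   = 2≤^ (size* seed) (2≤^ (size* s₁) 2≤U)
              ; M≤U   = M₂≤
              ; ready = Ready-keep (λ b i j b<7 → keeps₂ {M₁} {M₂} e₂ b i j (m<n⇒m<1+n b<7)) (ready₁ {M₁} e₁)
              ; tab   = λ u v u<n v<n → trans (keeps₂ {M₁} {M₂} e₂ TAB u v ≤-refl) (trans (e₁ TAB u v)
                  (cong₂ _+_ (empty TAB u v ≤-refl) (contrib-tally R u v u<n v<n)))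
              ; layer≡ = record
                { walks≡ = λ h v h<n v<n → trans (e₂ 8 h v) (cong₂ _+_ (empty₁ {M₁} e₁ 8 h v ≤-refl) (contrib-seed (ready₁ {M₁} e₁) h v h<n))
                ; split≡ = λ h v h<n v<n → trans (trans (e₂ 9 h v) (cong₂ _+_ (empty₁ {M₁} e₁ 9 h v (n≤1+n 8)) (contrib-quiet seed {[]} {M₁} {9} h v (λ ()))))
                    (sym (*-zeroʳ (hi h)))
                }
              ; empty = λ b i j 10≤b → trans (e₂ b i j) (cong₂ _+_ (empty₁ {M₁} e₁ b i j (≤-trans (m≤n+m 8 2) 10≤b))
                  (contrib-quiet seed {[]} {M₁} {b} i j (<⇒≢ (≤-trans (n≤1+n 9) 10≤b))))
              })
            (^≤-rest z₂ z₃ (^≤-rest z₁ (z₂ * z₃) U^≤))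
            (fits-≤ (≤-trans (m≤n⇒m≤1+n (m≤n+m (size* s₃) (size* seed))) (m≤n⇒m≤1+n (m≤n+m _ (size* s₁)))) f))
    where
    s₁ s₃ : Stmt 0
    s₁ = enumerate tally p
    s₃ = layers 8 length-of-cycle
    z₁ z₂ z₃ : ℕ
    z₁ = 2 + size* s₁
    z₂ = 2 + size* seed
    z₃ = growth 8 length-of-cycle
    tally-writes : ∀ {P : ℕ → Set} → P TAB → Writes P s₁
    tally-writes h = Writes-extend {body = tally} (λ _ _ → h) p _ _
    ready₁ : ∀ {M₁} → M₁ ≋ M ⊕ contrib s₁ [] M → Ready M₁
    ready₁ {M₁} e = Ready-keep (phase-keeps s₁ 7 {M} {M₁} (tally-writes ≤-refl) e) R
    empty₁ : ∀ {M₁} → M₁ ≋ M ⊕ contrib s₁ [] M → ∀ b i j → 8 ≤ b → M₁ b i j ≡ 0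
    empty₁ e b i j 8≤b = trans (e b i j) (cong₂ _+_ (empty b i j (<⇒≤ 8≤b))
      (contrib-quiet s₁ {[]} {M} {b} i j (tally-writes (<⇒≢ 8≤b))))
    keeps₂ : ∀ {M₁ M₂} → M₂ ≋ M₁ ⊕ contrib seed [] M₁ → ∀ b i j → b < 8 → M₂ b i j ≡ M₁ b i j
    keeps₂ {M₁} {M₂} = phase-keeps seed 8 {M₁} {M₂} ≤-refl

-- Adjacency lists

δ*-cases : ∀ x y v → (x ≡ y × δ x y * v ≡ v) ⊎ δ x y * v ≡ 0
δ*-cases x y v with x ≟ y
... | yes refl = inj₁ (refl , δ-refl-* x v)
... | no  x≢y  = inj₂ (cong (_* v) (δ-≢ x≢y))

bump≤ : ∀ {M M′ : Mem} {U} a x y v → (∀ b i j → M b i j ≤ U) → M a x y + v ≤ U →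
        (∀ b i j → M′ b i j ≡ M b i j + δ a b * (δ x i * (δ y j * v))) → ∀ b i j → M′ b i j ≤ U
bump≤ {M} a x y v M≤ M+v≤ e b i j rewrite e b i j
  with δ*-cases a b (δ x i * (δ y j * v)) | δ*-cases x i (δ y j * v) | δ*-cases y j v
... | inj₂ z | _ | _ rewrite z = ≤-trans (≤-reflexive (+-identityʳ _)) (M≤ b i j)
... | inj₁ (refl , e₁) | inj₂ z | _ rewrite e₁ | z = ≤-trans (≤-reflexive (+-identityʳ _)) (M≤ a i j)
... | inj₁ (refl , e₁) | inj₁ (refl , e₂) | inj₂ z rewrite e₁ | e₂ | z =
  ≤-trans (≤-reflexive (+-identityʳ _)) (M≤ a x j)
... | inj₁ (refl , e₁) | inj₁ (refl , e₂) | inj₁ (refl , e₃) rewrite e₁ | e₂ | e₃ = M+v≤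

-- `build` reads the degrees that it changes, so `contrib` does not describe it. Its loop is
-- verified by the invariant `Partial`, and only its single assignments go through `exec-acc`.
module Building (p q : ℕ) (G : Arcs) (w N Ω : ℕ) (2≤Ω : 2 ≤ Ω) (N≤Ω : N ≤ Ω)
  (n≤N : Arcs.n G ≤ N) (L<N : Arcs.L G < N)
  {U : ℕ} (2≤U : 2 ≤ U) (U≤Ω : U ≤ Ω) (N≤U : N ≤ U) where

  open Algorithm p q
  open Arcs G
  open Machine w N Ω 2≤Ω N≤Ω

  record Loaded (M : Mem) : Set where
    field
      cnt≡  : M CNT 0 0 ≡ L
      src≡  : ∀ e → M SRC e 0 ≡ src e
      dst≡  : ∀ e → M DST e 0 ≡ dst e

  -- Holds when the arcs numbered x and above have been entered: loops count down.
  record Partial (x : ℕ) (M : Mem) : Set where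
    field
      loaded : Loaded M
      bound  : ∀ a i j → M a i j ≤ U
      empty  : ∀ a i j → 7 ≤ a → M a i j ≡ 0
      outs   : ∀ u (f : ℕ → ℕ) →
               Σ< x (λ e → δ (src e) u * f (dst e)) + Σ< (M DEG u 0) (λ y → f (M OUT u y)) ≡
               Σ< L (λ e → δ (src e) u * f (dst e))
      fresh  : ∀ u y → M DEG u 0 ≤ y → M OUT u y ≡ 0
      outs<  : ∀ u y → y < M DEG u 0 → M OUT u y < n
      leads  : ∀ u → Σ< L (λ e → δ (src e) u * M LEAD e 0) ≡ sgn (M DEG u 0)
      unled  : ∀ e → e < x → M LEAD e 0 ≡ 0
      lead≤1 : ∀ e → M LEAD e 0 ≤ 1
  open Loaded
  open Partial

  module Step {x : ℕ} (x<L : x < L) {M : Mem} (P : Partial (suc x) M) where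

    s t g : ℕ
    s = src x
    t = dst x
    g = M DEG s 0

    -- Arc `x` leaves `s` and is not yet entered, so the arcs entered at `s` are fewer than all
    -- arcs. This keeps the write position below `N`.
    room : suc g ≤ L
    room = begin
      suc g
        ≤⟨ +-mono-≤ {1} {Σ< (suc x) (λ e → δ (src e) s * 1)} (≤-trans (≤-reflexive (sym (δ-refl-* s 1))) (m≤m+n _ _))
             (≤-reflexive (sym (trans (Σ-const g 1) (*-identityʳ g)))) ⟩
      Σ< (suc x) (λ e → δ (src e) s * 1) + Σ< g (λ _ → 1)
        ≡⟨ outs P s (λ _ → 1) ⟩
      Σ< L (λ e → δ (src e) s * 1)
        ≤⟨ Σ-mono L (λ e _ → ≤-trans (≤-reflexive (*-identityʳ _)) (bit≤1 (src e ≡ᵇ s))) ⟩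
      Σ< L (λ _ → 1)
        ≡⟨ trans (Σ-const L 1) (*-identityʳ L) ⟩
      L ∎
      where open ≤-Reasoning

    record Pushed (M′ : Mem) : Set where
      field
        keep   : ∀ a i j → a < 4 ⊎ 7 ≤ a → M′ a i j ≡ M a i j
        bound′ : ∀ a i j → M′ a i j ≤ U
        deg′   : ∀ u → M′ DEG u 0 ≡ M DEG u 0 + δ s u
        lead′  : ∀ e → M′ LEAD e 0 ≡ M LEAD e 0 + δ x e * δ g 0
        out′   : ∀ u y → M′ OUT u y ≡ M OUT u y + δ s u * (δ g y * t)

    module _ {M′ : Mem} (Q : Pushed M′) where
      open Pushed Q

      data Vertex (u : ℕ) : Set where
        new : u ≡ s → M′ DEG u 0 ≡ suc g → (∀ y → M′ OUT u y ≡ M OUT s y + δ g y * t) → Vertex u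
        old : s ≢ u → M′ DEG u 0 ≡ M DEG u 0 → (∀ y → M′ OUT u y ≡ M OUT u y) → Vertex u

      vertex : ∀ u → Vertex u
      vertex u with u ≟ s
      ... | yes refl = new refl (trans (deg′ s) (trans (cong (g +_) (δ-refl s)) (+-comm g 1)))
        λ y → trans (out′ s y) (cong (M OUT s y +_) (δ-refl-* s _))
      ... | no u≢s = old (λ e → u≢s (sym e)) (trans (deg′ u) (trans (cong (M DEG u 0 +_) zeros) (+-identityʳ _)))
        λ y → trans (out′ u y) (trans (cong (λ z → M OUT u y + z * _) zeros) (+-identityʳ _))
        where
        zeros : δ s u ≡ 0
        zeros = δ-≢ λ e → u≢s (sym e)

      out-new : ∀ y → y < g → M OUT s y + δ g y * t ≡ M OUT s y
      out-new y y<g = trans (cong (λ z → M OUT s y + z * t) (δ-≢ (>⇒≢ y<g))) (+-identityʳ _)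

      out-last : M OUT s g + δ g g * t ≡ t
      out-last = cong₂ _+_ (fresh P s g ≤-refl) (δ-refl-* g t)

      -- The summand of arc `x` moves from the arcs still to come to the list of its source.
      outs′ : ∀ u (f : ℕ → ℕ) →
              Σ< x (λ e → δ (src e) u * f (dst e)) + Σ< (M′ DEG u 0) (λ y → f (M′ OUT u y)) ≡
              Σ< L (λ e → δ (src e) u * f (dst e))
      outs′ u f with vertex u
      ... | old s≢u d o = begin
        X + Σ< (M′ DEG u 0) (λ y → f (M′ OUT u y))
          ≡⟨ cong (X +_) (trans (cong (λ z → Σ< z _) d) (Σ-cong′ (M DEG u 0) λ y → cong f (o y))) ⟩
        X + Σ< (M DEG u 0) (λ y → f (M OUT u y))
          ≡⟨ cong (λ z → z * f t + X + Σ< (M DEG u 0) (λ y → f (M OUT u y))) (sym (δ-≢ s≢u)) ⟩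
        δ s u * f t + X + Σ< (M DEG u 0) (λ y → f (M OUT u y))
          ≡⟨ outs P u f ⟩
        Σ< L (λ e → δ (src e) u * f (dst e)) ∎
        where
        open ≡-Reasoning
        X = Σ< x (λ e → δ (src e) u * f (dst e))
      ... | new refl d o = begin
        X + Σ< (M′ DEG s 0) (λ y → f (M′ OUT s y))
          ≡⟨ cong (X +_) (cong (λ z → Σ< z (λ y → f (M′ OUT s y))) d) ⟩
        X + (f (M′ OUT s g) + Σ< g (λ y → f (M′ OUT s y)))
          ≡⟨ cong (X +_) (cong₂ _+_ (trans (cong f (trans (o g) out-last)) (sym (δ-refl-* s (f t))))
               (Σ-cong g λ y y<g → cong f (trans (o y) (out-new y y<g)))) ⟩
        X + (δ s s * f t + Σ< g (λ y → f (M OUT s y)))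
          ≡⟨ solve 3 (λ a b c → a :+ (b :+ c) := (b :+ a) :+ c) refl X (δ s s * f t) _ ⟩
        δ s s * f t + X + Σ< g (λ y → f (M OUT s y))
          ≡⟨ outs P s f ⟩
        Σ< L (λ e → δ (src e) s * f (dst e)) ∎
        where
        open ≡-Reasoning
        open +-*-Solver
        X = Σ< x (λ e → δ (src e) s * f (dst e))

      fresh′ : ∀ u y → M′ DEG u 0 ≤ y → M′ OUT u y ≡ 0
      fresh′ u y ≤y with vertex u
      ... | old _ d o = trans (o y) (fresh P u y (subst (_≤ y) d ≤y))
      ... | new refl d o = trans (o y) (cong₂ _+_ (fresh P s y (<⇒≤ g<y)) (cong (_* t) (δ-≢ (<⇒≢ g<y))))
        where
        g<y : g < y
        g<y = subst (_≤ y) d ≤y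

      outs<′ : ∀ u y → y < M′ DEG u 0 → M′ OUT u y < n
      outs<′ u y y< with vertex u
      ... | old _ d o = subst (_< n) (sym (o y)) (outs< P u y (subst (y <_) d y<))
      ... | new refl d o with y ≟ g
      ...   | yes refl = subst (_< n) (sym (trans (o g) out-last)) (dst< x x<L)
      ...   | no y≢g = subst (_< n) (sym (trans (o y) (out-new y y<g))) (outs< P s y y<g)
        where
        y<g : y < g
        y<g = ≤∧≢⇒< (≤-pred (subst (y <_) d y<)) y≢g

      -- Arc `x` is marked exactly when the degree of its source leaves zero, the only change that
      -- `sgn` sees.
      leads′ : ∀ u → Σ< L (λ e → δ (src e) u * M′ LEAD e 0) ≡ sgn (M′ DEG u 0)
      leads′ u = begin
        Σ< L (λ e → δ (src e) u * M′ LEAD e 0)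
          ≡⟨ Σ-cong′ L (λ e → trans (cong (δ (src e) u *_) (lead′ e))
               (trans (*-distribˡ-+ (δ (src e) u) (M LEAD e 0) _)
                 (cong (δ (src e) u * M LEAD e 0 +_) (*-CS.x∙yz≈y∙xz (δ (src e) u) (δ x e) (δ g 0))))) ⟩
        Σ< L (λ e → δ (src e) u * M LEAD e 0 + δ x e * (δ (src e) u * δ g 0))
          ≡⟨ Σ-+ L _ _ ⟩
        Σ< L (λ e → δ (src e) u * M LEAD e 0) + Σ< L (λ e → δ x e * (δ (src e) u * δ g 0))
          ≡⟨ cong₂ _+_ (leads P u) (Σ-δ L _ x<L) ⟩
        sgn (M DEG u 0) + δ s u * δ g 0
          ≡⟨ count u ⟩
        sgn (M′ DEG u 0) ∎
        where
        open ≡-Reasoning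
        first : ∀ g → sgn g + δ g 0 ≡ 1
        first zero    = refl
        first (suc g) = refl
        count : ∀ u → sgn (M DEG u 0) + δ s u * δ g 0 ≡ sgn (M′ DEG u 0)
        count u with vertex u
        ... | old s≢u d _ = trans (cong (λ z → sgn (M DEG u 0) + z * δ g 0) (δ-≢ s≢u))
                              (trans (+-identityʳ _) (cong sgn (sym d)))
        ... | new refl d _ = trans (cong (sgn g +_) (δ-refl-* s (δ g 0))) (trans (first g) (cong sgn (sym d)))

      step : Partial x M′
      step = record
        { loaded = record
          { cnt≡ = trans (keep CNT 0 0 (inj₁ (<ᵇ⇒< _ _ tt))) (cnt≡ (loaded P))
          ; src≡ = λ e → trans (keep SRC e 0 (inj₁ (<ᵇ⇒< _ _ tt))) (src≡ (loaded P) e)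
          ; dst≡ = λ e → trans (keep DST e 0 (inj₁ (<ᵇ⇒< _ _ tt))) (dst≡ (loaded P) e)
          }
        ; bound  = bound′
        ; empty  = λ a i j 7≤a → trans (keep a i j (inj₂ 7≤a)) (empty P a i j 7≤a)
        ; outs   = outs′
        ; fresh  = fresh′
        ; outs<  = outs<′
        ; leads  = leads′
        ; unled  = λ e e<x → trans (lead′ e) (cong₂ _+_ (unled P e (m<n⇒m<1+n e<x)) (cong (_* δ g 0) (δ-≢ (>⇒≢ e<x))))
        ; lead≤1 = lead≤1′
        }
        where
        lead≤1′ : ∀ e → M′ LEAD e 0 ≤ 1
        lead≤1′ e with x ≟ e
        ... | yes refl = ≤-trans (≤-reflexive (trans (lead′ x) (cong₂ _+_ (unled P x ≤-refl) (δ-refl-* x (δ g 0))))) (bit≤1 (g ≡ᵇ 0))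
        ... | no x≢e = ≤-trans (≤-reflexive (trans (lead′ e) (trans (cong (λ z → M LEAD e 0 + z * δ g 0) (δ-≢ x≢e)) (+-identityʳ _)))) (lead≤1 P e)

    s′ : ℕ
    s′ = M SRC x 0

    s′≡s : s′ ≡ s
    s′≡s = src≡ (loaded P) x

    s′<n : s′ < n
    s′<n = subst (_< n) (sym s′≡s) (src< x x<L)

    ρ : Env 2
    ρ = s′ ∷ x ∷ []

    push₁ push₂ push₃ : Stmt 2
    push₁ = acc OUT (var #0) (at DEG (var #0)) (at DST (var #1))
    push₂ = acc LEAD (var #1) (lit 0) (bin eq (at DEG (var #0)) (lit 0))
    push₃ = acc DEG (var #0) (lit 0) (lit 1)

    0<N : 0 < N
    0<N = ≤-<-trans z≤n L<N

    ≤Ω : ∀ {M : Mem} → (∀ a i j → M a i j ≤ U) → ∀ a i j → M a i j ≤ Ω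
    ≤Ω h a i j = ≤-trans (h a i j) U≤Ω

    reads : ∀ a {_ : T (a <ᵇ 7)} → a < 7
    reads a {t} = <ᵇ⇒< a 7 t

    g′≡g : M DEG s′ 0 ≡ g
    g′≡g = cong (λ z → M DEG z 0) s′≡s

    out+≤ : M OUT s′ (M DEG s′ 0) + M DST x 0 ≤ U
    out+≤ = ≤-trans (≤-reflexive (cong₂ _+_ (fresh P s′ (M DEG s′ 0) ≤-refl) (dst≡ (loaded P) x)))
              (≤-trans (<⇒≤ (dst< x x<L)) (≤-trans n≤N N≤U))

    exec-push : Fits (size* (push₁ ⨟ push₂ ⨟ push₃)) →
                Exec (push₁ ⨟ push₂ ⨟ push₃) ρ M (cost (push₁ ⨟ push₂ ⨟ push₃)) Pushed
    exec-push f =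
      -- Each assignment is run with the current memory as `M₀`, since reads and writes overlap.
      exec-seq (Stratified.exec-acc {7} {M} (≤Ω (bound P)) OUT (var #0) (at DEG (var #0)) (at DST (var #1))
          (tt , (reads DEG , tt , tt) , (reads DST , tt , tt)) (λ _ _ _ _ → refl)
          (tt , (tt , tt , s′<N , 0<N) , s′<N , subst (_< N) (sym g′≡g) (<-trans room L<N))
          (tt , tt , x<N , 0<N)
          (fits-≤ (m≤n⇒m≤1+n (m≤m+n (size* push₁) _)) f) (≤-trans out+≤ U≤Ω))
        λ M₁ e₁ → exec-seq (Stratified.exec-acc {7} {M₁} (≤Ω (M₁≤ e₁)) LEAD (var #1) (lit 0) (bin eq (at DEG (var #0)) (lit 0))
          (tt , tt , (reads DEG , tt , tt) , tt) (λ _ _ _ _ → refl)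
          (tt , tt , x<N , 0<N) ((tt , tt , s′<N , 0<N) , tt)
          (fits-≤ (≤-trans (m≤n⇒m≤1+n (m≤m+n (size* push₂) (size* push₃))) (m≤n⇒m≤1+n (m≤n+m _ (size* push₁)))) f)
          (≤-trans (lead+≤ e₁) U≤Ω))
        λ M₂ e₂ → exec-weaken ≤-refl (λ M₃ e₃ → pushed e₁ e₂ e₃)
          (Stratified.exec-acc {7} {M₂} (≤Ω (M₂≤ e₁ e₂)) DEG (var #0) (lit 0) (lit 1)
            (tt , tt , tt) (λ _ _ _ _ → refl) (tt , tt , s′<N , 0<N) tt
            (fits-≤ (≤-trans (m≤n⇒m≤1+n (m≤n+m (size* push₃) (size* push₂))) (m≤n⇒m≤1+n (m≤n+m _ (size* push₁)))) f)
            (≤-trans (deg+≤ e₁ e₂) U≤Ω))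
      where
      s′<N : s′ < N
      s′<N = <-≤-trans s′<n n≤N
      x<N : x < N
      x<N = <-trans x<L L<N
      M₁≤ : ∀ {M₁} → M₁ ≋ M ⊕ contrib push₁ ρ M → ∀ a i j → M₁ a i j ≤ U
      M₁≤ e = bump≤ OUT s′ (M DEG s′ 0) (M DST x 0) (bound P) out+≤ e
      lead+≤ : ∀ {M₁} → M₁ ≋ M ⊕ contrib push₁ ρ M → M₁ LEAD x 0 + δ (M₁ DEG s′ 0) 0 ≤ U
      lead+≤ {M₁} e = ≤-trans (+-mono-≤ (≤-reflexive (trans (e LEAD x 0) (trans (+-identityʳ _) (unled P x ≤-refl))))
        (bit≤1 (M₁ DEG s′ 0 ≡ᵇ 0))) (<⇒≤ 2≤U)
      M₂≤ : ∀ {M₁ M₂} → M₁ ≋ M ⊕ contrib push₁ ρ M → M₂ ≋ M₁ ⊕ contrib push₂ ρ M₁ → ∀ a i j → M₂ a i j ≤ U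
      M₂≤ {M₁} e₁ e₂ = bump≤ LEAD x 0 (δ (M₁ DEG s′ 0) 0) (M₁≤ e₁) (lead+≤ e₁) e₂
      deg+≤ : ∀ {M₁ M₂} → M₁ ≋ M ⊕ contrib push₁ ρ M → M₂ ≋ M₁ ⊕ contrib push₂ ρ M₁ → M₂ DEG s′ 0 + 1 ≤ U
      deg+≤ {M₁} e₁ e₂ = ≤-trans (≤-reflexive (trans (cong (_+ 1) (trans (e₂ DEG s′ 0) (trans (+-identityʳ _)
        (trans (e₁ DEG s′ 0) (trans (+-identityʳ _) g′≡g))))) (+-comm g 1)))
        (≤-trans room (≤-trans (<⇒≤ L<N) N≤U))
      pushed : ∀ {M₁ M₂ M₃} → M₁ ≋ M ⊕ contrib push₁ ρ M → M₂ ≋ M₁ ⊕ contrib push₂ ρ M₁ →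
               M₃ ≋ M₂ ⊕ contrib push₃ ρ M₂ → Pushed M₃
      pushed {M₁} {M₂} {M₃} e₁ e₂ e₃ = record
        { keep   = λ a i j a≢ → trans (e₃ a i j) (trans (cong (M₂ a i j +_) (off DEG a a≢ (≤-refl , <ᵇ⇒< _ _ tt)))
            (trans (+-identityʳ _) (trans (e₂ a i j) (trans (cong (M₁ a i j +_) (off LEAD a a≢ (<ᵇ⇒< 3 _ tt , <ᵇ⇒< _ _ tt)))
              (trans (+-identityʳ _) (trans (e₁ a i j) (trans (cong (M a i j +_) (off OUT a a≢ (<ᵇ⇒< 3 _ tt , ≤-refl))) (+-identityʳ _))))))))
        ; bound′ = bump≤ DEG s′ 0 1 (M₂≤ e₁ e₂) (deg+≤ e₁ e₂) e₃
        ; deg′   = λ u → trans (e₃ DEG u 0) (cong₂ _+_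
            (trans (e₂ DEG u 0) (trans (+-identityʳ _) (trans (e₁ DEG u 0) (+-identityʳ _))))
            (trans (*-identityˡ _) (trans (*-identityʳ _) (cong (λ z → δ z u) s′≡s))))
        ; lead′  = λ e → trans (e₃ LEAD e 0) (trans (+-identityʳ _) (trans (e₂ LEAD e 0) (cong₂ _+_
            (trans (e₁ LEAD e 0) (+-identityʳ _))
            (trans (*-identityˡ _) (cong (δ x e *_) (trans (*-identityˡ _)
              (cong (λ z → δ z 0) (trans (e₁ DEG s′ 0) (trans (+-identityʳ _) g′≡g)))))))))
        ; out′   = λ u y → trans (e₃ OUT u y) (trans (+-identityʳ _) (trans (e₂ OUT u y) (trans (+-identityʳ _)
            (trans (e₁ OUT u y) (cong (M OUT u y +_) (trans (*-identityˡ _)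
              (cong₂ (λ z v → δ z u * v) s′≡s (cong₂ (λ z v → δ z y * v) g′≡g (dst≡ (loaded P) x)))))))))
        }
        where
        off : ∀ b a {z} → a < 4 ⊎ 7 ≤ a → 4 ≤ b × b < 7 → δ b a * z ≡ 0
        off b a {z} (inj₁ a<4) (4≤b , b<7) = cong (_* z) (δ-≢ (>⇒≢ (<-≤-trans a<4 4≤b)))
        off b a {z} (inj₂ 7≤a) (4≤b , b<7) = cong (_* z) (δ-≢ (<⇒≢ (<-≤-trans b<7 7≤a)))

  Built : Mem → Set
  Built M = Σ[ A ∈ Adjacency G ] Counts.Ready p q G A M
            × (∀ a i j → M a i j ≤ U) × (∀ a i j → 7 ≤ a → M a i j ≡ 0)

  -- The adjacency structure is read off the final memory; its list property is `outs` with no arcs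
  -- left to come.
  built : ∀ {M} → Partial 0 M → Built M
  built {M} P = A , R , bound P , empty P
    where
    A : Adjacency G
    A = record
      { deg = λ u → M DEG u 0 ; lead = λ e → M LEAD e 0 ; out = M OUT
      ; out-sum  = outs P
      ; lead-sum = λ u → trans (Σ-cong′ L λ e → cong (δ (src e) u *_) (sgn-bit (lead≤1 P e))) (leads P u)
      ; out<     = outs< P
      }
      where
      sgn-bit : ∀ {x} → x ≤ 1 → sgn x ≡ x
      sgn-bit z≤n       = refl
      sgn-bit (s≤s z≤n) = refl
    R : Counts.Ready p q G A M
    R = record
      { cnt≡ = cnt≡ (loaded P) ; src≡ = src≡ (loaded P) ; dst≡ = dst≡ (loaded P)
      ; deg≡ = λ _ → refl ; lead≡ = λ _ → refl ; out≡ = λ _ _ → refl }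

  exec-build : ∀ {M B} → Loaded M → (∀ a i j → M a i j ≤ U) → (∀ a i j → 4 ≤ a → M a i j ≡ 0) →
               1 ≤ B → L ≤ B → Fits (size* build) → Exec build [] M (cost build * B) Built
  exec-build {M} {B} l M≤ z 1≤B L≤B f =
    exec-weaken
      (subst (λ n → c + (1 + Σ< n (λ x → 3 + K * 1)) ≤ (c + 4 + K) * B) (sym (cnt≡ l))
        (for-time L c K B (λ _ → 1) 1≤B (λ _ _ → ≤-refl)
          (≤-trans (≤-reflexive (trans (Σ-const L 1) (*-identityʳ L))) L≤B)))
      (λ _ → built)
      (exec-for Partial (fit {z = size* build} (≤^1 2≤Ω {y = size* build} (<⇒≤ 2≤Ω) (s≤s z≤n)) f)
        (<ᵇ⇒< CNT 7 tt , tt , tt) (λ _ _ _ _ → refl) (tt , tt , 0<N , 0<N)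
        (fits-≤ (m≤m+n (size (get {0} CNT (lit 0) (lit 0))) _) f)
        initially
        λ x x<n M′ P → let x<L = subst (x <_) (cnt≡ l) x<n in
          exec-weaken (≤-reflexive (sym (*-identityʳ K))) (λ _ Q → Step.step x<L P Q)
            (Stratified.exec-bind {7} {M′} (λ a i j → ≤-trans (bound P a i j) U≤Ω)
              (<ᵇ⇒< SRC 7 tt , tt , tt) (λ _ _ _ _ → refl)
              (tt , tt , <-trans x<L L<N , 0<N)
              (fits-≤ (≤-trans (m≤m+n (size (get {1} SRC (var #0) (lit 0))) _) (m≤n+m _ (size (get {0} CNT (lit 0) (lit 0))))) f)
              (Step.exec-push x<L P (fits-≤ (≤-trans (m≤n+m _ (size (get {1} SRC (var #0) (lit 0)))) (m≤n+m _ (size (get {0} CNT (lit 0) (lit 0))))) f))))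
    where
    open Stratified {7} {M} (λ a i j → ≤-trans (M≤ a i j) U≤Ω)
    c K : ℕ
    c = steps (get {0} CNT (lit 0) (lit 0))
    K = cost (bind {1} SRC (var #0) (lit 0)
          (acc OUT (var #0) (at DEG (var #0)) (at DST (var #1)) ⨟
           acc LEAD (var #1) (lit 0) (bin eq (at DEG (var #0)) (lit 0)) ⨟
           acc DEG (var #0) (lit 0) (lit 1)))
    0<N : 0 < N
    0<N = ≤-<-trans z≤n L<N
    initially : Partial (M CNT 0 0) M
    initially = record
      { loaded = l
      ; bound  = M≤
      ; empty  = λ a i j 7≤a → z a i j (≤-trans (m≤n+m 4 3) 7≤a)
      ; outs   = λ u f → trans (cong₂ _+_ (cong (λ k → Σ< k _) (cnt≡ l))
                   (cong (λ k → Σ< k (λ y → f (M OUT u y))) (z DEG u 0 ≤-refl))) (+-identityʳ _)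
      ; fresh  = λ u y _ → z OUT u y (m≤n+m 4 2)
      ; outs<  = λ u y y< → contradiction (subst (y <_) (z DEG u 0 ≤-refl) y<) (λ ())
      ; leads  = λ u → trans (Σ-zero L λ e _ → trans (cong (δ (src e) u *_) (z LEAD e 0 (n≤1+n 4))) (*-zeroʳ (δ (src e) u)))
                   (cong sgn (sym (z DEG u 0 ≤-refl)))
      ; unled  = λ e _ → z LEAD e 0 (n≤1+n 4)
      ; lead≤1 = λ e → ≤-trans (≤-reflexive (z LEAD e 0 (n≤1+n 4))) z≤n
      }

-- Homomorphisms as closed walks

bit : ∀ {P : Set} → Dec P → ℕ
bit P? = if does P? then 1 else 0

Σ-first : ∀ n f → Σ< (suc n) f ≡ f 0 + Σ< n (λ x → f (suc x))
Σ-first zero    f = refl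
Σ-first (suc n) f = begin
  f (suc n) + Σ< (suc n) f                         ≡⟨ cong (f (suc n) +_) (Σ-first n f) ⟩
  f (suc n) + (f 0 + Σ< n (λ x → f (suc x)))       ≡⟨ sym (+-assoc (f (suc n)) (f 0) _) ⟩
  f (suc n) + f 0 + Σ< n (λ x → f (suc x))         ≡⟨ cong (_+ Σ< n (λ x → f (suc x))) (+-comm (f (suc n)) (f 0)) ⟩
  f 0 + f (suc n) + Σ< n (λ x → f (suc x))         ≡⟨ +-assoc (f 0) (f (suc n)) _ ⟩
  f 0 + Σ< (suc n) (λ x → f (suc x))               ∎
  where open ≡-Reasoning

sum-tabulate : ∀ {A : Set} n (h : Fin n → A) (f : A → ℕ) (g : ℕ → ℕ) → (∀ i → f (h i) ≡ g (toℕ i)) →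
               sumᴸ (map f (tabulate h)) ≡ Σ< n g
sum-tabulate zero    h f g e = refl
sum-tabulate (suc n) h f g e =
  trans (cong₂ _+_ (e zero) (sum-tabulate n (h ∘ suc) f (g ∘ suc) (λ i → e (suc i)))) (sym (Σ-first n g))

count-product : ∀ {A : Set} {j} {P : Pred (Vec A (suc j)) 0ℓ} (P? : Decidable₁ P) (xs : List A) (ys : List (Vec A j)) →
  length (filter P? (cartesianProductWith _∷_ xs ys)) ≡
  sumᴸ (map (λ x → length (filter (λ y → P? (x ∷ y)) ys)) xs)
count-product P? []       ys = refl
count-product P? (x ∷ xs) ys = begin
  length (filter P? (map (x ∷_) ys ++ cartesianProductWith _∷_ xs ys))
    ≡⟨ cong length (filter-++ P? (map (x ∷_) ys) _) ⟩
  length (filter P? (map (x ∷_) ys) ++ filter P? (cartesianProductWith _∷_ xs ys))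
    ≡⟨ length-++ (filter P? (map (x ∷_) ys)) ⟩
  length (filter P? (map (x ∷_) ys)) + length (filter P? (cartesianProductWith _∷_ xs ys))
    ≡⟨ cong₂ _+_ (count-map ys) (count-product P? xs ys) ⟩
  length (filter (λ y → P? (x ∷ y)) ys) + sumᴸ (map (λ x → length (filter (λ y → P? (x ∷ y)) ys)) xs) ∎
  where
  open ≡-Reasoning
  count-map : ∀ ys → length (filter P? (map (x ∷_) ys)) ≡ length (filter (λ y → P? (x ∷ y)) ys)
  count-map []       = refl
  count-map (y ∷ ys) with does (P? (x ∷ y))
  ... | true  = cong suc (count-map ys)
  ... | false = count-map ys

module _ {n : ℕ} (R : Rel (Fin n) 0ℓ) (R? : Decidable R) where

  Path : ∀ {j} → Fin n → Vec (Fin n) j → Fin n → Set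
  Path u []       z = R u z
  Path u (x ∷ xs) z = R u x × Path x xs z

  path? : ∀ {j} u (xs : Vec (Fin n) j) z → Dec (Path u xs z)
  path? u []       z = R? u z
  path? u (x ∷ xs) z = R? u x ×-dec path? x xs z

  Steps : ∀ {j} → Fin n → Vec (Fin n) j → Fin n → Set
  Steps {j} u xs z =
    (∀ i i′ → toℕ i′ ≡ suc (toℕ i) → R (lookup (u ∷ xs) i) (lookup (u ∷ xs) i′)) ×
    (∀ i → toℕ i ≡ j → R (lookup (u ∷ xs) i) z)

  path⇒steps : ∀ {j} u (xs : Vec (Fin n) j) z → Path u xs z → Steps u xs z
  path⇒steps u []       z r = (λ { _ zero () }) , λ { zero _ → r }
  path⇒steps u (x ∷ xs) z (r , p) with path⇒steps x xs z p
  ... | next , last =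
    (λ { zero (suc zero) _ → r ; (suc i) (suc i′) e → next i i′ (suc-injective e) }) ,
    λ { (suc i) e → last i (suc-injective e) }

  steps⇒path : ∀ {j} u (xs : Vec (Fin n) j) z → Steps u xs z → Path u xs z
  steps⇒path u []       z (_ , last)    = last zero refl
  steps⇒path u (x ∷ xs) z (next , last) = next zero (suc zero) refl ,
    steps⇒path x xs z ((λ i i′ e → next (suc i) (suc i′) (cong suc e)) , λ i e → last (suc i) (cong suc e))

  Closed : ∀ {j} → Vec (Fin n) (suc j) → Set
  Closed (v ∷ xs) = Path v xs v

  closed? : ∀ {j} (φ : Vec (Fin n) (suc j)) → Dec (Closed φ)
  closed? (v ∷ xs) = path? v xs v

  cyclic⇒closed : ∀ {j} (φ : Vec (Fin n) (suc j)) →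
                  (∀ i i′ → CycleArc (suc j) i i′ → R (lookup φ i) (lookup φ i′)) → Closed φ
  cyclic⇒closed (v ∷ xs) h = steps⇒path v xs v
    ((λ i i′ e → h i i′ (inj₁ e)) , λ i e → h i zero (inj₂ (cong suc e , refl)))

  closed⇒cyclic : ∀ {j} (φ : Vec (Fin n) (suc j)) → Closed φ →
                  ∀ i i′ → CycleArc (suc j) i i′ → R (lookup φ i) (lookup φ i′)
  closed⇒cyclic (v ∷ xs) p i i′   (inj₁ e)       = proj₁ (path⇒steps v xs v p) i i′ e
  closed⇒cyclic (v ∷ xs) p i zero (inj₂ (e , _)) = proj₂ (path⇒steps v xs v p) i (suc-injective e)

  module _ (A : Matrix) (A≡ : ∀ u v → A (toℕ u) (toℕ v) ≡ bit (R? u v)) where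
    open Matrices n

    -- `j` inner vertices make `suc j` steps; splitting off the first inner vertex is the recursion
    -- of `pow`.
    count-paths : ∀ j u z → length (filter (λ xs → path? u xs z) (allMaps j n)) ≡ pow A (suc j) (toℕ u) (toℕ z)
    count-paths zero u z = trans singleton (sym (trans (·-identityʳ A (toℕ u) (toℕ z) (toℕ<n u) (toℕ<n z)) (A≡ u z)))
      where
      singleton : length (filter (λ xs → path? u xs z) ([] ∷ [])) ≡ bit (R? u z)
      singleton with does (R? u z)
      ... | true  = refl
      ... | false = refl
    count-paths (suc j) u z =
      trans (count-product (λ xs → path? u xs z) (allFin n) (allMaps j n))
        (sum-tabulate n (λ i → i) _ (λ x → A (toℕ u) x * pow A (suc j) x (toℕ z)) λ x →
          trans (first-step x) (cong₂ _*_ (sym (A≡ u x)) (count-paths j x z)))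
      where
      first-step : ∀ x → length (filter (λ xs → R? u x ×-dec path? x xs z) (allMaps j n)) ≡
                   bit (R? u x) * length (filter (λ xs → path? x xs z) (allMaps j n))
      first-step x with R? u x
      ... | yes r = trans (cong length (filter-≐ _ _ (proj₂ , (r ,_)) (allMaps j n))) (sym (*-identityˡ _))
      ... | no ¬r = cong length (filter-none _ (All.universal (λ _ → ¬r ∘ proj₁) (allMaps j n)))

    count-closed : ∀ j → length (filter closed? (allMaps (suc j) n)) ≡ trace (pow A (suc j))
    count-closed j =
      trans (count-product closed? (allFin n) (allMaps j n))
        (sum-tabulate n (λ i → i) _ (λ x → pow A (suc j) x x) λ v → count-paths j v v)

homCount-directed : ∀ (D : Digraph) (let open Digraph D; open Matrices order) A →
  (∀ u v → A (toℕ u) (toℕ v) ≡ bit (u ⇒? v)) →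
  ∀ j → homCount (directedCycle (suc j)) D ≡ trace (pow A (suc j))
homCount-directed D A A≡ j =
  trans (cong length (filter-≐ (isHom? (directedCycle (suc j)) D) (closed? _⇒_ _⇒?_)
          ((λ {φ} h → cyclic⇒closed _⇒_ _⇒?_ φ λ i i′ → h {i} {i′}) ,
           λ {φ} c {i} {i′} → closed⇒cyclic _⇒_ _⇒?_ φ c i i′)
          (allMaps (suc j) order)))
        (count-closed _⇒_ _⇒?_ A A≡ j)
  where open Digraph D

-- Each cycle edge comes in both orientations, but as the graph is symmetric the forward arcs alone
-- constrain the map, which leaves closed walks again.
homCount-undirected : ∀ (G : Graph) (let open Graph G; open Matrices order) A →
  (∀ u v → A (toℕ u) (toℕ v) ≡ bit (u ~? v)) →
  ∀ j 3≤k → homCountᵘ (cycle (suc j) 3≤k) G ≡ trace (pow A (suc j))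
homCount-undirected G A A≡ j 3≤k =
  trans (cong length (filter-≐ (isHom? (Graph.adjacency (cycle (suc j) 3≤k)) adjacency) (closed? _~_ _~?_)
          ((λ {φ} h → cyclic⇒closed _~_ _~?_ φ λ i i′ c → h {i} {i′} (inj₁ c)) ,
           λ {φ} c {i} {i′} → λ
             { (inj₁ a) → closed⇒cyclic _~_ _~?_ φ c i i′ a
             ; (inj₂ a) → ~-sym (closed⇒cyclic _~_ _~?_ φ c i′ i a) })
          (allMaps (suc j) order)))
        (count-closed _~_ _~?_ A A≡ j)
  where open Graph G

-- From input lists to adjacency matrices

contents-beyond : ∀ xs a → length xs ≤ a → contents xs a ≡ 0
contents-beyond []       a       _         = refl
contents-beyond (x ∷ xs) (suc a) (s≤s len≤a) = contents-beyond xs a len≤a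

contents-All : ∀ {P : ℕ → Set} {xs} → P 0 → All P xs → ∀ a → P (contents xs a)
contents-All p0 []       a       = p0
contents-All p0 (p ∷ ps) zero    = p
contents-All p0 (p ∷ ps) (suc a) = contents-All p0 ps a

contents-∈ : ∀ {P : ℕ → Set} {xs} → All P xs → ∀ a → a < length xs → P (contents xs a)
contents-∈ (p ∷ ps) zero    _         = p
contents-∈ (p ∷ ps) (suc a) (s≤s a<)  = contents-∈ ps a a<

Σ-contents : ∀ {A : Set} (f g : A → ℕ) (F : ℕ → ℕ → ℕ) es →
  Σ< (length es) (λ e → F (contents (map f es) e) (contents (map g es) e)) ≡ sumᴸ (map (λ p → F (f p) (g p)) es)
Σ-contents f g F []       = refl
Σ-contents f g F (e ∷ es) =
  trans (Σ-first (length es) (λ x → F (contents (map f (e ∷ es)) x) (contents (map g (e ∷ es)) x)))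
        (cong (F (f e) (g e) +_) (Σ-contents f g F es))

module _ {n : ℕ} where

  source target : Fin n × Fin n → ℕ
  source (u , v) = toℕ u
  target (u , v) = toℕ v

  All-universal : ∀ {A : Set} {P : ℕ → Set} (f : A → ℕ) → (∀ x → P (f x)) → ∀ xs → All P (map f xs)
  All-universal f h []       = []
  All-universal f h (x ∷ xs) = h x ∷ All-universal f h xs

  arcsOf : List (Fin n × Fin n) → Arcs
  arcsOf es = record
    { n = n ; L = length es
    ; src = contents (map source es) ; dst = contents (map target es)
    ; src< = λ e e<L → contents-∈ {_< n} (All-universal source (λ p → toℕ<n (proj₁ p)) es) e (subst (e <_) (sym (length-map source es)) e<L)
    ; dst< = λ e e<L → contents-∈ {_< n} (All-universal target (λ p → toℕ<n (proj₂ p)) es) e (subst (e <_) (sym (length-map target es)) e<L)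
    }

  occurs : Fin n → Fin n → Fin n × Fin n → ℕ
  occurs u v p = δ (source p) (toℕ u) * δ (target p) (toℕ v)

  occurs-≢ : ∀ u v p → p ≢ (u , v) → occurs u v p ≡ 0
  occurs-≢ u v (x , y) p≢ with toℕ x ≟ toℕ u | toℕ y ≟ toℕ v
  ... | no x≢ | _     = cong (_* _) (δ-≢ x≢)
  ... | yes _ | no y≢ = trans (cong (δ (toℕ x) (toℕ u) *_) (δ-≢ y≢)) (*-zeroʳ (δ (toℕ x) (toℕ u)))
  ... | yes x≡ | yes y≡ = contradiction (cong₂ _,_ (toℕ-injective x≡) (toℕ-injective y≡)) p≢

  occurs-≡ : ∀ u v → occurs u v (u , v) ≡ 1
  occurs-≡ u v = cong₂ _*_ (δ-refl (toℕ u)) (δ-refl (toℕ v))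

  occurrences : List (Fin n × Fin n) → Fin n → Fin n → ℕ
  occurrences es u v = sumᴸ (map (occurs u v) es)

  adj-arcsOf : ∀ es u v → Arcs.adj (arcsOf es) (toℕ u) (toℕ v) ≡ occurrences es u v
  adj-arcsOf es u v = Σ-contents source target (λ x y → δ x (toℕ u) * δ y (toℕ v)) es

  absent : ∀ {es u v} → (u , v) ∉ es → occurrences es u v ≡ 0
  absent {[]}     ∉es = refl
  absent {p ∷ es} {u} {v} ∉es = cong₂ _+_ (occurs-≢ u v p λ e → ∉es (here (sym e))) (absent λ ∈es → ∉es (there ∈es))

  present : ∀ {es u v} → Unique es → (u , v) ∈ es → occurrences es u v ≡ 1
  present {p ∷ es} {u} {v} (p∉ ∷ _) (here refl) =
    cong₂ _+_ (occurs-≡ u v) (absent λ ∈es → All.lookup p∉ ∈es refl)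
  present {p ∷ es} {u} {v} (p∉ ∷ uniq) (there ∈es) =
    cong₂ _+_ (occurs-≢ u v p (All.lookup p∉ ∈es)) (present uniq ∈es)

  occurrences-swap : ∀ es u v → occurrences (es ++ map swap es) u v ≡ occurrences es u v + occurrences es v u
  occurrences-swap es u v = trans (split es) (cong (occurrences es u v +_) (swapped es))
    where
    split : ∀ es {fs} → occurrences (es ++ fs) u v ≡ occurrences es u v + occurrences fs u v
    split []       = refl
    split (e ∷ es) = trans (cong (occurs u v e +_) (split es)) (sym (+-assoc (occurs u v e) _ _))
    swapped : ∀ es → occurrences (map swap es) u v ≡ occurrences es v u
    swapped []             = refl
    swapped ((x , y) ∷ es) = cong₂ _+_ (*-comm (δ (toℕ y) (toℕ u)) _) (swapped es)

  AllPairs-∈ : ∀ {R : Rel (Fin n × Fin n) 0ℓ} {es e f} → AllPairs R es → e ∈ es → f ∈ es → e ≢ f → R e f ⊎ R f e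
  AllPairs-∈ (_ ∷ _)  (here refl) (here refl) e≢f = contradiction refl e≢f
  AllPairs-∈ (r ∷ _)  (here refl) (there f∈)  _   = inj₁ (All.lookup r f∈)
  AllPairs-∈ (r ∷ _)  (there e∈)  (here refl) _   = inj₂ (All.lookup r e∈)
  AllPairs-∈ (_ ∷ rs) (there e∈)  (there f∈)  e≢f = AllPairs-∈ rs e∈ f∈ e≢f

module _ (D : Digraph) (as : ArcList D) where
  open Digraph D
  open ArcList as

  adj-directed : ∀ u v → Arcs.adj (arcsOf list) (toℕ u) (toℕ v) ≡ bit (u ⇒? v)
  adj-directed u v with u ⇒? v
  ... | yes r = trans (adj-arcsOf list u v) (present distinct (Equivalence.from (complete u v) r))
  ... | no ¬r = trans (adj-arcsOf list u v) (absent λ ∈es → ¬r (Equivalence.to (complete u v) ∈es))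

module _ (G : Graph) (es : EdgeList G) where
  open Graph G
  open EdgeList es

  private
    unique : Unique list
    unique = AllPairs.map proj₁ distinct

    -- Irreflexivity makes the two pairs different entries, and different entries of an edge list
    -- are never reverses of each other.
    one-way : ∀ {u v} → (u , v) ∈ list → (v , u) ∉ list
    one-way {u} {v} uv∈ vu∈ with AllPairs-∈ distinct uv∈ vu∈ (λ { refl → ~-irrefl u (Equivalence.to (complete u u) (inj₁ uv∈)) })
    ... | inj₁ (_ , ≢) = ≢ refl
    ... | inj₂ (_ , ≢) = ≢ refl

  adj-undirected : ∀ u v → Arcs.adj (arcsOf (list ++ map swap list)) (toℕ u) (toℕ v) ≡ bit (u ~? v)
  adj-undirected u v = trans (adj-arcsOf (list ++ map swap list) u v) (trans (occurrences-swap list u v) cases)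
    where
    cases : occurrences list u v + occurrences list v u ≡ bit (u ~? v)
    cases with u ~? v
    ... | no ¬r = cong₂ _+_ (absent λ ∈es → ¬r (Equivalence.to (complete u v) (inj₁ ∈es)))
                            (absent λ ∈es → ¬r (Equivalence.to (complete u v) (inj₂ ∈es)))
    ... | yes r with Equivalence.from (complete u v) r
    ...   | inj₁ ∈es = cong₂ _+_ (present unique ∈es) (absent (one-way ∈es))
    ...   | inj₂ ∈es = cong₂ _+_ (absent (one-way ∈es)) (present unique ∈es)

-- Reading the input

private variable
  n : ℕ

contents-++ˡ : ∀ xs ys a → a < length xs → contents (xs ++ ys) a ≡ contents xs a
contents-++ˡ (x ∷ xs) ys zero    _        = refl
contents-++ˡ (x ∷ xs) ys (suc a) (s≤s a<) = contents-++ˡ xs ys a a<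

contents-++ʳ : ∀ xs ys a → contents (xs ++ ys) (length xs + a) ≡ contents ys a
contents-++ʳ []       ys a = refl
contents-++ʳ (x ∷ xs) ys a = contents-++ʳ xs ys a

-- Writing entry `x` to cell `x` reproduces the list; beyond its end both sides are the default
-- zero.
Σ-scatter : ∀ xs {m} → length xs ≡ m → ∀ a → Σ< m (λ x → δ x a * contents xs x) ≡ contents xs a
Σ-scatter xs {m} len a with a <? m
... | yes a<m = trans (Σ-cong′ m λ x → cong (_* contents xs x) (δ-sym x a)) (Σ-δ m (contents xs) a<m)
... | no  a≮m = trans (Σ-zero m λ x x<m → cong (_* contents xs x) (δ-≢ (<⇒≢ (<-≤-trans x<m (≮⇒≥ a≮m)))))
                      (sym (contents-beyond xs a (≤-trans (≤-reflexive len) (≮⇒≥ a≮m))))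

Σ-scatter-++ : ∀ xs ys {m} → length xs ≡ m → length ys ≡ m → ∀ a →
  Σ< m (λ x → δ x a * contents xs x + δ (m + x) a * contents ys x) ≡ contents (xs ++ ys) a
Σ-scatter-++ xs ys {m} refl leny a =
  trans (Σ-+ m _ _) (trans (cong (_+ Σ< m (λ x → δ (m + x) a * contents ys x)) (Σ-scatter xs refl a)) second)
  where
  δ-shift : ∀ m x a → δ (m + x) (m + a) ≡ δ x a
  δ-shift zero    x a = refl
  δ-shift (suc m) x a = δ-shift m x a
  second : contents xs a + Σ< m (λ x → δ (m + x) a * contents ys x) ≡ contents (xs ++ ys) a
  second with a <? m
  ... | yes a<m = trans (cong (contents xs a +_) (Σ-zero m λ x _ → cong (_* contents ys x)
                    (δ-≢ (>⇒≢ (<-≤-trans a<m (m≤m+n m x))))))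
                    (trans (+-identityʳ _) (sym (contents-++ˡ xs ys a a<m)))
  ... | no a≮m = begin
    contents xs a + Σ< m (λ x → δ (m + x) a * contents ys x)
      ≡⟨ cong₂ _+_ (contents-beyond xs a (≮⇒≥ a≮m))
           (cong (λ b → Σ< m (λ x → δ (m + x) b * contents ys x)) (sym split)) ⟩
    Σ< m (λ x → δ (m + x) (m + (a ∸ m)) * contents ys x)
      ≡⟨ Σ-cong′ m (λ x → cong (_* contents ys x) (δ-shift m x (a ∸ m))) ⟩
    Σ< m (λ x → δ x (a ∸ m) * contents ys x)
      ≡⟨ Σ-scatter ys leny (a ∸ m) ⟩
    contents ys (a ∸ m)
      ≡⟨ sym (contents-++ʳ xs ys (a ∸ m)) ⟩
    contents (xs ++ ys) (m + (a ∸ m))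
      ≡⟨ cong (contents (xs ++ ys)) split ⟩
    contents (xs ++ ys) a ∎
    where
    open ≡-Reasoning
    split : m + (a ∸ m) ≡ a
    split = m+[n∸m]≡n (≮⇒≥ a≮m)

-- In row 0 of array 0 the address of column `j` is `j` itself, so the raw input words are the
-- columns.
record Input (es : List (Fin n × Fin n)) (M : Mem) : Set where
  field
    edges≡ : M 0 0 1 ≡ length es
    fst≡   : ∀ x → M 0 0 (2 + (x + x)) ≡ contents (map source es) x
    snd≡   : ∀ x → M 0 0 (3 + (x + x)) ≡ contents (map target es) x

input : Expr d → Expr d
input = get 0 (lit 0)

twice : Expr d → Expr d
twice e = bin add e e

-- The two kinds of input differ only in how arcs are listed; all later phases see an arc list of
-- length between m and 2m.
record Loader : Set₁ where
  field
    loading     : Stmt 0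
    arcs        : List (Fin n × Fin n) → List (Fin n × Fin n)
    length≥     : ∀ (es : List (Fin n × Fin n)) → length es ≤ length (arcs es)
    length≤     : ∀ (es : List (Fin n × Fin n)) → length (arcs es) ≤ 2 * length es
    load-reads  : Reads* (_< 1) loading
    load-writes : ∀ {P : ℕ → Set} → P CNT → P SRC → P DST → Writes P loading
    load-cnt    : ∀ {es : List (Fin n × Fin n)} {M} → Input es M → contrib loading [] M CNT 0 0 ≡ length (arcs es)
    load-src    : ∀ {es : List (Fin n × Fin n)} {M} → Input es M →
                  ∀ e → contrib loading [] M SRC e 0 ≡ contents (map source (arcs es)) e
    load-dst    : ∀ {es : List (Fin n × Fin n)} {M} → Input es M →
                  ∀ e → contrib loading [] M DST e 0 ≡ contents (map target (arcs es)) e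
    load-OK     : ∀ {es : List (Fin n × Fin n)} {M B} w N Ω 2≤Ω N≤Ω → Input es M →
                  2 + (length es + length es) ≤ N → 1 ≤ B → length es ≤ B →
                  Machine.OK w N Ω 2≤Ω N≤Ω M loading [] B

module _ {es : List (Fin n × Fin n)} {M : Mem} (I : Input es M) where
  open Input I

  Σ-edges : ∀ f → Σ< (M 0 0 1) f ≡ Σ< (length es) f
  Σ-edges f = cong (λ z → Σ< z f) edges≡

  pos< : ∀ {N x} → 2 + (length es + length es) ≤ N → x < M 0 0 1 → 3 + (x + x) < N
  pos< {N} {x} ≤N x<m = ≤-trans bound ≤N
    where
    x< : x < length es
    x< = subst (x <_) edges≡ x<m
    bound : 2 + (1 + (1 + (x + x))) ≤ 2 + (length es + length es)
    bound = +-monoʳ-≤ 2 (≤-trans (≤-reflexive (cong suc (sym (+-suc x x)))) (+-mono-≤ x< x<))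

directed : Loader
directed = record
  { loading = acc CNT (lit 0) (lit 0) (input (lit 1)) ⨟
           for 0 (lit 0) (lit 1)
             (acc SRC (var #0) (lit 0) (input (bin add (lit 2) (twice (var #0)))) ⨟
              acc DST (var #0) (lit 0) (input (bin add (lit 3) (twice (var #0)))))
  ; arcs = λ es → es
  ; length≥ = λ _ → ≤-refl
  ; length≤ = λ es → m≤m+n (length es) _
  ; load-reads = (tt , tt , ≤-refl , tt , tt) , (≤-refl , tt , tt) ,
      (tt , tt , ≤-refl , tt , tt , tt , tt) , tt , tt , ≤-refl , tt , tt , tt , tt
  ; load-writes = λ c s t → c , s , t
  ; load-cnt = λ {_} {_} {M} I → trans (cong₂ _+_ (trans (*-identityˡ _) (trans (*-identityˡ _) (*-identityˡ _)))
      (Σ-zero (M 0 0 1) λ _ _ → refl)) (trans (+-identityʳ _) (Input.edges≡ I))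
  ; load-src = λ {_} {es} I e → trans (Σ-edges I _) (trans (Σ-cong′ (length es) λ x →
      trans (+-identityʳ _) (trans (*-identityˡ _) (cong (δ x e *_) (trans (*-identityˡ _) (Input.fst≡ I x)))))
      (Σ-scatter (map source es) (length-map source es) e))
  ; load-dst = λ {_} {es} I e → trans (Σ-edges I _) (trans (Σ-cong′ (length es) λ x →
      trans (*-identityˡ _) (cong (δ x e *_) (trans (*-identityˡ _) (Input.snd≡ I x))))
      (Σ-scatter (map target es) (length-map target es) e))
  ; load-OK = load-OK
  }
  where
  load-OK : ∀ {es : List (Fin n × Fin n)} {M B} w N Ω 2≤Ω N≤Ω → Input es M →
            2 + (length es + length es) ≤ N → 1 ≤ B → length es ≤ B → Machine.OK w N Ω 2≤Ω N≤Ω M _ [] B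
  load-OK {es = es} {M} {B} w N Ω 2≤Ω N≤Ω I ≤N 1≤B m≤B =
    acc (tt , tt , 0<N , 0<N) (tt , tt , 0<N , 1<N) 1≤B ⨟
    for (λ _ → 1) (tt , tt , 0<N , 1<N) 1≤B
      (λ x x< → let p = pos< I ≤N x< in
        acc (tt , tt , index p , 0<N) (tt , (tt , tt , tt) , 0<N , <-trans (n<1+n _) p) ≤-refl ⨟
        acc (tt , tt , index p , 0<N) (tt , (tt , tt , tt) , 0<N , p) ≤-refl)
      (≤-trans (≤-reflexive (trans (Σ-const (M 0 0 1) 1) (trans (*-identityʳ _) (Input.edges≡ I)))) m≤B)
    where
    open Machine w N Ω 2≤Ω N≤Ω
    1<N : 1 < N
    1<N = ≤-trans (m≤m+n 2 _) ≤N
    0<N : 0 < N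
    0<N = <⇒≤ 1<N
    index : ∀ {x} → 3 + (x + x) < N → x < N
    index {x} = ≤-<-trans (≤-trans (m≤m+n x x) (m≤n+m (x + x) 3))

undirected : Loader
undirected = record
  { loading = acc CNT (lit 0) (lit 0) (twice (input (lit 1))) ⨟
           for 0 (lit 0) (lit 1)
             (acc SRC (var #0) (lit 0) (input (bin add (lit 2) (twice (var #0)))) ⨟
              acc SRC (bin add (input (lit 1)) (var #0)) (lit 0) (input (bin add (lit 3) (twice (var #0)))) ⨟
              acc DST (var #0) (lit 0) (input (bin add (lit 3) (twice (var #0)))) ⨟
              acc DST (bin add (input (lit 1)) (var #0)) (lit 0) (input (bin add (lit 2) (twice (var #0)))))
  ; arcs = λ es → es ++ map swap es
  ; length≥ = λ es → ≤-trans (m≤m+n (length es) (length es)) (≤-reflexive (sym (len es)))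
  ; length≤ = λ es → ≤-reflexive (trans (len es) (cong (length es +_) (sym (+-identityʳ _))))
  ; load-reads = (tt , tt , (≤-refl , tt , tt) , ≤-refl , tt , tt) , (≤-refl , tt , tt) ,
      (tt , tt , ≤-refl , tt , tt , tt , tt) ,
      (((≤-refl , tt , tt) , tt) , tt , ≤-refl , tt , tt , tt , tt) ,
      (tt , tt , ≤-refl , tt , tt , tt , tt) ,
      (((≤-refl , tt , tt) , tt) , tt , ≤-refl , tt , tt , tt , tt)
  ; load-writes = λ c s t → c , s , s , t , t
  ; load-cnt = λ {_} {es} {M} I → trans (cong₂ _+_ (trans (*-identityˡ _) (trans (*-identityˡ _) (*-identityˡ _)))
      (Σ-zero (M 0 0 1) λ _ _ → refl)) (trans (+-identityʳ _)
        (trans (cong₂ _+_ (Input.edges≡ I) (Input.edges≡ I)) (sym (len es))))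
  ; load-src = λ {_} {es} {M} I e → trans (Σ-edges I _) (trans (Σ-cong′ (length es) λ x →
      cong₂ _+_ (cell≡ (δ x e) (Input.fst≡ I x))
        (trans (+-identityʳ _) (trans (cell≡ (δ (M 0 0 1 + x) e) (Input.snd≡ I x))
          (cong (λ m → δ (m + x) e * contents (map target es) x) (Input.edges≡ I)))))
      (trans (Σ-scatter-++ (map source es) (map target es) (length-map source es) (length-map target es) e)
        (cong (λ xs → contents xs e) (trans (cong (map source es ++_) (map-∘ es)) (sym (map-++ source es (map swap es)))))))
  ; load-dst = λ {_} {es} {M} I e → trans (Σ-edges I _) (trans (Σ-cong′ (length es) λ x →
      cong₂ _+_ (cell≡ (δ x e) (Input.snd≡ I x))
        (trans (cell≡ (δ (M 0 0 1 + x) e) (Input.fst≡ I x))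
          (cong (λ m → δ (m + x) e * contents (map source es) x) (Input.edges≡ I))))
      (trans (Σ-scatter-++ (map target es) (map source es) (length-map target es) (length-map source es) e)
        (cong (λ xs → contents xs e) (trans (cong (map target es ++_) (map-∘ es)) (sym (map-++ target es (map swap es)))))))
  ; load-OK = load-OK
  }
  where
  len : ∀ (es : List (Fin n × Fin n)) → length (es ++ map swap es) ≡ length es + length es
  len es = trans (length-++ es) (cong (length es +_) (length-map swap es))
  cell≡ : ∀ a {y z} → y ≡ z → 1 * (a * (1 * y)) ≡ a * z
  cell≡ a refl = trans (*-identityˡ _) (cong (a *_) (*-identityˡ _))
  load-OK : ∀ {es : List (Fin n × Fin n)} {M B} w N Ω 2≤Ω N≤Ω → Input es M →
            2 + (length es + length es) ≤ N → 1 ≤ B → length es ≤ B → Machine.OK w N Ω 2≤Ω N≤Ω M _ [] B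
  load-OK {es = es} {M} {B} w N Ω 2≤Ω N≤Ω I ≤N 1≤B m≤B =
    acc (tt , tt , 0<N , 0<N) ((tt , tt , 0<N , 1<N) , (tt , tt , 0<N , 1<N)) 1≤B ⨟
    for (λ _ → 1) (tt , tt , 0<N , 1<N) 1≤B
      (λ x x< → let p = pos< I ≤N x< ; p′ = <-trans (n<1+n _) p in
        acc (tt , tt , index p , 0<N) (tt , (tt , tt , tt) , 0<N , p′) ≤-refl ⨟
        acc (((tt , tt , 0<N , 1<N) , tt) , tt , mirror x< , 0<N) (tt , (tt , tt , tt) , 0<N , p) ≤-refl ⨟
        acc (tt , tt , index p , 0<N) (tt , (tt , tt , tt) , 0<N , p) ≤-refl ⨟
        acc (((tt , tt , 0<N , 1<N) , tt) , tt , mirror x< , 0<N) (tt , (tt , tt , tt) , 0<N , p′) ≤-refl)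
      (≤-trans (≤-reflexive (trans (Σ-const (M 0 0 1) 1) (trans (*-identityʳ _) (Input.edges≡ I)))) m≤B)
    where
    open Machine w N Ω 2≤Ω N≤Ω
    1<N : 1 < N
    1<N = ≤-trans (m≤m+n 2 _) ≤N
    0<N : 0 < N
    0<N = <⇒≤ 1<N
    index : ∀ {x} → 3 + (x + x) < N → x < N
    index {x} = ≤-<-trans (≤-trans (m≤m+n x x) (m≤n+m (x + x) 3))
    mirror : ∀ {x} → x < M 0 0 1 → M 0 0 1 + x < N
    mirror {x} x< = <-≤-trans (+-monoʳ-< (M 0 0 1) x<)
      (≤-trans (≤-reflexive (cong₂ _+_ (Input.edges≡ I) (Input.edges≡ I))) (≤-trans (m≤n+m _ 2) ≤N))

-- `ends` is local to `initial` and cannot be named, so it enters as a function with its defining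
-- equation.
module _ (ends : Fin n × Fin n → List ℕ) (ends≡ : ∀ p → ends p ≡ source p ∷ target p ∷ []) where

  contents-sources : ∀ es x → contents (concatMap ends es) (x + x) ≡ contents (map source es) x
  contents-sources []       x       = refl
  contents-sources (p ∷ es) zero    rewrite ends≡ p = refl
  contents-sources (p ∷ es) (suc x) rewrite ends≡ p | +-suc x x = contents-sources es x

  contents-targets : ∀ es x → contents (concatMap ends es) (suc (x + x)) ≡ contents (map target es) x
  contents-targets []       x       = refl
  contents-targets (p ∷ es) zero    rewrite ends≡ p = refl
  contents-targets (p ∷ es) (suc x) rewrite ends≡ p | +-suc x x = contents-targets es x

  length-ends : ∀ es → length (concatMap ends es) ≡ length es + length es
  length-ends []       = refl
  length-ends (p ∷ es) rewrite ends≡ p =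
    cong suc (trans (cong suc (length-ends es)) (sym (+-suc (length es) (length es))))

  ends< : ∀ es → All (_< n) (concatMap ends es)
  ends< []       = []
  ends< (p ∷ es) rewrite ends≡ p = toℕ<n (proj₁ p) ∷ toℕ<n (proj₂ p) ∷ ends< es

-- The whole program and its bounds

total-time : ∀ {e s t₁ t₂ c₁ c₂ c} B → c ≡ e + (c₁ + (c₂ + s)) → 1 ≤ B → t₁ ≤ c₁ * B → t₂ ≤ c₂ * B →
             e + (t₁ + (t₂ + s)) ≤ c * B
total-time {e} {s} {t₁} {t₂} {c₁} {c₂} B refl 1≤B t₁≤ t₂≤ = begin
  e + (t₁ + (t₂ + s))
    ≤⟨ +-mono-≤ (m≤m*n e B) (+-mono-≤ t₁≤ (+-mono-≤ t₂≤ (m≤m*n s B))) ⟩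
  e * B + (c₁ * B + (c₂ * B + s * B))
    ≡⟨ solve 5 (λ e s c₁ c₂ B → e :* B :+ (c₁ :* B :+ (c₂ :* B :+ s :* B)) := (e :+ (c₁ :+ (c₂ :+ s))) :* B)
         refl e s c₁ c₂ B ⟩
  (e + (c₁ + (c₂ + s))) * B ∎
  where
  open ≤-Reasoning
  open +-*-Solver
  instance
    B≢0 : NonZero B
    B≢0 = >-nonZero 1≤B

module Solution (p q : ℕ) (q≤p : q ≤ p) (ℓ : Loader) where
  open Loader ℓ
  open Algorithm p q
  open Discipline p q

  result : Expr 0
  result = cell (result-array 8 length-of-cycle)

  setup readout program : Program
  -- The radix `n + m + m + 2` exceeds every vertex, every arc number (there are at most 2m arcs)
  -- and the last input address 2m + 1.
  setup = const 2 0 ⨾ load 1 2 ⨾ const 2 1 ⨾ load 2 2 ⨾ op add 1 1 2 ⨾ op add 1 1 2 ⨾ const 2 2 ⨾ op add 1 1 2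
  readout = compileE result 2 ⨾ const 0 0 ⨾ op add 0 0 2
  program = setup ⨾ compile (loading ⨟ build) ⨾ compile count ⨾ readout

  -- `Ω` is `Q` to the power `value-exponent`: 2 for `U₀`, then the loading phase, then the counting
  -- phases. Building adds no factor because `Partial` preserves the bound.
  value-exponent total-size : ℕ
  value-exponent = 2 * ((2 + size* loading) * count-growth)
  total-size     = size* (loading ⨟ build) + size* count + size result

  -- Abstract, because comparing these constants in unary is infeasible.
  abstract
    word-exponent time-factor : ℕ
    word-exponent = suc (value-exponent * total-size)
    time-factor   = 8 + (cost (loading ⨟ build) + (cost count + (steps result + 2)))

    word-exponent≡ : word-exponent ≡ suc (value-exponent * total-size)
    word-exponent≡ = refl

    time-factor≡ : time-factor ≡ 8 + (cost (loading ⨟ build) + (cost count + (steps result + 2)))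
    time-factor≡ = refl

  module _ (es : List (Fin n × Fin n)) (w : ℕ) where

    m Q N U₀ U₁ Ω : ℕ
    m  = length es
    Q  = 2 + n + m
    N  = n + m + m + 2
    -- Input words are at most `Q`; the square also covers the radix, which is at most `2 * Q`.
    U₀ = Q ^ 2
    U₁ = U₀ ^ (2 + size* loading)
    Ω  = U₁ ^ count-growth

    G : Arcs
    G = arcsOf (arcs es)

    open Arcs G using (L; adj)
    open Matrices n

    2≤U₀ : 2 ≤ U₀
    2≤U₀ = ≤^1 {Q} (s≤s (s≤s z≤n)) {2} {2} (s≤s (s≤s z≤n)) (s≤s z≤n)

    2≤U₁ : 2 ≤ U₁
    2≤U₁ = ≤^1 2≤U₀ {2} {2 + size* loading} 2≤U₀ (s≤s z≤n)

    1≤count-growth : 1 ≤ count-growth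
    1≤count-growth = *-mono-≤ {1} {2 + size* (enumerate tally p)} (s≤s z≤n)
      (*-mono-≤ {1} {2 + size* seed} (s≤s z≤n) (1≤growth 8 length-of-cycle))

    U₀≤U₁ : U₀ ≤ U₁
    U₀≤U₁ = ≤^1 2≤U₀ {U₀} {2 + size* loading} ≤-refl (s≤s z≤n)

    U₁≤Ω : U₁ ≤ Ω
    U₁≤Ω = ≤^1 2≤U₁ {U₁} {count-growth} ≤-refl 1≤count-growth

    2≤Ω : 2 ≤ Ω
    2≤Ω = ≤-trans 2≤U₁ U₁≤Ω

    N≤U₀ : N ≤ U₀
    N≤U₀ = begin
      n + m + m + 2                ≤⟨ m≤m+n _ (n + 2) ⟩
      n + m + m + 2 + (n + 2)      ≡⟨ solve 2 (λ n m → n :+ m :+ m :+ con 2 :+ (n :+ con 2) := con 2 :* (con 2 :+ n :+ m)) refl n m ⟩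
      2 * Q                        ≤⟨ *-monoˡ-≤ Q {2} {Q} (s≤s (s≤s z≤n)) ⟩
      Q * Q                        ≡⟨ cong (Q *_) (sym (*-identityʳ Q)) ⟩
      U₀                           ∎
      where
      open ≤-Reasoning
      open +-*-Solver

    N≤Ω : N ≤ Ω
    N≤Ω = ≤-trans N≤U₀ (≤-trans U₀≤U₁ U₁≤Ω)

    2m+2≤N : 2 + (m + m) ≤ N
    2m+2≤N = ≤-trans (m≤n+m (2 + (m + m)) n)
      (≤-reflexive (solve 2 (λ n m → n :+ (con 2 :+ (m :+ m)) := n :+ m :+ m :+ con 2) refl n m))
      where open +-*-Solver

    n≤N : n ≤ N
    n≤N = ≤-trans (m≤m+n n (m + m + 2)) (≤-reflexive (solve 2 (λ n m → n :+ (m :+ m :+ con 2) := n :+ m :+ m :+ con 2) refl n m))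
      where open +-*-Solver

    L<N : L < N
    L<N = ≤-trans (s≤s (length≤ es)) (≤-trans (≤-trans (n≤1+n _) (≤-reflexive (cong (λ z → 2 + (m + z)) (+-identityʳ m)))) 2m+2≤N)

    open Machine w N Ω 2≤Ω N≤Ω

    -- Read off the machine memory, so that `Holds` is reflexivity.
    M₀ : Mem
    M₀ a i j = mem (initial n es) (addr a i j)

    input-M₀ : Input es M₀
    input-M₀ = record
      { edges≡ = refl
      ; fst≡   = contents-sources _ (λ _ → refl) es
      ; snd≡   = contents-targets _ (λ _ → refl) es
      }

    M₀≤U₀ : ∀ a i j → M₀ a i j ≤ U₀
    M₀≤U₀ a i j = ≤-trans (contents-All {_≤ Q} z≤n (n≤Q ∷ m≤n+m m (2 + n) ∷ below-Q (ends< _ (λ _ → refl) es)) (addr a i j))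
      (≤^1 {Q} (s≤s (s≤s z≤n)) {Q} {2} ≤-refl (s≤s z≤n))
      where
      n≤Q : n ≤ Q
      n≤Q = ≤-trans (m≤n+m n 2) (m≤m+n (2 + n) m)
      below-Q : ∀ {xs} → All (_< n) xs → All (_≤ Q) xs
      below-Q []       = []
      below-Q (x ∷ xs) = ≤-trans (<⇒≤ x) n≤Q ∷ below-Q xs

    M₀-empty : ∀ a i j → 1 ≤ a → M₀ a i j ≡ 0
    M₀-empty a i j 1≤a = contents-beyond (n ∷ m ∷ _) (addr a i j)
      (≤-trans (≤-reflexive (cong (2 +_) (length-ends _ (λ _ → refl) es))) (≤-trans 2m+2≤N N≤addr))
      where
      1≤N : 1 ≤ N
      1≤N = ≤-trans (m≤m+n 1 _) 2m+2≤N
      N≤addr : N ≤ addr a i j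
      N≤addr = begin
        N                   ≡⟨ sym (*-identityˡ N) ⟩
        1 * N               ≤⟨ *-monoˡ-≤ N (*-mono-≤ 1≤a 1≤N) ⟩
        a * N * N           ≤⟨ *-monoˡ-≤ N (m≤m+n (a * N) i) ⟩
        (a * N + i) * N     ≤⟨ m≤m+n _ j ⟩
        addr a i j          ∎
        where open ≤-Reasoning

    module _ (wide : Q ^ word-exponent ≤ 2 ^ w) where

      all-fits : Fits total-size
      all-fits = fits (begin-strict
        Ω ^ total-size                       ≡⟨ cong (_^ total-size) (trans (^-*-assoc U₀ (2 + size* loading) count-growth)
                                                  (^-*-assoc Q 2 ((2 + size* loading) * count-growth))) ⟩
        (Q ^ value-exponent) ^ total-size    ≡⟨ ^-*-assoc Q value-exponent total-size ⟩
        Q ^ (value-exponent * total-size)    <⟨ ^-monoʳ-< Q (s≤s (s≤s z≤n)) (n<1+n (value-exponent * total-size)) ⟩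
        Q ^ suc (value-exponent * total-size) ≡⟨ cong (Q ^_) (sym word-exponent≡) ⟩
        Q ^ word-exponent                    ≤⟨ wide ⟩
        2 ^ w                                ∎)
        where open ≤-Reasoning

      fits-prelude : Fits (size* (loading ⨟ build))
      fits-prelude = fits-≤ (≤-trans (m≤m+n _ (size* count)) (m≤m+n _ (size result))) all-fits

      fits-count : Fits (size* count)
      fits-count = fits-≤ (≤-trans (m≤n+m (size* count) (size* (loading ⨟ build))) (m≤m+n _ (size result))) all-fits

      fits-result : Fits (size result)
      fits-result = fits-≤ (m≤n+m (size result) (size* (loading ⨟ build) + size* count)) all-fits

      N<2^w : N < 2 ^ w
      N<2^w = fit (≤^1 2≤Ω {N} {size result} N≤Ω (s≤s z≤n)) fits-result

      ready : State
      ready = ⟨ ((((((((λ _ → 0) [ 2 ≔ 0 ]) [ 1 ≔ n ]) [ 2 ≔ 1 ]) [ 2 ≔ m ]) [ 1 ≔ n + m ]) [ 1 ≔ n + m + m ])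
                 [ 2 ≔ 2 ]) [ 1 ≔ N ] , mem (initial n es) ⟩

      run-setup : w ⊢ setup , initial n es ⇓[ 8 ] ready
      run-setup =
        ⇓seq (⇓const (≤N z≤n)) (⇓seq (⇓load (≤N n≤N)) (⇓seq (⇓const (≤N 1≤N))
          (⇓seq (⇓load (≤N (≤-trans (m≤n+m m n) n+m≤N))) (⇓seq (⇓op (≤N n+m≤N)) (⇓seq (⇓op (≤N (m≤m+n (n + m + m) 2)))
            (⇓seq (⇓const (≤N (m≤n+m 2 (n + m + m)))) (⇓op N<2^w)))))))
        where
        ≤N : ∀ {x} → x ≤ N → x < 2 ^ w
        ≤N x≤N = ≤-<-trans x≤N N<2^w
        1≤N : 1 ≤ N
        1≤N = ≤-trans (m≤m+n 1 1) (m≤n+m 2 (n + m + m))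
        n+m≤N : n + m ≤ N
        n+m≤N = ≤-trans (m≤m+n (n + m) m) (m≤m+n (n + m + m) 2)

      ready-Sim : Sim [] ready
      ready-Sim = record { radix = refl ; vars = λ () ; vars≤ = λ () }

      Y : ℕ
      Y = 1 ⊔ L

      m≤Y : m ≤ Y
      m≤Y = ≤-trans (length≥ es) (m≤n⊔m 1 L)

      open Building p q G w N Ω 2≤Ω N≤Ω n≤N L<N 2≤U₁ U₁≤Ω (≤-trans N≤U₀ U₀≤U₁)

      prelude : Exec (loading ⨟ build) [] M₀ (cost loading * Y + cost build * Y) Built
      prelude = exec-seq
        (phase loading 1 2≤U₀ M₀≤U₀ U₁≤Ω load-reads (load-writes ≤-refl (s≤s z≤n) (s≤s z≤n))
          (load-OK w N Ω 2≤Ω N≤Ω input-M₀ 2m+2≤N (m≤m⊔n 1 L) m≤Y)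
          (fits-≤ (m≤n⇒m≤1+n (m≤m+n (size* loading) (size* build))) fits-prelude))
        λ M₁ (e , M₁≤) → exec-build
          (record
            { cnt≡ = trans (e CNT 0 0) (cong₂ _+_ (M₀-empty CNT 0 0 ≤-refl) (load-cnt input-M₀))
            ; src≡ = λ x → trans (e SRC x 0) (cong₂ _+_ (M₀-empty SRC x 0 (s≤s z≤n)) (load-src input-M₀ x))
            ; dst≡ = λ x → trans (e DST x 0) (cong₂ _+_ (M₀-empty DST x 0 (s≤s z≤n)) (load-dst input-M₀ x))
            })
          M₁≤
          (λ a i j 4≤a → trans (e a i j) (cong₂ _+_ (M₀-empty a i j (≤-trans (s≤s z≤n) 4≤a))
            (contrib-quiet loading i j (load-writes (<⇒≢ (≤-trans (s≤s (s≤s z≤n)) 4≤a))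
              (<⇒≢ (≤-trans (s≤s (s≤s (s≤s z≤n))) 4≤a)) (<⇒≢ 4≤a)))))
          (m≤m⊔n 1 L) (m≤n⊔m 1 L)
          (fits-≤ (m≤n⇒m≤1+n (m≤n+m (size* build) (size* loading))) fits-prelude)

      Y≤2m : Y ≤ 2 * (1 ⊔ m)
      Y≤2m = ⊔-lub (≤-trans (m≤m⊔n 1 m) (m≤m+n (1 ⊔ m) _))
        (≤-trans (length≤ es) (*-monoʳ-≤ 2 (m≤n⊔m 1 m)))

      -- The 8 is a 2 from the budget times a 4, as `Y ≤ 2 * (1 ⊔ m)` contributes at most `4 ^ r`.
      -- No logarithmic factor arises, so its exponent is 0.
      time-bound : ∀ {t budget} → t ≤ time-factor * budget → budget ^ suc p ≤ 2 ^ suc p * Y ^ (suc p + p) →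
                   TimeBound (time-factor * 8) 0 (suc p + p) (suc p) m t
      time-bound {t} {budget} t≤ b≤ = begin
        t ^ r
          ≤⟨ ^-monoˡ-≤ r t≤ ⟩
        (time-factor * budget) ^ r
          ≡⟨ ^-distribʳ-* r time-factor budget ⟩
        time-factor ^ r * budget ^ r
          ≤⟨ *-monoʳ-≤ (time-factor ^ r) (≤-trans b≤ (*-monoʳ-≤ (2 ^ r) (^-monoˡ-≤ (r + p) Y≤2m))) ⟩
        time-factor ^ r * (2 ^ r * (2 * (1 ⊔ m)) ^ (r + p))
          ≡⟨ cong (λ z → time-factor ^ r * (2 ^ r * z)) (^-distribʳ-* (r + p) 2 (1 ⊔ m)) ⟩
        time-factor ^ r * (2 ^ r * (2 ^ (r + p) * (1 ⊔ m) ^ (r + p)))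
          ≤⟨ *-monoʳ-≤ (time-factor ^ r) (*-monoʳ-≤ (2 ^ r) (*-monoˡ-≤ _ (^-monoʳ-≤ 2 (+-monoʳ-≤ r (n≤1+n p))))) ⟩
        time-factor ^ r * (2 ^ r * (2 ^ (r + r) * (1 ⊔ m) ^ (r + p)))
          ≡⟨ cong (λ z → time-factor ^ r * (2 ^ r * (z * (1 ⊔ m) ^ (r + p)))) (^-distribˡ-+-* 2 r r) ⟩
        time-factor ^ r * (2 ^ r * (2 ^ r * 2 ^ r * (1 ⊔ m) ^ (r + p)))
          ≡⟨ solve 3 (λ f x y → f :* (x :* (x :* x :* y)) := f :* (x :* (x :* x)) :* y) refl (time-factor ^ r) (2 ^ r) _ ⟩
        time-factor ^ r * (2 ^ r * (2 ^ r * 2 ^ r)) * (1 ⊔ m) ^ (r + p)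
          ≡⟨ cong (λ z → time-factor ^ r * z * (1 ⊔ m) ^ (r + p)) (sym (trans (^-distribʳ-* r 2 4) (cong (2 ^ r *_) (^-distribʳ-* r 2 2)))) ⟩
        time-factor ^ r * 8 ^ r * (1 ⊔ m) ^ (r + p)
          ≡⟨ cong (_* (1 ⊔ m) ^ (r + p)) (trans (sym (^-distribʳ-* r time-factor 8)) (cong (_^ r) (sym (*-identityʳ (time-factor * 8))))) ⟩
        (time-factor * 8 * 1) ^ r * (1 ⊔ m) ^ (r + p) ∎
        where
        open ≤-Reasoning
        open +-*-Solver
        r = suc p

      Correct : Set
      Correct = ∃[ t ] ∃[ σ ] (w ⊢ program , initial n es ⇓[ t ] σ)
                × output σ ≡ trace (pow adj length-of-cycle)
                × TimeBound (time-factor * 8) 0 (suc p + p) (suc p) m t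

      r : ℕ
      r = result-array 8 length-of-cycle

      read : ∀ {t₁ t₂ σ₁ σ₂ budget} {M₂ : Mem} → w ⊢ compile (loading ⨟ build) , ready ⇓[ t₁ ] σ₁ → w ⊢ compile count , σ₁ ⇓[ t₂ ] σ₂ →
             t₁ ≤ cost (loading ⨟ build) * budget → t₂ ≤ cost count * budget → 1 ≤ budget →
             budget ^ suc p ≤ 2 ^ suc p * Y ^ (suc p + p) →
             (∀ a i j → M₂ a i j ≤ Ω) → M₂ r 0 0 ≡ trace (pow adj length-of-cycle) →
             Computes (compileE result 2) σ₂ 2 (M₂ r 0 0) (steps result) → Correct
      read {t₁} {t₂} {budget = budget} run₁ run₂ t₁≤ t₂≤ 1≤b b≤ M₂≤ M₂≡ (computes {σ₃} run₃ mem≡ below₃ result≡) =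
        _ , _ , ⇓seq run-setup (⇓seq run₁ (⇓seq run₂ (⇓seq run₃ (⇓seq (⇓const (≤-<-trans z≤n N<2^w)) (⇓op answer<))))) ,
        trans result≡ M₂≡ , time-bound {budget = budget} (total-time {8} {steps result + 2} {t₁} {t₂} {cost (loading ⨟ build)} {cost count} {time-factor} budget time-factor≡ 1≤b t₁≤ t₂≤) b≤
        where
        answer< : reg σ₃ 2 < 2 ^ w
        answer< = subst (_< 2 ^ w) (sym result≡)
          (fit (≤^1 2≤Ω {y = size result} (M₂≤ r 0 0) (s≤s z≤n)) fits-result)

      finish-run : (A : Adjacency G) → ∀ {D} (1≤D : 1 ≤ D) (D^r≤Y : D ^ suc p ≤ Y) (Y< : Y < suc D ^ suc p) →
        (let open Resources.Threshold p q G A 1≤D D^r≤Y Y<) → ∀ {t₁ σ₁} →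
        w ⊢ compile (loading ⨟ build) , ready ⇓[ t₁ ] σ₁ → t₁ ≤ cost loading * Y + cost build * Y → ready ≈[ 2 ] σ₁ →
        Outcome count σ₁ (cost count * budget)
          (Correctness.Finished p q q≤p G A 1≤D D^r≤Y Y< w N Ω 2≤Ω N≤Ω n≤N L<N r) →
        Correct
      finish-run A 1≤D D^r≤Y Y< run₁ t₁≤ below₁ (outcome run₂ t₂≤ below₂ M₂ holds₂ (M₂≡ , M₂≤)) =
        read {budget = budget} {M₂} run₁ run₂
          (≤-trans t₁≤ (≤-trans (≤-reflexive (sym (*-distribʳ-+ Y (cost loading) (cost build))))
            (*-monoʳ-≤ (cost (loading ⨟ build)) (≤-trans Y≤YZ YZ≤budget))))
          t₂≤ 1≤budget budget-bound M₂≤ M₂≡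
          (compileE-correct {θ = suc r} {M = M₂} M₂≤ result {[]} (≤-refl , tt , tt)
            (tt , tt , 0<N , 0<N) fits-result ≤-refl
            (Sim-resp ≤-refl below₂ (Sim-resp ≤-refl below₁ ready-Sim)) (λ a i j _ → holds₂ a i j tt))
        where
        open Resources.Threshold p q G A 1≤D D^r≤Y Y< using (budget; Y≤YZ; YZ≤budget; 1≤budget; budget-bound)
        0<N : 0 < N
        0<N = ≤-<-trans z≤n L<N

      continue : Outcome (loading ⨟ build) ready (cost loading * Y + cost build * Y) Built →
                 (∃[ D ] 1 ≤ D × D ^ suc p ≤ Y × Y < suc D ^ suc p) → Correct
      continue (outcome {t₁} {σ₁} run₁ t₁≤ below₁ M₁ holds₁ (A , R , M₁≤ , empty)) (D , 1≤D , D^r≤Y , Y<) =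
        finish-run A 1≤D D^r≤Y Y< run₁ t₁≤ below₁
          (Correctness.exec-count p q q≤p G A 1≤D D^r≤Y Y< w N Ω 2≤Ω N≤Ω n≤N L<N 2≤U₁ M₁≤ R empty ≤-refl fits-count
            σ₁ (Sim-resp ≤-refl below₁ ready-Sim) holds₁)

      correct : Correct
      correct = continue (prelude ready ready-Sim (λ _ _ _ _ _ _ → refl)) (root p Y (m≤m⊔n 1 L))

solve-undirected : ∀ p q → q ≤ p → ∀ {k} (3≤k : 3 ≤ k) → suc q + suc p ≡ k →
                   SolvableInÕm^ (suc p + p) (suc p) (CountHomsᵘ (cycle k 3≤k))
solve-undirected p q q≤p 3≤k refl =
  program , word-exponent , time-factor * 8 , 0 , λ (G , es) w wide →
    Product.map₂ (Product.map₂ (Product.map₂ (Product.map₁ λ out →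
      trans out (sym (homCount-undirected G (Arcs.adj (arcsOf (Loader.arcs undirected (EdgeList.list es)))) (adj-undirected G es) (q + suc p) 3≤k)))))
    (correct (EdgeList.list es) w wide)
  where open Solution p q q≤p undirected

solve-directed : ∀ p q → q ≤ p → ∀ {k} → suc q + suc p ≡ k →
                 SolvableInÕm^ (suc p + p) (suc p) (CountHoms (directedCycle k))
solve-directed p q q≤p refl =
  program , word-exponent , time-factor * 8 , 0 , λ (D , as) w wide →
    Product.map₂ (Product.map₂ (Product.map₂ (Product.map₁ λ out →
      trans out (sym (homCount-directed D (Arcs.adj (arcsOf (ArcList.list as))) (adj-directed D as) (q + suc p))))))
    (correct (ArcList.list as) w wide)
  where open Solution p q q≤p directed

module Halves (k : ℕ) where

  p q : ℕ
  -- The cycle has `3 + k` vertices; `suc p` and `suc q` are its halves rounded up and down.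
  p = suc ⌊ k /2⌋
  q = ⌈ k /2⌉

  q≤p : q ≤ p
  q≤p = ≤-pred (⌊n/2⌋≤⌈n/2⌉ (3 + k))

  length≡ : suc q + suc p ≡ 3 + k
  length≡ = ⌊n/2⌋+⌈n/2⌉≡n (3 + k)

  root≡ : suc p ≡ ⌈ 3 + k /2⌉
  root≡ = refl

  -- The exponent 2 - 1/r is the fraction (2r - 1)/r with r = `suc p`.
  exponent≡ : suc p + p ≡ 2 * ⌈ 3 + k /2⌉ ∸ 1
  exponent≡ = trans (+-comm (suc p) p) (cong (λ z → p + suc z) (sym (+-identityʳ p)))

theorem8 : (k : ℕ) (3≤k : 3 ≤ k) →
    SolvableInÕm^ (2 * ⌈ k /2⌉ ∸ 1) ⌈ k /2⌉ (CountHomsᵘ (cycle k 3≤k))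
    × SolvableInÕm^ (2 * ⌈ k /2⌉ ∸ 1) ⌈ k /2⌉ (CountHoms (directedCycle k))
theorem8 (suc (suc (suc k))) 3≤k@(s≤s (s≤s (s≤s _))) =
  subst₂ (λ a b → SolvableInÕm^ a b (CountHomsᵘ (cycle (3 + k) 3≤k))) exponent≡ root≡
    (solve-undirected p q q≤p 3≤k length≡) ,
  subst₂ (λ a b → SolvableInÕm^ a b (CountHoms (directedCycle (3 + k)))) exponent≡ root≡
    (solve-directed p q q≤p length≡)
  where open Halves k
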